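{- Let $m\ge 1$ be an integer, $N=127^m$, $f=\phi(127^m)/18$ and $q=2^f$ (here $\mathrm{ord}_{127^m}(2)=\phi(127^m)/18$, so $N\mid q-1$). Let $\gamma$ be a fixed primitive element of $\mathbb{F}_q$, let $C_i=\{\gamma^{i+jN}\mid 0\le j\le\frac{q-1}{N}-1\}$ for $0\le i\le N-1$, and let $D=\bigcup_{i=0}^{127^{m-1}-1}C_i$. Then $\mathrm{Cay}(\mathbb{F}_q,D)$ is a strongly regular graph.
   Context: $\phi$ is the Euler totient function and $\mathrm{ord}_n(a)$ is the multiplicative order of $a$ modulo $n$. For $D\subseteq\mathbb{F}_q^*$ with $-D=D$, $\mathrm{Cay}(\mathbb{F}_q,D)$ is the graph with vertex set $\mathbb{F}_q$ in which two vertices are adjacent if and only if their difference belongs to $D$. A strongly regular graph srg$(v,k,\lambda,\mu)$ is a simple undirected regular graph of order $v$ and valency $k$, neither complete nor edgeless, such that any two adjacent vertices have exactly $\lambda$ common neighbors and any two (distinct) nonadjacent vertices have exactly $\mu$ common neighbors; connectedness is not required. -}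

module Defs where

open import Algebra.Bundles using (CommutativeRing)
open import Data.Fin.Base using (Fin)
open import Data.List.Base using (filter; length; upTo)
open import Data.Nat.Base as ℕ using (ℕ; NonZero; _≤_; _<_; _∸_; _/_; _%_)
open import Data.Nat.Coprimality using (coprime?)
open import Data.Product.Base using (∃-syntax; _×_; proj₁)
open import Function.Bundles using (Inverse)
open import Level using (Level; _⊔_) renaming (suc to lsuc)
open import Relation.Binary.Bundles using (Setoid)
open import Relation.Binary.Core using (Rel)
open import Relation.Binary.Definitions using (Irreflexive; Symmetric; _Respects₂_)
open import Relation.Binary.PropositionalEquality as ≡ using (_≡_)
import Relation.Binary.Construct.On as On
open import Relation.Nullary.Negation using (¬_)
open import Relation.Unary using (Pred)
import Algebra.Properties.Semiring.Exp as Exp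

private
  variable
    a c p r ℓ : Level

-- Counts 0 ≤ k < n; since gcd 0 1 = 1 this gives φ 1 = 1.
φ : ℕ → ℕ
φ n = length (filter (λ k → coprime? k n) (upTo n))

record IsMultiplicativeOrder (n : ℕ) .{{_ : NonZero n}} (b d : ℕ) : Set where
  field
    positive : 1 ≤ d
    power≡1  : b ℕ.^ d % n ≡ 1 % n
    minimal  : ∀ e → 1 ≤ e → b ℕ.^ e % n ≡ 1 % n → d ≤ e

HasCardinality : Setoid a ℓ → ℕ → Set (a ⊔ ℓ)
HasCardinality S n = Inverse S (≡.setoid (Fin n))

-- Elements of the subset are compared in S; the membership proofs are ignored.
subset : (S : Setoid a ℓ) → Pred (Setoid.Carrier S) p → Setoid (a ⊔ p) ℓ
subset S P = On.setoid S (proj₁ {B = P})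

record FiniteField c ℓ (q : ℕ) : Set (lsuc (c ⊔ ℓ)) where
  field
    commutativeRing : CommutativeRing c ℓ
  open CommutativeRing commutativeRing public
  field
    1≉0         : ¬ (1# ≈ 0#)
    inverse     : ∀ x → ¬ (x ≈ 0#) → ∃[ y ] (x * y ≈ 1#)
    cardinality : HasCardinality setoid q
  open Exp semiring public using (_^_)

module _ {q : ℕ} (F : FiniteField c ℓ q) where
  open FiniteField F

  record IsPrimitive (γ : Carrier) : Set (c ⊔ ℓ) where
    field
      nonzero   : ¬ (γ ≈ 0#)
      generates : ∀ x → ¬ (x ≈ 0#) → ∃[ n ] (γ ^ n ≈ x)

  CyclotomicClass : (γ : Carrier) (N : ℕ) .{{_ : NonZero N}} → ℕ → Pred Carrier ℓ
  CyclotomicClass γ N i x = ∃[ j ] (j < (q ∸ 1) / N × x ≈ γ ^ (i ℕ.+ j ℕ.* N))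

  -- D ⊆ F* and -D = D are not required here: they say exactly that this
  -- relation is irreflexive and symmetric, which IsSRG below demands.
  Cay : Pred Carrier p → Rel Carrier p
  Cay D x y = D (x - y)

module _ (V : Setoid a ℓ) (_~_ : Rel (Setoid.Carrier V) r) where
  open Setoid V

  Complete : Set (a ⊔ ℓ ⊔ r)
  Complete = ∀ x y → ¬ (x ≈ y) → x ~ y

  Edgeless : Set (a ⊔ r)
  Edgeless = ∀ x y → ¬ (x ~ y)

  neighbours : Carrier → Setoid (a ⊔ r) ℓ
  neighbours x = subset V (λ z → x ~ z)

  commonNeighbours : Carrier → Carrier → Setoid (a ⊔ r) ℓ
  commonNeighbours x y = subset V (λ z → x ~ z × y ~ z)

  record IsSRG (v k l μ : ℕ) : Set (a ⊔ ℓ ⊔ r) where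
    field
      respects    : _~_ Respects₂ _≈_
      irreflexive : Irreflexive _≈_ _~_
      symmetric   : Symmetric _~_
      order       : HasCardinality V v
      valency     : ∀ x → HasCardinality (neighbours x) k
      notComplete : ¬ Complete
      notEdgeless : ¬ Edgeless
      adjacent    : ∀ x y → x ~ y → HasCardinality (commonNeighbours x y) l
      nonadjacent : ∀ x y → ¬ (x ≈ y) → ¬ (x ~ y) →
                    HasCardinality (commonNeighbours x y) μ

  IsStronglyRegular : Set (a ⊔ ℓ ⊔ r)
  IsStronglyRegular = ∃[ v ] ∃[ k ] ∃[ l ] ∃[ μ ] IsSRG v k l μ

{-# OPTIONS --safe #-}
module Submission where

-- Let L = 127^(m-1), N = 127 L and η_a = Σ_{x ∈ C_a} ψ(x) for the canonical additive character ψ. Since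
-- ⟨2⟩ contains every residue ≡ 1 mod 127 modulo N, η_(j+L) = η_j unless L ∣ j. Hence the eigenvalue
-- ψ(γ^a D) is the sum of a constant and one of the 127 integers u_t = η_(Lt), and D defines a strongly
-- regular graph as soon as u takes two values.
--
-- By orthogonality, 127 Σ u_t² - (Σ u_t)² = 126 q. By Stickelberger's theorem, the Gauss sums of order N
-- are divisible by 2^θ, where 4 q = 128 · 2^(2θ): the digit sums of the exponents are controlled because the
-- orbit of j under doubling modulo N is a union of classes modulo 127. So u_t = u_0 + 2^θ v_t with integers
-- v_t such that 127 Σ v_t² - (Σ v_t)² = 63 · 64. Then Σ v_t ≡ ±63 mod 127, and after a change of sign and
-- a translation Σ v_t = Σ v_t² = 63, which forces v_t ∈ {0,1}. Only 127 = 2^7 - 1 being prime is used.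
--
-- Stickelberger's divisibility is proved by adding binary digits to the exponent: doubling it does not
-- change the Gauss sum, and adding 1 to an even exponent multiplies it by an even Gauss sum, up to a Jacobi
-- sum that is ≡ 1 modulo 2.

open import Algebra.Bundles using (CommutativeRing)
open import Algebra.Structures using (IsCommutativeRing)
open import Data.Empty using (⊥-elim)
open import Data.Fin.Base as Fin using (Fin; zero; suc; toℕ; fromℕ<)
import Data.Fin.Permutation as Perm
import Data.Fin.Properties as Fin
open import Data.Integer.Base as ℤ using (ℤ; +_; -[1+_]; 0ℤ; 1ℤ; -1ℤ)
import Data.Integer.DivMod as ℤDM
open import Data.Integer.Divisibility.Signed as ℤD using (∣⇒∣ᵤ; ∣ᵤ⇒∣)
import Data.Integer.Properties as ℤ
open import Data.Integer.Tactic.RingSolver using (solve-∀)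
open import Data.List.Base using (_∷_; applyUpTo; filter; length)
open import Data.Nat.Base as ℕ using (ℕ; zero; suc; NonZero; _≤_; _<_; z≤n; s≤s; _∸_; _/_; _%_)
open import Data.Nat.Coprimality using (Coprime; coprime?; coprime-divisor)
import Data.Nat.DivMod as DM
open import Data.Nat.Divisibility as ℕD using (_∣_; _∤_; divides)
open import Data.Nat.Primality using (Prime; prime?; prime[2]; euclidsLemma; prime⇒irreducible; prime⇒nonTrivial; prime⇒nonZero)
open import Data.Nat.Properties as ℕ using (m^n≢0)
open import Data.Nat.Tactic.RingSolver using () renaming (solve-∀ to solve-ℕ)
open import Data.Product.Base using (∃-syntax; _×_; _,_; proj₁; proj₂)
open import Data.Sum.Base using (_⊎_; inj₁; inj₂; [_,_]′)
open import Defs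
open import Function.Base using (_∘_; id)
open import Function.Bundles using (Inverse)
open import Level using (Level)
open import Relation.Binary.Core using (Rel)
open import Relation.Binary.Definitions using (tri<; tri≈; tri>)
open import Relation.Binary.PropositionalEquality as ≡ using (_≡_; cong; cong₂; subst; subst₂)
open import Relation.Nullary using (¬_; Dec; yes; no)
open import Relation.Nullary.Decidable using (_×-dec_; _⊎-dec_; from-yes; map′)
open import Relation.Unary using (Decidable; Pred; ⋃)

-- Finite sums

-- The Gauss sums live in a cyclotomic ring where 2 is not prime, but only congruences between
-- rational integers modulo 2^θ are wanted. So the multiplicative characters take values in
-- Teichmüller lifts modulo 2^θ: polynomials in one integer matrix that reduces modulo 2 to
-- multiplication by γ. There divisibility by 2^θ means being 0, and factors that are nonzero in F
-- can be cancelled. Write q - 1 = M N and p = 127. The Gauss sums of exponent M j with p ∤ j vanish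
-- in that ring. The others have order dividing L and do not distinguish the residues t L modulo N,
-- so Fourier inversion gives N u_t a value independent of t, and N is odd. With p = 2^r - 1 and L =
-- 1 + 2g, the exponent is θ = 1 + r g. It comes from the sum of the residues 2^i j modulo N: these
-- fill whole classes modulo p, and the classes themselves form an orbit under doubling modulo p,
-- whose sum is at least p. As q = 2^(r L), this gives 4q = 2^(2θ) 2^r.

record Reindexing (n : ℕ) : Set where
  field
    to   : ℕ → ℕ
    from : ℕ → ℕ
    to<     : ∀ k → k < n → to k < n
    from<   : ∀ k → k < n → from k < n
    to-from : ∀ k → k < n → to (from k) ≡ k
    from-to : ∀ k → k < n → from (to k) ≡ k

  permutation : Perm.Permutation n n
  permutation = Perm.permutation (lift to to<) (lift from from<)
    (lift-inv to to< from from< to-from) (lift-inv from from< to to< from-to)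
    where
    lift : (g : ℕ → ℕ) → (∀ k → k < n → g k < n) → Fin n → Fin n
    lift g g< i = fromℕ< (g< (toℕ i) (Fin.toℕ<n i))
    toℕ-lift : ∀ g g< i → toℕ (lift g g< i) ≡ g (toℕ i)
    toℕ-lift g g< i = Fin.toℕ-fromℕ< _
    lift-inv : ∀ g g< h h< → (∀ k → k < n → g (h k) ≡ k) → ∀ i → lift g g< (lift h h< i) ≡ i
    lift-inv g g< h h< inv i = Fin.toℕ-injective (≡.trans (toℕ-lift g g< _)
      (≡.trans (cong g (toℕ-lift h h< i)) (inv (toℕ i) (Fin.toℕ<n i))))

-- An injective self-map of {0,…,n-1} is onto, by the pigeonhole principle applied
-- to the n+1 values k, g 0, …, g (n-1).
injective⇒surjective : ∀ n (g : ℕ → ℕ) → (∀ k → k < n → g k < n) →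
  (∀ i j → i < n → j < n → g i ≡ g j → i ≡ j) → ∀ k → k < n → ∃[ i ] (i < n × g i ≡ k)
injective⇒surjective n g g< inj k k<n with Fin.pigeonhole (ℕ.n<1+n n) h
  where
  h : Fin (suc n) → Fin n
  h zero    = fromℕ< k<n
  h (suc i) = fromℕ< (g< (toℕ i) (Fin.toℕ<n i))
... | zero , suc j , _ , eq = toℕ j , Fin.toℕ<n j ,
        ≡.sym (≡.trans (≡.sym (Fin.toℕ-fromℕ< k<n)) (≡.trans (cong toℕ eq) (Fin.toℕ-fromℕ< _)))
... | suc i , suc j , s≤s i<j , eq = ⊥-elim (ℕ.<-irrefl (inj _ _ (Fin.toℕ<n i) (Fin.toℕ<n j)
        (≡.trans (≡.sym (Fin.toℕ-fromℕ< (g< (toℕ i) (Fin.toℕ<n i)))) (≡.trans (cong toℕ eq) (Fin.toℕ-fromℕ< _)))) i<j)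

injective⇒reindexing : ∀ n (g : ℕ → ℕ) → (∀ k → k < n → g k < n) →
  (∀ i j → i < n → j < n → g i ≡ g j → i ≡ j) → ∃[ ρ ] (∀ k → Reindexing.to {n} ρ k ≡ g k)
injective⇒reindexing n g g< inj = record
  { to = g ; from = inv ; to< = g< ; from< = inv<
  ; to-from = to-from
  ; from-to = λ k k<n → inj _ _ (inv< _ (g< k k<n)) k<n (to-from _ (g< k k<n)) } , λ k → ≡.refl
  where
  inv′ : ∀ k → Dec (k < n) → ℕ
  inv′ k (yes p) = proj₁ (injective⇒surjective n g g< inj k p)
  inv′ k (no _)  = 0
  inv : ℕ → ℕ
  inv k = inv′ k (k ℕ.<? n)
  inv< : ∀ k → k < n → inv k < n
  inv< k k<n with k ℕ.<? n
  ... | yes p = proj₁ (proj₂ (injective⇒surjective n g g< inj k p))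
  ... | no ¬p = ⊥-elim (¬p k<n)
  to-from : ∀ k → k < n → g (inv k) ≡ k
  to-from k k<n with k ℕ.<? n
  ... | yes p = proj₂ (proj₂ (injective⇒surjective n g g< inj k p))
  ... | no ¬p = ⊥-elim (¬p k<n)

module Sum {c ℓ : Level} (R : CommutativeRing c ℓ) where
  open CommutativeRing R
  open import Algebra.Properties.Semiring.Sum semiring as S using (sum)
  open import Algebra.Properties.Semiring.Exp semiring using (_^_)
  open import Algebra.Properties.Ring ring using (-‿distribˡ-*)
  open import Relation.Binary.Reasoning.Setoid setoid

  -- Opaque, lest sums with a literal number of terms be unfolded.
  opaque
    Σ< : ℕ → (ℕ → Carrier) → Carrier
    Σ< n f = sum {n} (f ∘ toℕ)

  opaque
    unfolding Σ<

    Σ-empty-≡ : ∀ f → Σ< 0 f ≡ 0#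
    Σ-empty-≡ f = ≡.refl

    Σ-cons-≡ : ∀ n f → Σ< (suc n) f ≡ f 0 + Σ< n (f ∘ suc)
    Σ-cons-≡ n f = ≡.refl

    Σ-empty : ∀ f → Σ< 0 f ≈ 0#
    Σ-empty f = refl

    Σ-cons : ∀ n f → Σ< (suc n) f ≈ f 0 + Σ< n (f ∘ suc)
    Σ-cons n f = refl

    Σ-cong : ∀ n {f g : ℕ → Carrier} → (∀ k → k < n → f k ≈ g k) → Σ< n f ≈ Σ< n g
    Σ-cong n f≈g = S.sum-cong-≋ {n} (λ i → f≈g (toℕ i) (Fin.toℕ<n i))

    Σ-+ : ∀ n (f g : ℕ → Carrier) → Σ< n (λ k → f k + g k) ≈ Σ< n f + Σ< n g
    Σ-+ n f g = S.∑-distrib-+ {n} (f ∘ toℕ) (g ∘ toℕ)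

    Σ-*ˡ : ∀ n x (f : ℕ → Carrier) → x * Σ< n f ≈ Σ< n (λ k → x * f k)
    Σ-*ˡ n x f = S.*-distribˡ-sum {n} x (f ∘ toℕ)

    Σ-*ʳ : ∀ n x (f : ℕ → Carrier) → Σ< n f * x ≈ Σ< n (λ k → f k * x)
    Σ-*ʳ n x f = S.*-distribʳ-sum {n} x (f ∘ toℕ)

    Σ-0 : ∀ n → Σ< n (λ _ → 0#) ≈ 0#
    Σ-0 n = S.sum-replicate-zero n

    Σ-swap : ∀ m n (f : ℕ → ℕ → Carrier) →
             Σ< m (λ i → Σ< n (λ j → f i j)) ≈ Σ< n (λ j → Σ< m (λ i → f i j))
    Σ-swap m n f = S.∑-comm {m} {n} (λ i j → f (toℕ i) (toℕ j))

    Σ-reindex : ∀ {n} (ρ : Reindexing n) (f : ℕ → Carrier) → Σ< n (f ∘ Reindexing.to ρ) ≈ Σ< n f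
    Σ-reindex {n} ρ f = sym (trans (S.sum-permute (f ∘ toℕ) (Reindexing.permutation ρ))
      (S.sum-cong-≋ {n} (λ i → reflexive (cong f (Fin.toℕ-fromℕ< _)))))

    Σ-split : ∀ m n (f : ℕ → Carrier) → Σ< (m ℕ.+ n) f ≈ Σ< m f + Σ< n (λ k → f (m ℕ.+ k))
    Σ-split zero    n f = sym (+-identityˡ _)
    Σ-split (suc m) n f = trans (+-congˡ (Σ-split m n (f ∘ suc))) (sym (+-assoc _ _ _))

    Σ-snoc : ∀ n (f : ℕ → Carrier) → Σ< (suc n) f ≈ Σ< n f + f n
    Σ-snoc zero    f = trans (+-identityʳ _) (sym (+-identityˡ _))
    Σ-snoc (suc n) f = trans (+-congˡ (Σ-snoc n (f ∘ suc))) (sym (+-assoc _ _ _))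

  Σ-cong′ : ∀ n {f g : ℕ → Carrier} → (∀ k → f k ≈ g k) → Σ< n f ≈ Σ< n g
  Σ-cong′ n f≈g = Σ-cong n (λ k _ → f≈g k)

  Σ-zero : ∀ n {f : ℕ → Carrier} → (∀ k → k < n → f k ≈ 0#) → Σ< n f ≈ 0#
  Σ-zero n f≈0 = trans (Σ-cong n f≈0) (Σ-0 n)

  Σ-- : ∀ n (f : ℕ → Carrier) → Σ< n (λ k → - f k) ≈ - Σ< n f
  Σ-- n f = begin
    Σ< n (λ k → - f k) ≈⟨ Σ-cong′ n (λ k → -‿cong (*-identityˡ (f k))) ⟨
    Σ< n (λ k → - (1# * f k)) ≈⟨ Σ-cong′ n (λ k → -‿distribˡ-* 1# (f k)) ⟩
    Σ< n (λ k → - 1# * f k) ≈⟨ Σ-*ˡ n (- 1#) f ⟨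
    - 1# * Σ< n f ≈⟨ -‿distribˡ-* 1# _ ⟨
    - (1# * Σ< n f) ≈⟨ -‿cong (*-identityˡ _) ⟩
    - Σ< n f ∎

  Σ-minus : ∀ n (f g : ℕ → Carrier) → Σ< n (λ k → f k - g k) ≈ Σ< n f - Σ< n g
  Σ-minus n f g = trans (Σ-+ n f (λ k → - g k)) (+-congˡ (Σ-- n g))

  Σ-product : ∀ m n (f g : ℕ → Carrier) → Σ< m f * Σ< n g ≈ Σ< m (λ i → Σ< n (λ j → f i * g j))
  Σ-product m n f g = trans (Σ-*ʳ m (Σ< n g) f) (Σ-cong′ m (λ i → Σ-*ˡ n (f i) g))

  Σ-block : ∀ m n (f : ℕ → Carrier) → Σ< (m ℕ.* n) f ≈ Σ< m (λ i → Σ< n (λ j → f (i ℕ.* n ℕ.+ j)))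
  Σ-block zero    n f = trans (Σ-empty _) (sym (Σ-empty _))
  Σ-block (suc m) n f = trans (Σ-split n (m ℕ.* n) f) (trans (+-congˡ (trans (Σ-block m n (λ k → f (n ℕ.+ k)))
    (Σ-cong′ m (λ i → Σ-cong′ n (λ j → reflexive (cong f (≡.sym (ℕ.+-assoc n (i ℕ.* n) j)))))))) (sym (Σ-cons m _)))

  Σ-periodic : ∀ n (f : ℕ → Carrier) → (∀ k → f (k ℕ.+ n) ≈ f k) → ∀ a → Σ< n (λ k → f (a ℕ.+ k)) ≈ Σ< n f
  Σ-periodic n f per zero    = refl
  Σ-periodic n f per (suc a) = trans shift (Σ-periodic n f per a)
    where
    h : ℕ → Carrier
    h k = f (a ℕ.+ k)
    h-n : h n ≈ h 0
    h-n = trans (per a) (reflexive (cong f (≡.sym (ℕ.+-identityʳ a))))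
    shift : Σ< n (λ k → f (suc a ℕ.+ k)) ≈ Σ< n h
    shift = begin
      Σ< n (λ k → f (suc (a ℕ.+ k))) ≈⟨ Σ-cong′ n (λ k → reflexive (cong f (≡.sym (ℕ.+-suc a k)))) ⟩
      Σ< n (h ∘ suc) ≈⟨ +-identityʳ _ ⟨
      Σ< n (h ∘ suc) + 0# ≈⟨ +-congˡ (-‿inverseʳ (h 0)) ⟨
      Σ< n (h ∘ suc) + (h 0 - h 0) ≈⟨ +-assoc _ _ _ ⟨
      Σ< n (h ∘ suc) + h 0 - h 0 ≈⟨ +-congʳ (trans (+-comm _ _) (sym (Σ-cons n h))) ⟩
      Σ< (suc n) h - h 0 ≈⟨ +-congʳ (Σ-snoc n h) ⟩
      Σ< n h + h n - h 0 ≈⟨ +-assoc _ _ _ ⟩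
      Σ< n h + (h n - h 0) ≈⟨ +-congˡ (trans (+-congʳ h-n) (-‿inverseʳ (h 0))) ⟩
      Σ< n h + 0# ≈⟨ +-identityʳ _ ⟩
      Σ< n h ∎

  Σ-only : ∀ n j (f : ℕ → Carrier) → j < n → (∀ k → k < n → ¬ k ≡ j → f k ≈ 0#) → Σ< n f ≈ f j
  Σ-only (suc n) zero f _ f≈0 =
    trans (Σ-cons n f) (trans (+-congˡ (Σ-zero n (λ k k<n → f≈0 (suc k) (s≤s k<n) (λ ())))) (+-identityʳ _))
  Σ-only (suc n) (suc j) f (s≤s j<n) f≈0 =
    trans (Σ-cons n f) (trans (+-cong (f≈0 0 (s≤s z≤n) (λ ())) (Σ-only n j (f ∘ suc) j<n
      (λ k k<n k≢j → f≈0 (suc k) (s≤s k<n) (k≢j ∘ ℕ.suc-injective)))) (+-identityˡ _))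

  -- Both sides are the sum of the powers with exponents 0, ..., n. This form of (x - 1) S = x^n - 1
  -- avoids subtraction.
  geometric : ∀ n x → x * Σ< n (x ^_) + 1# ≈ x ^ n + Σ< n (x ^_)
  geometric n x = begin
    x * Σ< n (x ^_) + 1# ≈⟨ +-congʳ (Σ-*ˡ n x (x ^_)) ⟩
    Σ< n (λ k → x ^ suc k) + 1# ≈⟨ trans (+-comm _ _) (sym (Σ-cons n (x ^_))) ⟩
    Σ< (suc n) (x ^_) ≈⟨ Σ-snoc n (x ^_) ⟩
    Σ< n (x ^_) + x ^ n ≈⟨ +-comm _ _ ⟩
    x ^ n + Σ< n (x ^_) ∎

-- The multiplicative group of a finite field

least : ∀ {p} {P : ℕ → Set p} → (∀ k → Dec (P k)) → ∀ k → P k →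
        ∃[ d ] (d ≤ k × P d × (∀ e → e < d → ¬ P e))
least P? zero Pk = zero , z≤n , Pk , λ _ ()
least {P = P} P? (suc k) Pk with P? 0
... | yes P0 = zero , z≤n , P0 , λ _ ()
... | no ¬P0 with least {P = P ∘ suc} (P? ∘ suc) k Pk
...   | d , d≤k , Pd , below = suc d , s≤s d≤k , Pd , λ { zero _ → ¬P0 ; (suc e) (s≤s e<d) → below e e<d }

module FieldTheory {c ℓ : Level} {q : ℕ} (F : FiniteField c ℓ q) where
  open FiniteField F
  open import Relation.Binary.Reasoning.Setoid setoid
  open import Algebra.Properties.Ring ring using (-‿distribˡ-*)
  open import Algebra.Properties.Group +-group using (x∙y⁻¹≈ε⇒x≈y)
  open import Algebra.Properties.Semiring.Exp semiring using (^-homo-*)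

  _≈?_ : ∀ x y → Dec (x ≈ y)
  x ≈? y = map′ (λ eq → trans (sym (strictlyInverseʳ x)) (trans (from-cong eq) (strictlyInverseʳ y))) to-cong
    (to x Fin.≟ to y)
    where open Inverse cardinality

  *-cancelˡ : ∀ {x y z} → ¬ x ≈ 0# → x * y ≈ x * z → y ≈ z
  *-cancelˡ {x} {y} {z} x≉0 eq with inverse x x≉0
  ... | x⁻¹ , inv = begin
    y ≈⟨ unit y ⟨
    x⁻¹ * (x * y) ≈⟨ *-congˡ eq ⟩
    x⁻¹ * (x * z) ≈⟨ unit z ⟩
    z ∎
    where
    unit : ∀ w → x⁻¹ * (x * w) ≈ w
    unit w = trans (sym (*-assoc _ _ _)) (trans (*-congʳ (trans (*-comm _ _) inv)) (*-identityˡ w))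

  x*y≈0⇒y≈0 : ∀ {x y} → ¬ x ≈ 0# → x * y ≈ 0# → y ≈ 0#
  x*y≈0⇒y≈0 x≉0 eq = *-cancelˡ x≉0 (trans eq (sym (zeroʳ _)))

  *-≉0 : ∀ {x y} → ¬ x ≈ 0# → ¬ y ≈ 0# → ¬ x * y ≈ 0#
  *-≉0 x≉0 y≉0 = y≉0 ∘ x*y≈0⇒y≈0 x≉0

  ^-≉0 : ∀ {x} k → ¬ x ≈ 0# → ¬ x ^ k ≈ 0#
  ^-≉0 zero    x≉0 = 1≉0
  ^-≉0 (suc k) x≉0 = *-≉0 x≉0 (^-≉0 k x≉0)

  xy≈y⇒y≈0 : ∀ {x y} → ¬ x ≈ 1# → x * y ≈ y → y ≈ 0#
  xy≈y⇒y≈0 {x} {y} x≉1 eq = x*y≈0⇒y≈0 {x = x - 1#} (x≉1 ∘ x∙y⁻¹≈ε⇒x≈y x 1#) (begin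
    (x - 1#) * y ≈⟨ distribʳ _ _ _ ⟩
    x * y + - 1# * y ≈⟨ +-cong eq (trans (sym (-‿distribˡ-* _ _)) (-‿cong (*-identityˡ y))) ⟩
    y - y ≈⟨ -‿inverseʳ y ⟩
    0# ∎)

  x*x≈x⇒x≈0∨1 : ∀ {x} → x * x ≈ x → x ≈ 0# ⊎ x ≈ 1#
  x*x≈x⇒x≈0∨1 {x} eq with x ≈? 1#
  ... | yes x≈1 = inj₂ x≈1
  ... | no  x≉1 = inj₁ (xy≈y⇒y≈0 x≉1 eq)

  ^-cancel : ∀ {x} i j → ¬ x ≈ 0# → i ≤ j → x ^ i ≈ x ^ j → x ^ (j ∸ i) ≈ 1#
  ^-cancel {x} i j x≉0 i≤j eq = sym (*-cancelˡ (^-≉0 i x≉0) (begin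
    x ^ i * 1# ≈⟨ *-identityʳ _ ⟩
    x ^ i ≈⟨ eq ⟩
    x ^ j ≡⟨ cong (x ^_) (≡.sym (ℕ.m+[n∸m]≡n i≤j)) ⟩
    x ^ (i ℕ.+ (j ∸ i)) ≈⟨ ^-homo-* x i (j ∸ i) ⟩
    x ^ i * x ^ (j ∸ i) ∎))

  1^k≈1 : ∀ k → 1# ^ k ≈ 1#
  1^k≈1 zero    = refl
  1^k≈1 (suc k) = trans (*-identityˡ _) (1^k≈1 k)

  sum-of-powers : ∀ n x → ¬ x ≈ 1# → x ^ n ≈ 1# → Sum.Σ< commutativeRing n (x ^_) ≈ 0#
  sum-of-powers n x x≉1 xⁿ≈1 = xy≈y⇒y≈0 x≉1 (begin
    x * S ≈⟨ +-identityʳ _ ⟨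
    x * S + 0# ≈⟨ +-congˡ (-‿inverseʳ 1#) ⟨
    x * S + (1# - 1#) ≈⟨ +-assoc _ _ _ ⟨
    x * S + 1# - 1# ≈⟨ +-congʳ (trans (geometric n x) (trans (+-congʳ xⁿ≈1) (+-comm _ _))) ⟩
    S + 1# - 1# ≈⟨ trans (+-assoc _ _ _) (+-congˡ (-‿inverseʳ 1#)) ⟩
    S + 0# ≈⟨ +-identityʳ _ ⟩
    S ∎)
    where
    open Sum commutativeRing
    S = Σ< n (x ^_)

module Primitive {c ℓ : Level} {q : ℕ} (F : FiniteField c ℓ q)
                 (γ : FiniteField.Carrier F) (prim : IsPrimitive F γ) where
  open FiniteField F
  open FieldTheory F public
  open IsPrimitive prim
  open import Relation.Binary.Reasoning.Setoid setoid
  open import Algebra.Properties.Semiring.Exp semiring using (^-congˡ; ^-homo-*; ^-assocʳ)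

  γ^-≉0 : ∀ k → ¬ γ ^ k ≈ 0#
  γ^-≉0 k = ^-≉0 k nonzero

  private
    card : Carrier → Fin q
    card = Inverse.to cardinality

    card-injective : ∀ {x y} → card x ≡ card y → x ≈ y
    card-injective {x} {y} eq = trans (sym (strictlyInverseʳ x)) (trans (from-cong eq) (strictlyInverseʳ y))
      where open Inverse cardinality

    somePeriod : ∃[ k ] γ ^ suc k ≈ 1#
    somePeriod with Fin.pigeonhole (ℕ.n<1+n q) (λ i → card (γ ^ toℕ i))
    ... | i , j , i<j , eq = toℕ j ∸ suc (toℕ i) , trans (reflexive (cong (γ ^_) (≡.sym (ℕ.+-∸-assoc 1 i<j))))
            (^-cancel (toℕ i) (toℕ j) nonzero (ℕ.<⇒≤ i<j) (card-injective eq))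

    opaque
      leastPeriod : ∃[ d ] (d ≤ proj₁ somePeriod × γ ^ suc d ≈ 1# × (∀ e → e < d → ¬ γ ^ suc e ≈ 1#))
      leastPeriod = least {P = λ k → γ ^ suc k ≈ 1#} (λ k → (γ ^ suc k) ≈? 1#) (proj₁ somePeriod) (proj₂ somePeriod)

  -- The order of γ, found by search below a period that the pigeonhole principle supplies; that it
  -- equals q - 1 is `q≡1+n`.
  n : ℕ
  n = suc (proj₁ leastPeriod)

  γⁿ≈1 : γ ^ n ≈ 1#
  γⁿ≈1 = proj₁ (proj₂ (proj₂ leastPeriod))

  γ^≉1 : ∀ k → 0 < k → k < n → ¬ γ ^ k ≈ 1#
  γ^≉1 (suc k) _ (s≤s k<n) = proj₂ (proj₂ (proj₂ leastPeriod)) k k<n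

  γ^-periodic : ∀ a k → γ ^ (a ℕ.+ k ℕ.* n) ≈ γ ^ a
  γ^-periodic a k = begin
    γ ^ (a ℕ.+ k ℕ.* n) ≈⟨ ^-homo-* γ a (k ℕ.* n) ⟩
    γ ^ a * γ ^ (k ℕ.* n) ≡⟨ cong (λ e → γ ^ a * γ ^ e) (ℕ.*-comm k n) ⟩
    γ ^ a * γ ^ (n ℕ.* k) ≈⟨ *-congˡ (^-assocʳ γ n k) ⟨
    γ ^ a * (γ ^ n) ^ k ≈⟨ *-congˡ (trans (^-congˡ k γⁿ≈1) (1^k≈1 k)) ⟩
    γ ^ a * 1# ≈⟨ *-identityʳ _ ⟩
    γ ^ a ∎

  γ^-% : ∀ k → γ ^ k ≈ γ ^ (k % n)
  γ^-% k = trans (reflexive (cong (γ ^_) (DM.m≡m%n+[m/n]*n k n))) (γ^-periodic (k % n) (k / n))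

  private
    γ^-injective-≤ : ∀ i j → j < n → i ≤ j → γ ^ i ≈ γ ^ j → i ≡ j
    γ^-injective-≤ i j j<n i≤j eq with ℕ.m≤n⇒m<n∨m≡n i≤j
    ... | inj₂ i≡j = i≡j
    ... | inj₁ i<j = ⊥-elim (γ^≉1 (j ∸ i) (ℕ.m<n⇒0<n∸m i<j) (ℕ.≤-<-trans (ℕ.m∸n≤m j i) j<n)
                       (^-cancel i j nonzero i≤j eq))

  γ^-injective : ∀ i j → i < n → j < n → γ ^ i ≈ γ ^ j → i ≡ j
  γ^-injective i j i<n j<n eq with ℕ.≤-total i j
  ... | inj₁ i≤j = γ^-injective-≤ i j j<n i≤j eq
  ... | inj₂ j≤i = ≡.sym (γ^-injective-≤ j i i<n j≤i (sym eq))

  γ^≈⇒%≡ : ∀ i j → γ ^ i ≈ γ ^ j → i % n ≡ j % n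
  γ^≈⇒%≡ i j eq = γ^-injective _ _ (DM.m%n<n i n) (DM.m%n<n j n) (trans (sym (γ^-% i)) (trans eq (γ^-% j)))

  log : ∀ x → ¬ x ≈ 0# → ∃[ k ] (k < n × γ ^ k ≈ x)
  log x x≉0 with generates x x≉0
  ... | k , eq = k % n , DM.m%n<n k n , trans (sym (γ^-% k)) eq

  -- This enumeration of F puts 0 first, so that a sum over F is one term followed by a sum over the
  -- exponents of γ.
  elt : ℕ → Carrier
  elt zero    = 0#
  elt (suc k) = γ ^ k

  idx : Carrier → ℕ
  idx x with x ≈? 0#
  ... | yes _  = 0
  ... | no x≉0 = suc (proj₁ (log x x≉0))

  idx< : ∀ x → idx x < suc n
  idx< x with x ≈? 0#
  ... | yes _  = s≤s z≤n
  ... | no x≉0 = s≤s (proj₁ (proj₂ (log x x≉0)))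

  elt-idx : ∀ x → elt (idx x) ≈ x
  elt-idx x with x ≈? 0#
  ... | yes x≈0 = sym x≈0
  ... | no x≉0  = proj₂ (proj₂ (log x x≉0))

  elt-injective : ∀ i j → i < suc n → j < suc n → elt i ≈ elt j → i ≡ j
  elt-injective zero    zero    _ _ _ = ≡.refl
  elt-injective zero    (suc j) _ _ eq = ⊥-elim (γ^-≉0 j (sym eq))
  elt-injective (suc i) zero    _ _ eq = ⊥-elim (γ^-≉0 i eq)
  elt-injective (suc i) (suc j) (s≤s i<n) (s≤s j<n) eq = cong suc (γ^-injective i j i<n j<n eq)

  idx-elt : ∀ k → k < suc n → idx (elt k) ≡ k
  idx-elt k k< = elt-injective _ _ (idx< (elt k)) k< (elt-idx (elt k))

  idx-cong : ∀ {x y} → x ≈ y → idx x ≡ idx y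
  idx-cong {x} {y} x≈y = elt-injective _ _ (idx< x) (idx< y) (trans (elt-idx x) (trans x≈y (sym (elt-idx y))))

  -- `elt` is injective on 1 + n indices and `idx` on the q elements, so each count bounds the
  -- other.
  q≡1+n : q ≡ suc n
  q≡1+n = ℕ.≤-antisym
    (Fin.injective⇒≤ {f = λ i → fromℕ< (idx< (Inverse.from cardinality i))} idx-inj)
    (Fin.injective⇒≤ {f = λ i → card (elt (toℕ i))} (λ {i} {j} eq →
      Fin.toℕ-injective (elt-injective _ _ (Fin.toℕ<n i) (Fin.toℕ<n j) (card-injective eq))))
    where
    open Inverse cardinality using (from; strictlyInverseˡ; to-cong)
    idx-inj : ∀ {i j} → fromℕ< (idx< (from i)) ≡ fromℕ< (idx< (from j)) → i ≡ j
    idx-inj {i} {j} eq = ≡.trans (≡.sym (strictlyInverseˡ i)) (≡.trans (to-cong (begin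
      from i ≈⟨ elt-idx (from i) ⟨
      elt (idx (from i)) ≡⟨ cong elt (≡.trans (≡.sym (Fin.toℕ-fromℕ< _)) (≡.trans (cong toℕ eq) (Fin.toℕ-fromℕ< _))) ⟩
      elt (idx (from j)) ≈⟨ elt-idx (from j) ⟩
      from j ∎)) (strictlyInverseˡ j))

  power-sum : ∀ e → ¬ γ ^ e ≈ 1# → Sum.Σ< commutativeRing n (λ k → γ ^ (e ℕ.* k)) ≈ 0#
  power-sum e γᵉ≉1 = trans (Sum.Σ-cong′ commutativeRing n (λ k → sym (^-assocʳ γ e k)))
    (sum-of-powers n (γ ^ e) γᵉ≉1 (begin
      (γ ^ e) ^ n ≈⟨ ^-assocʳ γ e n ⟩
      γ ^ (e ℕ.* n) ≈⟨ γ^-periodic 0 e ⟩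
      1# ∎))

  x^q≈x : ∀ x → x ^ suc n ≈ x
  x^q≈x x with x ≈? 0#
  ... | yes x≈0 = trans (*-congʳ x≈0) (trans (zeroˡ _) (sym x≈0))
  ... | no x≉0 with log x x≉0
  ...   | k , _ , eq = trans (*-congˡ xⁿ≈1) (*-identityʳ x)
    where
    xⁿ≈1 : x ^ n ≈ 1#
    xⁿ≈1 = begin
      x ^ n ≈⟨ ^-congˡ n eq ⟨
      (γ ^ k) ^ n ≈⟨ ^-assocʳ γ k n ⟩
      γ ^ (k ℕ.* n) ≈⟨ γ^-periodic 0 k ⟩
      1# ∎

  record Bijection : Set (c Level.⊔ ℓ) where
    field
      σ τ : Carrier → Carrier
      σ-cong : ∀ {x y} → x ≈ y → σ x ≈ σ y
      τ-cong : ∀ {x y} → x ≈ y → τ x ≈ τ y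
      σ-τ : ∀ x → σ (τ x) ≈ x
      τ-σ : ∀ x → τ (σ x) ≈ x

    reindexing : Reindexing (suc n)
    reindexing = record
      { to = λ k → idx (σ (elt k)) ; from = λ k → idx (τ (elt k))
      ; to< = λ k _ → idx< _ ; from< = λ k _ → idx< _
      ; to-from = λ k k< → ≡.trans (idx-cong (trans (σ-cong (elt-idx _)) (σ-τ _))) (idx-elt k k<)
      ; from-to = λ k k< → ≡.trans (idx-cong (trans (τ-cong (elt-idx _)) (τ-σ _))) (idx-elt k k<)
      }

  scaling : ∀ b → ¬ b ≈ 0# → Bijection
  scaling b b≉0 with inverse b b≉0
  ... | b⁻¹ , inv = record
    { σ = b *_ ; τ = b⁻¹ *_ ; σ-cong = *-congˡ ; τ-cong = *-congˡ
    ; σ-τ = λ x → trans (sym (*-assoc _ _ _)) (trans (*-congʳ inv) (*-identityˡ x))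
    ; τ-σ = λ x → trans (sym (*-assoc _ _ _)) (trans (*-congʳ (trans (*-comm _ _) inv)) (*-identityˡ x)) }

  translation : Carrier → Bijection
  translation a = record
    { σ = _+ a ; τ = _- a ; σ-cong = +-congʳ ; τ-cong = +-congʳ
    ; σ-τ = λ x → trans (+-assoc _ _ _) (trans (+-congˡ (-‿inverseˡ a)) (+-identityʳ x))
    ; τ-σ = λ x → trans (+-assoc _ _ _) (trans (+-congˡ (-‿inverseʳ a)) (+-identityʳ x)) }

  module SumF {c′ ℓ′ : Level} (R : CommutativeRing c′ ℓ′) where
    private module R = CommutativeRing R
    open Sum R public

    ΣF : (Carrier → R.Carrier) → R.Carrier
    ΣF h = Σ< (suc n) (h ∘ elt)

    ΣF* : (Carrier → R.Carrier) → R.Carrier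
    ΣF* h = Σ< n (λ k → h (γ ^ k))

    ΣF-bijection : ∀ (β : Bijection) h → (∀ {x y} → x ≈ y → h x R.≈ h y) → ΣF (h ∘ Bijection.σ β) R.≈ ΣF h
    ΣF-bijection β h h-cong = R.trans
      (Σ-cong′ (suc n) (λ k → h-cong (sym (elt-idx _))))
      (Σ-reindex (Bijection.reindexing β) (h ∘ elt))

    ΣF*-bijection : ∀ (β : Bijection) h → Bijection.σ β 0# ≈ 0# →
                    (∀ {x y} → x ≈ y → h x R.≈ h y) → ΣF* (h ∘ Bijection.σ β) R.≈ ΣF* h
    ΣF*-bijection β h σ0≈0 h-cong = ∙-cancelˡ (h 0#) _ _
      (R.trans (R.+-congʳ (h-cong (sym σ0≈0))) (R.trans (R.sym (Σ-cons n _)) (R.trans (ΣF-bijection β h h-cong) (Σ-cons n _))))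
      where open import Algebra.Properties.Group R.+-group using (∙-cancelˡ)

    ΣF-cong : ∀ {f g : Carrier → R.Carrier} → (∀ x → f x R.≈ g x) → ΣF f R.≈ ΣF g
    ΣF-cong f≈g = Σ-cong′ (suc n) (λ k → f≈g (elt k))

    ΣF*-cong : ∀ {f g : Carrier → R.Carrier} → (∀ x → f x R.≈ g x) → ΣF* f R.≈ ΣF* g
    ΣF*-cong f≈g = Σ-cong′ n (λ k → f≈g (γ ^ k))

-- Characteristic 2, the trace and the additive character

ℤ-ring : CommutativeRing Level.zero Level.zero
ℤ-ring = ℤ.+-*-commutativeRing

private
  module Z = Sum ℤ-ring
  import Algebra.Properties.AbelianGroup ℤ.+-0-abelianGroup as ℤ+

≡-neg⇒≡0 : ∀ {a} → a ≡ ℤ.- a → a ≡ 0ℤ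
≡-neg⇒≡0 {+ zero} _ = ≡.refl

module Characteristic2 {c ℓ : Level} {q : ℕ} (F : FiniteField c ℓ q)
  (γ : FiniteField.Carrier F) (prim : IsPrimitive F γ) (f : ℕ) (q≡2^f : q ≡ 2 ℕ.^ f) where
  open FiniteField F
  open Primitive F γ prim public
  open import Relation.Binary.Reasoning.Setoid setoid
  open import Algebra.Properties.Semiring.Exp semiring using (^-homo-*; ^-assocʳ)
  open import Algebra.Properties.Semiring.Mult semiring using (×1-homo-*; ×-congˡ; ×-homo-+) renaming (_×_ to _·_)
  open import Algebra.Properties.Group +-group using (inverseˡ-unique; identityʳ-unique)
  open import Algebra.Properties.CommutativeSemigroup +-commutativeSemigroup using (interchange; x∙yz≈y∙xz)
  private module FF = SumF commutativeRing

  1+n≡2^f : suc n ≡ 2 ℕ.^ f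
  1+n≡2^f = ≡.trans (≡.sym q≡1+n) q≡2^f

  private
    count : ∀ k → FF.Σ< k (λ _ → 1#) ≈ k · 1#
    count zero    = FF.Σ-empty _
    count (suc k) = trans (FF.Σ-cons k _) (+-congˡ (count k))

    2^k·1 : ∀ k → (2 ℕ.^ k) · 1# ≈ (2 · 1#) ^ k
    2^k·1 zero    = +-identityʳ 1#
    2^k·1 (suc k) = trans (×1-homo-* 2 (2 ℕ.^ k)) (*-congˡ (2^k·1 k))

  -- Adding 1 permutes F, so Σ (x + 1) = Σ x and the q ones sum to 0.
  q·1≈0 : suc n · 1# ≈ 0#
  q·1≈0 = trans (sym (count (suc n))) (identityʳ-unique _ _
    (trans (sym (FF.Σ-+ (suc n) elt (λ _ → 1#))) (FF.ΣF-bijection (translation 1#) (λ x → x) (λ eq → eq))))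

  -- The f-th power of 1 + 1 is 2^f · 1 = q · 1 = 0, and a field has no nilpotents.
  1+1≈0 : 1# + 1# ≈ 0#
  1+1≈0 with (2 · 1#) ≈? 0#
  ... | yes 2≈0 = trans (+-congˡ (sym (+-identityʳ 1#))) 2≈0
  ... | no  2≉0 = ⊥-elim (^-≉0 f 2≉0 (trans (sym (2^k·1 f)) (trans (×-congˡ (≡.sym 1+n≡2^f)) q·1≈0)))

  x+x≈0 : ∀ x → x + x ≈ 0#
  x+x≈0 x = trans (+-cong (sym (*-identityˡ x)) (sym (*-identityˡ x)))
    (trans (sym (distribʳ x 1# 1#)) (trans (*-congʳ 1+1≈0) (zeroˡ x)))

  -x≈x : ∀ x → - x ≈ x
  -x≈x x = sym (inverseˡ-unique x x (x+x≈0 x))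

  Σ1≈1 : FF.Σ< n (λ _ → 1#) ≈ 1#
  Σ1≈1 = trans (count n) (trans (sym (-x≈x _)) (sym (inverseˡ-unique 1# (n · 1#) q·1≈0)))

  sq-+ : ∀ x y → (x + y) * (x + y) ≈ x * x + y * y
  sq-+ x y = begin
    (x + y) * (x + y) ≈⟨ distribˡ _ _ _ ⟩
    (x + y) * x + (x + y) * y ≈⟨ +-cong (distribʳ _ _ _) (distribʳ _ _ _) ⟩
    (x * x + y * x) + (x * y + y * y) ≈⟨ +-assoc _ _ _ ⟩
    x * x + (y * x + (x * y + y * y)) ≈⟨ +-congˡ (+-assoc _ _ _) ⟨
    x * x + ((y * x + x * y) + y * y) ≈⟨ +-congˡ (+-congʳ (trans (+-congʳ (*-comm y x)) (x+x≈0 _))) ⟩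
    x * x + (0# + y * y) ≈⟨ +-congˡ (+-identityˡ _) ⟩
    x * x + y * y ∎

  frob : ℕ → Carrier → Carrier
  frob zero    x = x
  frob (suc i) x = frob i (x * x)

  frob-cong : ∀ i {x y} → x ≈ y → frob i x ≈ frob i y
  frob-cong zero    x≈y = x≈y
  frob-cong (suc i) x≈y = frob-cong i (*-cong x≈y x≈y)

  frob-+ : ∀ i x y → frob i (x + y) ≈ frob i x + frob i y
  frob-+ zero    x y = refl
  frob-+ (suc i) x y = trans (frob-cong i (sq-+ x y)) (frob-+ i (x * x) (y * y))

  frob-^ : ∀ i x → frob i x ≈ x ^ (2 ℕ.^ i)
  frob-^ zero    x = sym (*-identityʳ x)
  frob-^ (suc i) x = begin
    frob i (x * x) ≈⟨ frob-cong i (*-congˡ (*-identityʳ x)) ⟨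
    frob i (x ^ 2) ≈⟨ frob-^ i (x ^ 2) ⟩
    (x ^ 2) ^ (2 ℕ.^ i) ≈⟨ ^-assocʳ x 2 (2 ℕ.^ i) ⟩
    x ^ (2 ℕ.^ suc i) ∎

  frob-sq : ∀ i x → frob i x * frob i x ≈ frob (suc i) x
  frob-sq zero    x = refl
  frob-sq (suc i) x = frob-sq i (x * x)

  frob-f : ∀ x → frob f x ≈ x
  frob-f x = trans (frob-^ f x) (trans (reflexive (cong (x ^_) (≡.sym 1+n≡2^f))) (x^q≈x x))

  frob-γ : ∀ i k → frob i (γ ^ k) ≈ γ ^ (2 ℕ.^ i ℕ.* k)
  frob-γ i k = trans (frob-^ i (γ ^ k)) (trans (^-assocʳ γ k (2 ℕ.^ i)) (reflexive (cong (γ ^_) (ℕ.*-comm k _))))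

  Tr : Carrier → Carrier
  Tr x = FF.Σ< f (λ i → frob i x)

  Tr-cong : ∀ {x y} → x ≈ y → Tr x ≈ Tr y
  Tr-cong x≈y = FF.Σ-cong′ f (λ i → frob-cong i x≈y)

  Tr-+ : ∀ x y → Tr (x + y) ≈ Tr x + Tr y
  Tr-+ x y = trans (FF.Σ-cong′ f (λ i → frob-+ i x y)) (FF.Σ-+ f _ _)

  -- Squaring shifts the terms of the trace cyclically, because f squarings are the identity on F.
  Tr-sq : ∀ x → Tr (x * x) ≈ Tr x
  Tr-sq x = ∙-cancelʳ (frob 0 x) _ _ (begin
    FF.Σ< f (λ i → frob (suc i) x) + frob 0 x ≈⟨ +-comm _ _ ⟩
    frob 0 x + FF.Σ< f (λ i → frob (suc i) x) ≈⟨ FF.Σ-cons f (λ i → frob i x) ⟨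
    FF.Σ< (suc f) (λ i → frob i x) ≈⟨ FF.Σ-snoc f (λ i → frob i x) ⟩
    Tr x + frob f x ≈⟨ +-congˡ (frob-f x) ⟩
    Tr x + frob 0 x ∎)
    where open import Algebra.Properties.Group +-group using (∙-cancelʳ)

  sq-Σ : ∀ k (h : ℕ → Carrier) → FF.Σ< k h * FF.Σ< k h ≈ FF.Σ< k (λ i → h i * h i)
  sq-Σ zero    h = trans (*-congʳ (FF.Σ-empty h)) (trans (zeroˡ _) (sym (FF.Σ-empty _)))
  sq-Σ (suc k) h = begin
    FF.Σ< (suc k) h * FF.Σ< (suc k) h ≈⟨ *-cong (FF.Σ-cons k h) (FF.Σ-cons k h) ⟩
    (h 0 + S) * (h 0 + S) ≈⟨ sq-+ (h 0) S ⟩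
    h 0 * h 0 + S * S ≈⟨ +-congˡ (sq-Σ k (h ∘ suc)) ⟩
    h 0 * h 0 + FF.Σ< k (λ i → h (suc i) * h (suc i)) ≈⟨ FF.Σ-cons k _ ⟨
    FF.Σ< (suc k) (λ i → h i * h i) ∎
    where S = FF.Σ< k (h ∘ suc)

  -- Squaring is additive, so (Tr x)² = Tr (x²) = Tr x and the trace is a root of y² = y.
  Tr-0∨1 : ∀ x → Tr x ≈ 0# ⊎ Tr x ≈ 1#
  Tr-0∨1 x = x*x≈x⇒x≈0∨1 (trans (sq-Σ f _) (trans (FF.Σ-cong′ f (λ i → frob-sq i x)) (Tr-sq x)))

  0<f : 0 < f
  0<f = pos f 1+n≡2^f
    where
    pos : ∀ g → suc n ≡ 2 ℕ.^ g → 0 < g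
    pos zero    ()
    pos (suc g) _ = s≤s z≤n

  -- If the trace vanished identically, so would Σ_{x≠0} x⁻¹ Tr x, but only the term i = 0 of
  -- Tr x = Σ_i x^(2^i) contributes to this sum, and it contributes q - 1 = 1.
  Tr-nontrivial : ∃[ x ] Tr x ≈ 1#
  Tr-nontrivial with Fin.any? (λ (i : Fin n) → Tr (γ ^ toℕ i) ≈? 1#)
  ... | yes (i , eq) = γ ^ toℕ i , eq
  ... | no ¬Tr≈1 = ⊥-elim (1≉0 (trans (sym weighted≈1) weighted≈0))
    where
    Tr≈0 : ∀ k → k < n → Tr (γ ^ k) ≈ 0#
    Tr≈0 k k<n with Tr-0∨1 (γ ^ k)
    ... | inj₁ eq = eq
    ... | inj₂ eq = ⊥-elim (¬Tr≈1 (fromℕ< k<n , trans (reflexive (cong (Tr ∘ (γ ^_)) (Fin.toℕ-fromℕ< k<n))) eq))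
    -- γ^(m k) is the inverse of γ^k, so `exponent i` amounts to 2^i - 1 modulo n, which for i < f
    -- is 0 only at i = 0.
    m = ℕ.pred n
    weighted : Carrier
    weighted = FF.Σ< n (λ k → γ ^ (m ℕ.* k) * Tr (γ ^ k))
    weighted≈0 : weighted ≈ 0#
    weighted≈0 = FF.Σ-zero n (λ k k<n → trans (*-congˡ (Tr≈0 k k<n)) (zeroʳ _))
    exponent : ℕ → ℕ
    exponent i = m ℕ.+ 2 ℕ.^ i
    term : ∀ i k → γ ^ (m ℕ.* k) * frob i (γ ^ k) ≈ γ ^ (exponent i ℕ.* k)
    term i k = trans (*-congˡ (frob-γ i k)) (trans (sym (^-homo-* γ (m ℕ.* k) (2 ℕ.^ i ℕ.* k)))
      (reflexive (cong (γ ^_) (≡.sym (ℕ.*-distribʳ-+ k m (2 ℕ.^ i))))))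
    exponent-0 : exponent 0 ≡ n
    exponent-0 = ℕ.+-comm m 1
    exponent-suc : ∀ i → i < f → ¬ i ≡ 0 → ¬ γ ^ exponent i ≈ 1#
    exponent-suc i i<f i≢0 eq = γ^≉1 (2 ℕ.^ i ∸ 1) (ℕ.m<n⇒0<n∸m 1<2^i)
      (ℕ.≤-trans (ℕ.≤-reflexive (ℕ.m+[n∸m]≡n {1} (ℕ.<⇒≤ 1<2^i))) (ℕ.s≤s⁻¹
          (ℕ.≤-trans (ℕ.^-monoʳ-< 2 (s≤s (s≤s z≤n)) i<f) (ℕ.≤-reflexive (≡.sym 1+n≡2^f)))))
      (begin
        γ ^ (2 ℕ.^ i ∸ 1) ≈⟨ γ^-periodic (2 ℕ.^ i ∸ 1) 1 ⟨
        γ ^ (2 ℕ.^ i ∸ 1 ℕ.+ 1 ℕ.* n) ≡⟨ cong (γ ^_) shuffle ⟩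
        γ ^ exponent i ≈⟨ eq ⟩
        1# ∎)
      where
      1<2^i : 1 < 2 ℕ.^ i
      1<2^i = ℕ.^-monoʳ-< 2 (s≤s (s≤s z≤n)) (ℕ.n≢0⇒n>0 i≢0)
      shuffle : 2 ℕ.^ i ∸ 1 ℕ.+ 1 ℕ.* n ≡ exponent i
      shuffle = ≡.trans (cong (2 ℕ.^ i ∸ 1 ℕ.+_) (ℕ.*-identityˡ n)) (≡.trans (ℕ.+-suc _ m)
        (≡.trans (cong (ℕ._+ m) (ℕ.m+[n∸m]≡n {1} (ℕ.<⇒≤ 1<2^i))) (ℕ.+-comm (2 ℕ.^ i) m)))
    weighted≈1 : weighted ≈ 1#
    weighted≈1 = begin
      weighted ≈⟨ FF.Σ-cong′ n (λ k → FF.Σ-*ˡ f _ _) ⟩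
      FF.Σ< n (λ k → FF.Σ< f (λ i → γ ^ (m ℕ.* k) * frob i (γ ^ k))) ≈⟨ FF.Σ-swap n f _ ⟩
      FF.Σ< f (λ i → FF.Σ< n (λ k → γ ^ (m ℕ.* k) * frob i (γ ^ k))) ≈⟨ FF.Σ-cong′ f (λ i → FF.Σ-cong′ n (term i)) ⟩
      FF.Σ< f (λ i → FF.Σ< n (λ k → γ ^ (exponent i ℕ.* k))) ≈⟨ FF.Σ-only f 0 _ 0<f
          (λ i i<f i≢0 → power-sum (exponent i) (exponent-suc i i<f i≢0)) ⟩
      FF.Σ< n (λ k → γ ^ (exponent 0 ℕ.* k)) ≈⟨ FF.Σ-cong′ n (λ k → trans
          (reflexive (cong (γ ^_) (≡.trans (cong (ℕ._* k) exponent-0) (ℕ.*-comm n k)))) (γ^-periodic 0 k)) ⟩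
      FF.Σ< n (λ _ → 1#) ≈⟨ Σ1≈1 ⟩
      1# ∎

  private
    sign : ∀ {x} → Dec (x ≈ 0#) → ℤ
    sign (yes _) = 1ℤ
    sign (no _)  = -1ℤ

    sign-≈0 : ∀ {x} (d : Dec (x ≈ 0#)) → x ≈ 0# → sign d ≡ 1ℤ
    sign-≈0 (yes _)  _   = ≡.refl
    sign-≈0 (no x≉0) x≈0 = ⊥-elim (x≉0 x≈0)

    sign-≈1 : ∀ {x} (d : Dec (x ≈ 0#)) → x ≈ 1# → sign d ≡ -1ℤ
    sign-≈1 (yes x≈0) x≈1 = ⊥-elim (1≉0 (trans (sym x≈1) x≈0))
    sign-≈1 (no _)    _   = ≡.refl

  opaque
    -- The character (-1)^(Tr x); in characteristic 2 its values are signs, so the Gauss periods are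
    -- rational integers.
    ψ : Carrier → ℤ
    ψ x = sign (Tr x ≈? 0#)

    ψ-Tr≈0 : ∀ {x} → Tr x ≈ 0# → ψ x ≡ 1ℤ
    ψ-Tr≈0 {x} = sign-≈0 (Tr x ≈? 0#)

    ψ-Tr≈1 : ∀ {x} → Tr x ≈ 1# → ψ x ≡ -1ℤ
    ψ-Tr≈1 {x} = sign-≈1 (Tr x ≈? 0#)

  ψ-Tr : ∀ {x y} → Tr x ≈ Tr y → ψ x ≡ ψ y
  ψ-Tr {x} {y} eq with Tr-0∨1 y
  ... | inj₁ t = ≡.trans (ψ-Tr≈0 (trans eq t)) (≡.sym (ψ-Tr≈0 t))
  ... | inj₂ t = ≡.trans (ψ-Tr≈1 (trans eq t)) (≡.sym (ψ-Tr≈1 t))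

  ψ-cong : ∀ {x y} → x ≈ y → ψ x ≡ ψ y
  ψ-cong x≈y = ψ-Tr (Tr-cong x≈y)

  ψ-sq : ∀ x → ψ (x * x) ≡ ψ x
  ψ-sq x = ψ-Tr (Tr-sq x)

  ψ-±1 : ∀ x → ψ x ≡ 1ℤ ⊎ ψ x ≡ -1ℤ
  ψ-±1 x with Tr-0∨1 x
  ... | inj₁ t = inj₁ (ψ-Tr≈0 t)
  ... | inj₂ t = inj₂ (ψ-Tr≈1 t)

  ψ-+ : ∀ x y → ψ (x + y) ≡ ψ x ℤ.* ψ y
  ψ-+ x y with Tr-0∨1 x | Tr-0∨1 y
  ... | inj₁ s | inj₁ t rewrite ψ-Tr≈0 s | ψ-Tr≈0 t = ψ-Tr≈0 (trans (Tr-+ x y) (trans (+-cong s t) (+-identityˡ _)))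
  ... | inj₁ s | inj₂ t rewrite ψ-Tr≈0 s | ψ-Tr≈1 t = ψ-Tr≈1 (trans (Tr-+ x y) (trans (+-cong s t) (+-identityˡ _)))
  ... | inj₂ s | inj₁ t rewrite ψ-Tr≈1 s | ψ-Tr≈0 t = ψ-Tr≈1 (trans (Tr-+ x y) (trans (+-cong s t) (+-identityʳ _)))
  ... | inj₂ s | inj₂ t rewrite ψ-Tr≈1 s | ψ-Tr≈1 t = ψ-Tr≈0 (trans (Tr-+ x y) (trans (+-cong s t) 1+1≈0))

  Tr-0 : Tr 0# ≈ 0#
  Tr-0 = FF.Σ-zero f (λ i _ → frob-0 i)
    where
    frob-0 : ∀ i → frob i 0# ≈ 0#
    frob-0 zero    = refl
    frob-0 (suc i) = trans (frob-cong i (zeroˡ 0#)) (frob-0 i)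

  ψ-0 : ψ 0# ≡ 1ℤ
  ψ-0 = ψ-Tr≈0 Tr-0

  private module ZF = SumF ℤ-ring

  -- Translation by an element of trace 1 permutes F and changes every sign.
  Σψ≡0 : ZF.ΣF ψ ≡ 0ℤ
  Σψ≡0 with Tr-nontrivial
  ... | a , Tr-a = ≡-neg⇒≡0 (≡.trans (≡.sym (ZF.ΣF-bijection (translation a) ψ ψ-cong))
    (≡.trans (ZF.ΣF-cong (λ x → ≡.trans (ψ-+ x a) (≡.trans (cong (ψ x ℤ.*_) (ψ-Tr≈1 Tr-a))
        (≡.trans (ℤ.*-comm (ψ x) -1ℤ) (ℤ.-1*i≡-i (ψ x))))))
      (ZF.Σ-- (suc n) (ψ ∘ elt))))

  Σψ-scaled≡0 : ∀ b → ¬ b ≈ 0# → ZF.ΣF (λ x → ψ (b * x)) ≡ 0ℤ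
  Σψ-scaled≡0 b b≉0 = ≡.trans (ZF.ΣF-bijection (scaling b b≉0) ψ ψ-cong) Σψ≡0

  squaring : Bijection
  squaring = record
    { σ = λ x → x * x ; τ = frob (ℕ.pred f)
    ; σ-cong = λ eq → *-cong eq eq ; τ-cong = frob-cong (ℕ.pred f)
    ; σ-τ = λ x → trans (frob-sq (ℕ.pred f) x) (trans (reflexive (cong (λ i → frob i x) suc-pred-f)) (frob-f x))
    ; τ-σ = λ x → trans (reflexive (cong (λ i → frob i x) suc-pred-f)) (frob-f x) }
    where
    suc-pred-f : suc (ℕ.pred f) ≡ f
    suc-pred-f = ℕ.suc-pred f {{ℕ.>-nonZero 0<f}}

-- Coordinates with respect to powers of the primitive element

  -- The reduction map ℤ → F; the sign may be dropped in characteristic 2.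
  opaque
    ι : ℤ → Carrier
    ι a = ℤ.∣ a ∣ · 1#

    private
      ι-⊖ : ∀ i j → ι (i ℤ.⊖ j) ≈ i · 1# + j · 1#
      ι-⊖ zero    zero    = sym (+-identityˡ 0#)
      ι-⊖ zero    (suc j) = sym (+-identityˡ _)
      ι-⊖ (suc i) zero    = sym (+-identityʳ _)
      ι-⊖ (suc i) (suc j) = begin
        ι (suc i ℤ.⊖ suc j) ≡⟨ cong ι (ℤ.[1+m]⊖[1+n]≡m⊖n i j) ⟩
        ι (i ℤ.⊖ j) ≈⟨ ι-⊖ i j ⟩
        i · 1# + j · 1# ≈⟨ +-identityˡ _ ⟨
        0# + (i · 1# + j · 1#) ≈⟨ +-congʳ 1+1≈0 ⟨
        1# + 1# + (i · 1# + j · 1#) ≈⟨ interchange _ _ _ _ ⟩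
        1# + i · 1# + (1# + j · 1#) ∎

    ι-+ : ∀ a b → ι (a ℤ.+ b) ≈ ι a + ι b
    ι-+ (+ i)    (+ j)    = ×-homo-+ 1# i j
    ι-+ (+ i)    -[1+ j ] = ι-⊖ i (suc j)
    ι-+ -[1+ i ] (+ j)    = trans (ι-⊖ j (suc i)) (+-comm _ _)
    ι-+ -[1+ i ] -[1+ j ] = trans (+-congˡ (trans (+-congˡ (×-homo-+ 1# i j)) (x∙yz≈y∙xz _ _ _))) (sym (+-assoc _ _ _))

    ι-* : ∀ a b → ι (a ℤ.* b) ≈ ι a * ι b
    ι-* a b = trans (×-congˡ (ℤ.abs-* a b)) (×1-homo-* ℤ.∣ a ∣ ℤ.∣ b ∣)

    ι-0 : ι 0ℤ ≈ 0#
    ι-0 = refl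

    ι-1 : ι 1ℤ ≈ 1#
    ι-1 = +-identityʳ 1#

    ι-2 : ι (+ 2) ≈ 0#
    ι-2 = trans (+-congˡ (+-identityʳ 1#)) 1+1≈0

    ι--1 : ι -1ℤ ≈ 1#
    ι--1 = +-identityʳ 1#

  ι-even : ∀ a → ι (+ 2 ℤ.* a) ≈ 0#
  ι-even a = trans (ι-* (+ 2) a) (trans (*-congʳ ι-2) (zeroˡ _))

  private
    remainder : ∀ r b → r < 2 → (∃[ h ] + r ℤ.+ b ℤ.* + 2 ≡ + 2 ℤ.* h) ⊎ ι (+ r ℤ.+ b ℤ.* + 2) ≈ 1#
    remainder zero b _ = inj₁ (b , ≡.trans (ℤ.+-identityˡ _) (ℤ.*-comm b (+ 2)))
    remainder (suc zero) b _ = inj₂ (trans (ι-+ 1ℤ _) (trans (+-cong ι-1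
      (trans (reflexive (cong ι (ℤ.*-comm b (+ 2)))) (ι-even b))) (+-identityʳ 1#)))
    remainder (suc (suc r)) b (s≤s (s≤s ()))

  parity : ∀ a → (∃[ h ] a ≡ + 2 ℤ.* h) ⊎ ι a ≈ 1#
  parity a with remainder (a ℤDM.%ℕ 2) (a ℤDM./ℕ 2) (ℤDM.n%ℕd<d a 2)
  ... | inj₁ (h , eq) = inj₁ (h , ≡.trans (ℤDM.a≡a%ℕn+[a/ℕn]*n a 2) eq)
  ... | inj₂ eq       = inj₂ (trans (reflexive (cong ι (ℤDM.a≡a%ℕn+[a/ℕn]*n a 2))) eq)

  half : ∀ a → ι a ≈ 0# → ∃[ h ] a ≡ + 2 ℤ.* h
  half a ιa≈0 with parity a
  ... | inj₁ h = h
  ... | inj₂ ιa≈1 = ⊥-elim (1≉0 (trans (sym ιa≈1) ιa≈0))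

  -- The 𝔽₂-span of 1, γ, ..., γ^(d-1). The last coefficient is 0 or 1, and removing its term means
  -- adding it in characteristic 2; this form makes membership decidable.
  Span : ℕ → Carrier → Set ℓ
  Span zero    y = y ≈ 0#
  Span (suc d) y = Span d y ⊎ Span d (y + γ ^ d)

  span? : ∀ d y → Dec (Span d y)
  span? zero    y = y ≈? 0#
  span? (suc d) y = span? d y ⊎-dec span? d (y + γ ^ d)

  Span-cong : ∀ d {x y} → x ≈ y → Span d x → Span d y
  Span-cong zero    x≈y s        = trans (sym x≈y) s
  Span-cong (suc d) x≈y (inj₁ s) = inj₁ (Span-cong d x≈y s)
  Span-cong (suc d) x≈y (inj₂ s) = inj₂ (Span-cong d (+-congʳ x≈y) s)

  Span-0 : ∀ d → Span d 0#
  Span-0 zero    = refl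
  Span-0 (suc d) = inj₁ (Span-0 d)

  Span-γ : ∀ d i → i < d → Span d (γ ^ i)
  Span-γ (suc d) i (s≤s i≤d) with ℕ.m≤n⇒m<n∨m≡n i≤d
  ... | inj₁ i<d    = inj₁ (Span-γ d i i<d)
  ... | inj₂ ≡.refl = inj₂ (Span-cong d (sym (x+x≈0 _)) (Span-0 d))

  combination : ℕ → (ℕ → ℤ) → Carrier
  combination d v = FF.Σ< d (λ i → ι (v i) * γ ^ i)

  combination-cong : ∀ d {v w} → (∀ i → i < d → v i ≡ w i) → combination d v ≈ combination d w
  combination-cong d eq = FF.Σ-cong d (λ i i<d → *-congʳ (reflexive (cong ι (eq i i<d))))

  private
    term-cancel : ∀ {x y z w} → x ≈ 1# → z ≈ y + x * w → z + w ≈ y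
    term-cancel {x} {y} {z} {w} x≈1 eq = begin
      z + w ≈⟨ +-congʳ (trans eq (+-congˡ (trans (*-congʳ x≈1) (*-identityˡ w)))) ⟩
      y + w + w ≈⟨ trans (+-assoc _ _ _) (+-congˡ (x+x≈0 w)) ⟩
      y + 0# ≈⟨ +-identityʳ y ⟩
      y ∎

    term-drop : ∀ {x y z w} → x ≈ 0# → z ≈ y + x * w → z ≈ y
    term-drop x≈0 eq = trans eq (trans (+-congˡ (trans (*-congʳ x≈0) (zeroˡ _))) (+-identityʳ _))

  Span-combination : ∀ d v → Span d (combination d v)
  Span-combination zero    v = FF.Σ-empty _
  Span-combination (suc d) v with parity (v d)
  ... | inj₁ (h , eq) = inj₁ (Span-cong d (sym (term-drop (trans (reflexive (cong ι eq)) (ι-even h)) (FF.Σ-snoc d _)))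
      (Span-combination d v))
  ... | inj₂ eq       = inj₂ (Span-cong d (sym (term-cancel eq (FF.Σ-snoc d _))) (Span-combination d v))

  private
    set : (ℕ → ℤ) → ℕ → ℤ → ℕ → ℤ
    set v d a i with i ℕ.≟ d
    ... | yes _ = a
    ... | no  _ = v i

    combination-set : ∀ d v a → combination (suc d) (set v d a) ≈ combination d v + ι a * γ ^ d
    combination-set d v a = trans (FF.Σ-snoc d _) (+-cong (combination-cong d below) (*-congʳ (reflexive (cong ι at-d))))
      where
      below : ∀ i → i < d → set v d a i ≡ v i
      below i i<d with i ℕ.≟ d
      ... | yes i≡d = ⊥-elim (ℕ.<⇒≢ i<d i≡d)
      ... | no  _   = ≡.refl
      at-d : set v d a d ≡ a
      at-d with d ℕ.≟ d
      ... | yes _  = ≡.refl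
      ... | no d≢d = ⊥-elim (d≢d ≡.refl)

  coordinates : ∀ d y → Span d y → ∃[ v ] combination d v ≈ y
  coordinates zero    y s = (λ _ → 0ℤ) , trans (FF.Σ-empty _) (sym s)
  coordinates (suc d) y (inj₁ s) with coordinates d y s
  ... | v , eq = set v d 0ℤ , trans (combination-set d v 0ℤ)
    (trans (+-cong eq (trans (*-congʳ ι-0) (zeroˡ (γ ^ d)))) (+-identityʳ y))
  coordinates (suc d) y (inj₂ s) with coordinates d (y + γ ^ d) s
  ... | v , eq = set v d 1ℤ , (begin
    combination (suc d) (set v d 1ℤ) ≈⟨ combination-set d v 1ℤ ⟩
    combination d v + ι 1ℤ * γ ^ d   ≈⟨ +-cong eq (trans (*-congʳ ι-1) (*-identityˡ (γ ^ d))) ⟩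
    y + γ ^ d + γ ^ d                ≈⟨ trans (+-assoc _ _ _) (+-congˡ (x+x≈0 _)) ⟩
    y + 0#                           ≈⟨ +-identityʳ y ⟩
    y                                ∎)

  opaque
    -- The least such exponent is the degree of γ over 𝔽₂. The search ends at n, since γ^n = 1 lies
    -- in the span.
    dependency : ∃[ d ] (d ≤ n × Span d (γ ^ d) × (∀ e → e < d → ¬ Span e (γ ^ e)))
    dependency = least (λ e → span? e (γ ^ e)) n (Span-cong n (sym γⁿ≈1) (Span-γ n 0 (s≤s z≤n)))

  d : ℕ
  d = proj₁ dependency

  0<d : 0 < d
  0<d with d | proj₁ (proj₂ (proj₂ dependency))
  ... | zero  | 1≈0 = ⊥-elim (1≉0 1≈0)
  ... | suc _ | _   = s≤s z≤n

  -- An odd top coefficient would put γ^e into the span of the lower powers, against the minimality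
  -- of `d`. So it is even, its term drops out, and the argument descends.
  independent : ∀ e v → e ≤ d → combination e v ≈ 0# → ∀ i → i < e → ι (v i) ≈ 0#
  independent (suc e) v e<d eq i (s≤s i≤e) with parity (v e)
  ... | inj₂ ve≈1 = ⊥-elim (proj₂ (proj₂ (proj₂ dependency)) e e<d (Span-cong e
          (trans (sym (term-cancel ve≈1 (FF.Σ-snoc e _))) (trans (+-congʳ eq) (+-identityˡ _))) (Span-combination e v)))
  ... | inj₁ (h , ve) with ℕ.m≤n⇒m<n∨m≡n i≤e
  ...   | inj₁ i<e    = independent e v (ℕ.<⇒≤ e<d) (trans (sym (term-drop (trans (reflexive (cong ι ve)) (ι-even h))
      (FF.Σ-snoc e _))) eq) i i<e
  ...   | inj₂ ≡.refl = trans (reflexive (cong ι ve)) (ι-even h)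

  -- mulγ j lists the coordinates of γ·γ^j, so its columns form a lift to ℤ of multiplication by γ.
  opaque
    private
      mulγ′ : ∀ j → Dec (Span d (γ ^ suc j)) → ℕ → ℤ
      mulγ′ j (yes s) = proj₁ (coordinates d (γ ^ suc j) s)
      mulγ′ j (no _)  = λ _ → 0ℤ

    mulγ : ℕ → ℕ → ℤ
    mulγ j = mulγ′ j (span? d (γ ^ suc j))

    combination-mulγ : ∀ j → j < d → combination d (mulγ j) ≈ γ ^ suc j
    combination-mulγ j j<d with span? d (γ ^ suc j)
    ... | yes s = proj₂ (coordinates d (γ ^ suc j) s)
    ... | no ¬s with ℕ.m≤n⇒m<n∨m≡n j<d
    ...   | inj₁ 1+j<d = ⊥-elim (¬s (Span-γ d (suc j) 1+j<d))
    ...   | inj₂ 1+j≡d = ⊥-elim (¬s (subst (λ e → Span d (γ ^ e)) (≡.sym 1+j≡d) (proj₁ (proj₂ (proj₂ dependency)))))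

-- A 2-adic thickening of the field

-- ℤ[X] as a syntax. Below it acts on ℤᵈ, X acting by a lift of multiplication by γ on F = 𝔽₂ᵈ, and
-- polynomials are identified when they act alike modulo 2^K: this is the Galois ring of order q^K.
infixl 6 _⊕_
infixl 7 _⊗_

data Polynomial : Set where
  con     : ℤ → Polynomial
  X       : Polynomial
  _⊕_ _⊗_ : Polynomial → Polynomial → Polynomial

module Thickening {c ℓ : Level} {q : ℕ} (F : FiniteField c ℓ q)
  (γ : FiniteField.Carrier F) (prim : IsPrimitive F γ) (f : ℕ) (q≡2^f : q ≡ 2 ℕ.^ f) (K : ℕ) where
  open FiniteField F
  open Characteristic2 F γ prim f q≡2^f public
  open import Algebra.Properties.Semiring.Exp semiring using (^-congˡ; ^-homo-*; ^-assocʳ)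
  private
    m : ℕ
    m = ℕ.pred n
    module FF = SumF commutativeRing
    module ≈-Reasoning where
      open import Relation.Binary.Reasoning.Setoid setoid public

  -- ℤᵈ; the entries from the d-th on are junk.
  V : Set
  V = ℕ → ℤ

  infix 4 _≐_ _~_ _≋_

  _≐_ : V → V → Set
  v ≐ w = ∀ i → i < d → v i ≡ w i

  _+ᵛ_ : V → V → V
  (v +ᵛ w) i = v i ℤ.+ w i

  _*ᵛ_ : ℤ → V → V
  (a *ᵛ v) i = a ℤ.* v i

  mulX : V → V
  mulX v i = Z.Σ< d (λ j → v j ℤ.* mulγ j i)

  act : Polynomial → V → V
  act (con a) v = a *ᵛ v
  act X       v = mulX v
  act (p ⊕ r) v = act p v +ᵛ act r v
  act (p ⊗ r) v = act p (act r v)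

  eval : Polynomial → Carrier
  eval (con a) = ι a
  eval X       = γ
  eval (p ⊕ r) = eval p + eval r
  eval (p ⊗ r) = eval p * eval r

  act-cong : ∀ p {v w} → v ≐ w → act p v ≐ act p w
  act-cong (con a) eq i i<d = cong (a ℤ.*_) (eq i i<d)
  act-cong X       eq i i<d = Z.Σ-cong d (λ j j<d → cong (ℤ._* mulγ j i) (eq j j<d))
  act-cong (p ⊕ r) eq i i<d = cong₂ ℤ._+_ (act-cong p eq i i<d) (act-cong r eq i i<d)
  act-cong (p ⊗ r) eq i i<d = act-cong p (act-cong r eq) i i<d

  private
    distribˡ-≡ : ∀ a b e → a ℤ.* (b ℤ.+ e) ≡ a ℤ.* b ℤ.+ a ℤ.* e
    distribˡ-≡ = solve-∀
    interchange-≡ : ∀ a b e g → a ℤ.+ b ℤ.+ (e ℤ.+ g) ≡ a ℤ.+ e ℤ.+ (b ℤ.+ g)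
    interchange-≡ = solve-∀
    swap-≡ : ∀ a b e → a ℤ.* (b ℤ.* e) ≡ b ℤ.* (a ℤ.* e)
    swap-≡ = solve-∀

  act-+ : ∀ p v w → act p (v +ᵛ w) ≐ act p v +ᵛ act p w
  act-+ (con a) v w i _ = distribˡ-≡ a (v i) (w i)
  act-+ X       v w i _ = ≡.trans (Z.Σ-cong′ d (λ j → ℤ.*-distribʳ-+ (mulγ j i) (v j) (w j))) (Z.Σ-+ d _ _)
  act-+ (p ⊕ r) v w i i<d = ≡.trans (cong₂ ℤ._+_ (act-+ p v w i i<d) (act-+ r v w i i<d))
    (interchange-≡ (act p v i) (act p w i) (act r v i) (act r w i))
  act-+ (p ⊗ r) v w i i<d = ≡.trans (act-cong p (act-+ r v w) i i<d) (act-+ p (act r v) (act r w) i i<d)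

  act-* : ∀ p a v → act p (a *ᵛ v) ≐ a *ᵛ act p v
  act-* (con b) a v i _ = swap-≡ b a (v i)
  act-* X       a v i _ = ≡.trans (Z.Σ-cong′ d (λ j → ℤ.*-assoc a (v j) (mulγ j i))) (≡.sym (Z.Σ-*ˡ d a _))
  act-* (p ⊕ r) a v i i<d = ≡.trans (cong₂ ℤ._+_ (act-* p a v i i<d) (act-* r a v i i<d))
    (≡.sym (distribˡ-≡ a (act p v i) (act r v i)))
  act-* (p ⊗ r) a v i i<d = ≡.trans (act-cong p (act-* r a v) i i<d) (act-* p a (act r v) i i<d)

  act-mulX : ∀ p v → act p (mulX v) ≐ mulX (act p v)
  act-mulX (con a) v i i<d = ≡.sym (act-* X a v i i<d)
  act-mulX X       v i _   = ≡.refl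
  act-mulX (p ⊕ r) v i i<d = ≡.trans (cong₂ ℤ._+_ (act-mulX p v i i<d) (act-mulX r v i i<d))
    (≡.sym (act-+ X (act p v) (act r v) i i<d))
  act-mulX (p ⊗ r) v i i<d = ≡.trans (act-cong p (act-mulX r v) i i<d) (act-mulX p (act r v) i i<d)

  -- Every action is built from scalars and the single operator `mulX`, so commuting past these is
  -- enough.
  act-comm : ∀ p r v → act p (act r v) ≐ act r (act p v)
  act-comm p (con a) v = act-* p a v
  act-comm p X       v = act-mulX p v
  act-comm p (r ⊕ s) v i i<d = ≡.trans (act-+ p (act r v) (act s v) i i<d)
    (cong₂ ℤ._+_ (act-comm p r v i i<d) (act-comm p s v i i<d))
  act-comm p (r ⊗ s) v i i<d = ≡.trans (act-comm p r (act s v) i i<d) (act-cong r (act-comm p s v) i i<d)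

  -- The reduction ℤᵈ → F given by `combination` is equivariant: modulo 2, a polynomial acts as
  -- multiplication by its value at γ. For `X` this is the defining property of `mulγ`.
  combination-act : ∀ p v → combination d (act p v) ≈ eval p * combination d v
  combination-act (con a) v = trans (FF.Σ-cong′ d (λ i → trans (*-congʳ (ι-* a (v i))) (*-assoc _ _ _))) (sym (FF.Σ-*ˡ d _ _))
  combination-act X v = begin
    combination d (mulX v) ≈⟨ FF.Σ-cong′ d (λ i → *-congʳ (ι-Σ d _)) ⟩
    FF.Σ< d (λ i → FF.Σ< d (λ j → ι (v j ℤ.* mulγ j i)) * γ ^ i) ≈⟨ FF.Σ-cong′ d (λ i → FF.Σ-*ʳ d _ _) ⟩
    FF.Σ< d (λ i → FF.Σ< d (λ j → ι (v j ℤ.* mulγ j i) * γ ^ i)) ≈⟨ FF.Σ-swap d d _ ⟩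
    FF.Σ< d (λ j → FF.Σ< d (λ i → ι (v j ℤ.* mulγ j i) * γ ^ i)) ≈⟨ FF.Σ-cong′ d
        (λ j → FF.Σ-cong′ d (λ i → trans (*-congʳ (ι-* (v j) (mulγ j i))) (*-assoc _ _ _))) ⟩
    FF.Σ< d (λ j → FF.Σ< d (λ i → ι (v j) * (ι (mulγ j i) * γ ^ i))) ≈⟨ FF.Σ-cong′ d (λ j → FF.Σ-*ˡ d _ _) ⟨
    FF.Σ< d (λ j → ι (v j) * combination d (mulγ j)) ≈⟨ FF.Σ-cong d (λ j j<d → trans (*-congˡ (combination-mulγ j j<d)) (x∙yz≈y∙xz _ _ _)) ⟩
    FF.Σ< d (λ j → γ * (ι (v j) * γ ^ j)) ≈⟨ FF.Σ-*ˡ d _ _ ⟨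
    γ * combination d v ∎
    where
    open ≈-Reasoning
    open import Algebra.Properties.CommutativeSemigroup *-commutativeSemigroup using (x∙yz≈y∙xz)
    ι-Σ : ∀ k h → ι (Z.Σ< k h) ≈ FF.Σ< k (ι ∘ h)
    ι-Σ zero    h = trans (reflexive (cong ι (Z.Σ-empty h))) (trans ι-0 (sym (FF.Σ-empty _)))
    ι-Σ (suc k) h = trans (reflexive (cong ι (Z.Σ-cons k h))) (trans (ι-+ _ _) (trans (+-congˡ (ι-Σ k (h ∘ suc))) (sym (FF.Σ-cons k _))))
  combination-act (p ⊕ r) v = trans (trans (FF.Σ-cong′ d (λ i → trans (*-congʳ (ι-+ _ _)) (distribʳ _ _ _))) (FF.Σ-+ d _ _))
    (trans (+-cong (combination-act p v) (combination-act r v)) (sym (distribʳ _ _ _)))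
  combination-act (p ⊗ r) v = trans (combination-act p (act r v)) (trans (*-congˡ (combination-act r v)) (sym (*-assoc _ _ _)))

  2^ : ℕ → ℤ
  2^ k = + (2 ℕ.^ k)

  2^-+ : ∀ i j → 2^ (i ℕ.+ j) ≡ 2^ i ℤ.* 2^ j
  2^-+ i j = ≡.trans (cong +_ (ℕ.^-distribˡ-+-* 2 i j)) (ℤ.pos-* (2 ℕ.^ i) (2 ℕ.^ j))

  record _~_ (v w : V) : Set where
    constructor differ
    field
      quotient : V
      equality : v ≐ w +ᵛ (2^ K *ᵛ quotient)

  ≐⇒~ : ∀ {v w} → v ≐ w → v ~ w
  ≐⇒~ {v} {w} eq = differ (λ _ → 0ℤ) (λ i i<d → ≡.trans (eq i i<d) (lem (w i) (2^ K)))
    where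
    lem : ∀ a b → a ≡ a ℤ.+ b ℤ.* 0ℤ
    lem = solve-∀

  ~-sym : ∀ {v w} → v ~ w → w ~ v
  ~-sym {v} {w} (differ u eq) = differ (λ i → ℤ.- u i) (λ i i<d → ≡.trans (lem (w i) (2^ K) (u i))
    (cong (ℤ._+ 2^ K ℤ.* (ℤ.- u i)) (≡.sym (eq i i<d))))
    where
    lem : ∀ a b e → a ≡ a ℤ.+ b ℤ.* e ℤ.+ b ℤ.* (ℤ.- e)
    lem = solve-∀

  ~-trans : ∀ {v w x} → v ~ w → w ~ x → v ~ x
  ~-trans {v} {w} {x} (differ u eq) (differ u′ eq′) = differ (u′ +ᵛ u) (λ i i<d → ≡.trans (eq i i<d)
    (≡.trans (cong (ℤ._+ 2^ K ℤ.* u i) (eq′ i i<d)) (lem (x i) (2^ K) (u i) (u′ i))))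
    where
    lem : ∀ a b e e′ → a ℤ.+ b ℤ.* e′ ℤ.+ b ℤ.* e ≡ a ℤ.+ b ℤ.* (e′ ℤ.+ e)
    lem = solve-∀

  ~-+ : ∀ {v w v′ w′} → v ~ w → v′ ~ w′ → (v +ᵛ v′) ~ (w +ᵛ w′)
  ~-+ {v} {w} {v′} {w′} (differ u eq) (differ u′ eq′) = differ (u +ᵛ u′) (λ i i<d →
    ≡.trans (cong₂ ℤ._+_ (eq i i<d) (eq′ i i<d)) (lem (w i) (w′ i) (2^ K) (u i) (u′ i)))
    where
    lem : ∀ a a′ b e e′ → a ℤ.+ b ℤ.* e ℤ.+ (a′ ℤ.+ b ℤ.* e′) ≡ a ℤ.+ a′ ℤ.+ b ℤ.* (e ℤ.+ e′)
    lem = solve-∀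

  ~-act : ∀ p {v w} → v ~ w → act p v ~ act p w
  ~-act p {v} {w} (differ u eq) = differ (act p u) (λ i i<d → ≡.trans (act-cong p eq i i<d)
    (≡.trans (act-+ p w (2^ K *ᵛ u) i i<d) (cong (ℤ._+_ (act p w i)) (act-* p (2^ K) u i i<d))))

  record _≋_ (p r : Polynomial) : Set where
    constructor agree
    field
      on : ∀ v → act p v ~ act r v
  open _≋_

  infix 8 ⊖_

  ⊖_ : Polynomial → Polynomial
  ⊖ p = con -1ℤ ⊗ p

  private
    ≐⇒≋ : ∀ {p r} → (∀ v → act p v ≐ act r v) → p ≋ r
    ≐⇒≋ eq = agree (λ v → ≐⇒~ (eq v))
    lem-assoc : ∀ a b e → a ℤ.+ b ℤ.+ e ≡ a ℤ.+ (b ℤ.+ e)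
    lem-assoc = solve-∀
    lem-idˡ : ∀ a b → 0ℤ ℤ.* a ℤ.+ b ≡ b
    lem-idˡ = solve-∀
    lem-idʳ : ∀ a b → b ℤ.+ 0ℤ ℤ.* a ≡ b
    lem-idʳ = solve-∀
    lem-invˡ : ∀ a b → -1ℤ ℤ.* a ℤ.+ a ≡ 0ℤ ℤ.* b
    lem-invˡ = solve-∀
    lem-invʳ : ∀ a b → a ℤ.+ -1ℤ ℤ.* a ≡ 0ℤ ℤ.* b
    lem-invʳ = solve-∀

  ≋-isCommutativeRing : IsCommutativeRing _≋_ _⊕_ _⊗_ ⊖_ (con 0ℤ) (con 1ℤ)
  ≋-isCommutativeRing = record
    { isRing = record
      { +-isAbelianGroup = record
        { isGroup = record
          { isMonoid = record
            { isSemigroup = record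
              { isMagma = record
                { isEquivalence = record
                  { refl = ≐⇒≋ (λ v i _ → ≡.refl)
                  ; sym = λ e → agree (λ v → ~-sym (on e v))
                  ; trans = λ e e′ → agree (λ v → ~-trans (on e v) (on e′ v)) }
                ; ∙-cong = λ e e′ → agree (λ v → ~-+ (on e v) (on e′ v)) }
              ; assoc = λ p r s → ≐⇒≋ (λ v i _ → lem-assoc (act p v i) (act r v i) (act s v i)) }
            ; identity = (λ p → ≐⇒≋ (λ v i _ → lem-idˡ (v i) (act p v i)))
                       , (λ p → ≐⇒≋ (λ v i _ → lem-idʳ (v i) (act p v i))) }
          ; inverse = (λ p → ≐⇒≋ (λ v i _ → lem-invˡ (act p v i) (v i)))
                    , (λ p → ≐⇒≋ (λ v i _ → lem-invʳ (act p v i) (v i)))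
          ; ⁻¹-cong = λ e → agree (λ v → ~-act (con -1ℤ) (on e v)) }
        ; comm = λ p r → ≐⇒≋ (λ v i _ → ℤ.+-comm (act p v i) (act r v i)) }
      ; *-cong = λ {p} {p′} {r} {r′} e e′ → agree (λ v → ~-trans (~-act p (on e′ v)) (on e (act r′ v)))
      ; *-assoc = λ p r s → ≐⇒≋ (λ v i _ → ≡.refl)
      ; *-identity = (λ p → ≐⇒≋ (λ v i _ → ℤ.*-identityˡ (act p v i)))
                   , (λ p → ≐⇒≋ (λ v → act-cong p (λ i _ → ℤ.*-identityˡ (v i))))
      ; distrib = (λ p r s → ≐⇒≋ (λ v → act-+ p (act r v) (act s v)))
                , (λ p r s → ≐⇒≋ (λ v i _ → ≡.refl)) }
    ; *-comm = λ p r → ≐⇒≋ (act-comm p r) }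

  R : CommutativeRing Level.zero Level.zero
  R = record { isCommutativeRing = ≋-isCommutativeRing }

  -- Membership in the ideal (2^k) of the ring of all endomorphisms of ℤᵈ, modulo 2^K.
  record I (k : ℕ) (p : Polynomial) : Set where
    constructor multiple
    field
      of : ∀ v → ∃[ w ] act p v ~ (2^ k *ᵛ w)
  open I

  I-cong : ∀ {k p r} → p ≋ r → I k p → I k r
  I-cong e m = multiple (λ v → proj₁ (of m v) , ~-trans (~-sym (on e v)) (proj₂ (of m v)))

  I-+ : ∀ {k p r} → I k p → I k r → I k (p ⊕ r)
  I-+ {k} {p} {r} m m′ = multiple (λ v → proj₁ (of m v) +ᵛ proj₁ (of m′ v) ,
    ~-trans (~-+ (proj₂ (of m v)) (proj₂ (of m′ v))) (≐⇒~ (λ i _ → ≡.sym (distribˡ-≡ (2^ k) _ _))))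

  I-* : ∀ {j k p r} → I j p → I k r → I (j ℕ.+ k) (p ⊗ r)
  I-* {j} {k} {p} {r} m m′ = multiple λ v → proj₁ (of m (proj₁ (of m′ v))) ,
    ~-trans (~-act p (proj₂ (of m′ v))) (~-trans (≐⇒~ (act-* p (2^ k) _))
      (~-trans (~-act (con (2^ k)) (proj₂ (of m (proj₁ (of m′ v)))))
        (≐⇒~ (λ i _ → ≡.trans (≡.sym (ℤ.*-assoc (2^ k) (2^ j) _))
          (cong (ℤ._* _) (≡.sym (≡.trans (cong 2^ (ℕ.+-comm j k)) (2^-+ k j))))))))

  I-0 : ∀ p → I 0 p
  I-0 p = multiple (λ v → act p v , ≐⇒~ (λ i _ → ≡.sym (ℤ.*-identityˡ _)))

  I-*ˡ : ∀ {k r} p → I k r → I k (p ⊗ r)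
  I-*ˡ p m = I-* (I-0 p) m

  I-antitone : ∀ {j k p} → j ≤ k → I k p → I j p
  I-antitone {j} {k} j≤k m = multiple λ v → 2^ (k ∸ j) *ᵛ proj₁ (of m v) , ~-trans (proj₂ (of m v))
    (≐⇒~ (λ i _ → ≡.trans (cong (ℤ._* _) (≡.trans (cong 2^ (≡.sym (ℕ.m+[n∸m]≡n j≤k))) (2^-+ j (k ∸ j))))
      (ℤ.*-assoc (2^ j) (2^ (k ∸ j)) _)))

  I-K⇒≋0 : ∀ {p} → I K p → p ≋ con 0ℤ
  I-K⇒≋0 m = agree λ v → ~-trans (proj₂ (of m v)) (differ (proj₁ (of m v)) (λ i _ → lem (v i) _))
    where
    lem : ∀ a b → b ≡ 0ℤ ℤ.* a ℤ.+ b
    lem = solve-∀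

  I-≋0 : ∀ {k p} → p ≋ con 0ℤ → I k p
  I-≋0 {k} e = multiple λ v → (λ _ → 0ℤ) , ~-trans (on e v) (≐⇒~ (λ i _ → lem (v i) (2^ k)))
    where
    lem : ∀ a b → 0ℤ ℤ.* a ≡ b ℤ.* 0ℤ
    lem = solve-∀

  -- If p vanishes in F, every vector `act p v` reduces to 0 there, and `independent` makes all its
  -- coordinates even. Through this lemma, computations in F yield divisibility by 2.
  eval≈0⇒I-1 : ∀ p → eval p ≈ 0# → I 1 p
  eval≈0⇒I-1 p eq = multiple λ v → halves v , ≐⇒~ (λ i i<d → spec v i i<d)
    where
    even : ∀ v i → i < d → ι (act p v i) ≈ 0#
    even v = independent d (act p v) ℕ.≤-refl (trans (combination-act p v) (trans (*-congʳ eq) (zeroˡ _)))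
    halves : V → V
    halves v i with ι (act p v i) ≈? 0#
    ... | yes e = proj₁ (half _ e)
    ... | no _  = 0ℤ
    spec : ∀ v i → i < d → act p v i ≡ + 2 ℤ.* halves v i
    spec v i i<d with ι (act p v i) ≈? 0#
    ... | yes e = proj₂ (half _ e)
    ... | no ¬e = ⊥-elim (¬e (even v i i<d))

  -- The way back to ℤ: apply both sides to the all-ones vector and compare coordinate 0, which
  -- exists by `0<d`.
  con≋0⇒∣ : ∀ a → con a ≋ con 0ℤ → 2^ K ℤD.∣ a
  con≋0⇒∣ a e with on e (λ _ → 1ℤ)
  ... | differ u eq = ℤD.divides (u 0) (≡.trans (≡.sym (ℤ.*-identityʳ a)) (≡.trans (eq 0 0<d)
          (≡.trans (ℤ.+-identityˡ _) (ℤ.*-comm (2^ K) (u 0)))))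

  con-+ : ∀ a b → con (a ℤ.+ b) ≋ con a ⊕ con b
  con-+ a b = ≐⇒≋ (λ v i _ → ℤ.*-distribʳ-+ (v i) a b)

  con-* : ∀ a b → con (a ℤ.* b) ≋ con a ⊗ con b
  con-* a b = ≐⇒≋ (λ v i _ → ℤ.*-assoc a b (v i))

-- Teichmüller lifts

  module R = CommutativeRing R
  module RF = SumF R
  private
    module RE where
      open import Algebra.Properties.Semiring.Exp R.semiring public
      open import Algebra.Properties.Ring R.ring public
      open import Algebra.Properties.CommutativeSemigroup R.*-commutativeSemigroup public
    module ≋-Reasoning where
      open import Relation.Binary.Reasoning.Setoid R.setoid public
  open RE using () renaming (_^_ to _⇑_) public

  eval-⇑ : ∀ p k → eval (p ⇑ k) ≈ eval p ^ k
  eval-⇑ p zero    = ι-1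
  eval-⇑ p (suc k) = *-congˡ (eval-⇑ p k)

  eval-Σ : ∀ k h → eval (RF.Σ< k h) ≈ FF.Σ< k (eval ∘ h)
  eval-Σ zero    h = trans (reflexive (cong eval (RF.Σ-empty-≡ h))) (trans ι-0 (sym (FF.Σ-empty _)))
  eval-Σ (suc k) h = trans (reflexive (cong eval (RF.Σ-cons-≡ k h)))
    (trans (+-congˡ (eval-Σ k (h ∘ suc))) (sym (FF.Σ-cons k _)))

  eval-⊖1 : ∀ p → eval (p ⊕ ⊖ con 1ℤ) ≈ eval p + 1#
  eval-⊖1 p = +-congˡ (trans (*-cong ι--1 ι-1) (*-identityˡ 1#))

  private
    inverse-mod-2 : ∀ u → ¬ eval u ≈ 0# → ∃[ w ] eval w * eval u ≈ 1#
    inverse-mod-2 u u≉0 with log (eval u) u≉0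
    ... | k , k<n , γᵏ≈u = X ⇑ (n ∸ k) , (let open ≈-Reasoning in begin
      eval (X ⇑ (n ∸ k)) * eval u ≈⟨ *-cong (eval-⇑ X (n ∸ k)) (sym γᵏ≈u) ⟩
      γ ^ (n ∸ k) * γ ^ k ≈⟨ ^-homo-* γ (n ∸ k) k ⟨
      γ ^ (n ∸ k ℕ.+ k) ≡⟨ cong (γ ^_) (ℕ.m∸n+n≡m (ℕ.<⇒≤ k<n)) ⟩
      γ ^ n ≈⟨ γⁿ≈1 ⟩
      1# ∎)

  -- With w u = 1 - t and t ∈ (2), the identity g = w (u g) + t g improves the divisibility of g step by step.
  I-cancel : ∀ {k} u g → ¬ eval u ≈ 0# → I k (u ⊗ g) → I k g
  I-cancel {k} u g u≉0 m with inverse-mod-2 u u≉0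
  ... | w , wu≈1 = improve k ℕ.≤-refl
    where
    t : Polynomial
    t = con 1ℤ ⊕ ⊖ (w ⊗ u)
    eval-t : eval t ≈ 0#
    eval-t = trans (+-cong ι-1 (trans (*-cong ι--1 wu≈1) (*-identityˡ 1#))) 1+1≈0
    split : (w ⊗ (u ⊗ g)) ⊕ (t ⊗ g) ≋ g
    split = let open ≋-Reasoning in begin
      (w ⊗ (u ⊗ g)) ⊕ (t ⊗ g) ≈⟨ R.+-cong (R.sym (R.*-assoc w u g)) (R.distribʳ g (con 1ℤ) (⊖ (w ⊗ u))) ⟩
      ((w ⊗ u) ⊗ g) ⊕ ((con 1ℤ ⊗ g) ⊕ (⊖ (w ⊗ u) ⊗ g)) ≈⟨ R.+-congˡ (R.+-cong (R.*-identityˡ g) (R.sym (RE.-‿distribˡ-* (w ⊗ u) g))) ⟩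
      ((w ⊗ u) ⊗ g) ⊕ (g ⊕ ⊖ ((w ⊗ u) ⊗ g)) ≈⟨ R.+-congˡ (R.+-comm g _) ⟩
      ((w ⊗ u) ⊗ g) ⊕ (⊖ ((w ⊗ u) ⊗ g) ⊕ g) ≈⟨ R.+-assoc _ _ _ ⟨
      (((w ⊗ u) ⊗ g) ⊕ ⊖ ((w ⊗ u) ⊗ g)) ⊕ g ≈⟨ R.+-congʳ (R.-‿inverseʳ _) ⟩
      con 0ℤ ⊕ g ≈⟨ R.+-identityˡ g ⟩
      g ∎
    improve : ∀ i → i ≤ k → I i g
    improve zero    _   = I-0 g
    improve (suc i) i<k = I-cong split (I-+ (I-antitone i<k (I-*ˡ w m)) (I-* (eval≈0⇒I-1 t eval-t) (improve i (ℕ.<⇒≤ i<k))))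

  -- (u - 1) S = u^k - 1 = 0, and u - 1 can be cancelled because it is nonzero in F. The ring has
  -- zero divisors, so the hypothesis concerns `eval u`.
  geometric-0 : ∀ k u → ¬ eval u ≈ 1# → u ⇑ k ≋ con 1ℤ → RF.Σ< k (u ⇑_) ≋ con 0ℤ
  geometric-0 k u u≉1 uᵏ≋1 = I-K⇒≋0 (I-cancel (u ⊕ ⊖ con 1ℤ) S (λ eq → u≉1 (x+1≈0 (trans (sym (eval-⊖1 u)) eq)))
    (I-≋0 (let open ≋-Reasoning in begin
      (u ⊕ ⊖ con 1ℤ) ⊗ S ≈⟨ R.distribʳ S u (⊖ con 1ℤ) ⟩
      (u ⊗ S) ⊕ (⊖ con 1ℤ ⊗ S) ≈⟨ R.+-congˡ (RE.-1*x≈-x S) ⟩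
      (u ⊗ S) ⊕ ⊖ S ≈⟨ R.+-congʳ (R.+-identityʳ _) ⟨
      ((u ⊗ S) ⊕ con 0ℤ) ⊕ ⊖ S ≈⟨ R.+-congʳ (R.+-congˡ (R.-‿inverseʳ (con 1ℤ))) ⟨
      ((u ⊗ S) ⊕ (con 1ℤ ⊕ ⊖ con 1ℤ)) ⊕ ⊖ S ≈⟨ R.+-congʳ (R.+-assoc _ _ _) ⟨
      (((u ⊗ S) ⊕ con 1ℤ) ⊕ ⊖ con 1ℤ) ⊕ ⊖ S ≈⟨ R.+-congʳ (R.+-congʳ (R.trans (RF.geometric k u)
          (R.trans (R.+-congʳ uᵏ≋1) (R.+-comm _ _)))) ⟩
      ((S ⊕ con 1ℤ) ⊕ ⊖ con 1ℤ) ⊕ ⊖ S ≈⟨ R.+-congʳ (R.trans (R.+-assoc _ _ _) (R.trans (R.+-congˡ (R.-‿inverseʳ _)) (R.+-identityʳ S))) ⟩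
      S ⊕ ⊖ S ≈⟨ R.-‿inverseʳ S ⟩
      con 0ℤ ∎)))
    where
    S = RF.Σ< k (u ⇑_)
    x+1≈0 : ∀ {x} → x + 1# ≈ 0# → x ≈ 1#
    x+1≈0 {x} eq = trans (inverseˡ-unique x 1# eq) (-x≈x 1#)
      where open import Algebra.Properties.Group +-group using (inverseˡ-unique)

  private
    Near1 : ℕ → Polynomial → Set
    Near1 k p = ∃[ t ] (I k t × p ≋ con 1ℤ ⊕ t)

    -- In (1 + t)² = 1 + 2t + t² both 2t and t² gain a factor 2. For t² this needs t to be even
    -- already, hence the index `suc k`.
    near1-square : ∀ k p → Near1 (suc k) p → Near1 (suc (suc k)) (p ⊗ p)
    near1-square k p (t , m , e) = (t ⊕ t) ⊕ (t ⊗ t) ,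
      I-+ (I-cong twice (I-* {1} (eval≈0⇒I-1 (con (+ 2)) ι-2) m))
          (I-antitone (s≤s (ℕ.≤-trans (ℕ.m≤n+m (suc k) k) ℕ.≤-refl)) (I-* m m)) ,
      (let open ≋-Reasoning in begin
        p ⊗ p ≈⟨ R.*-cong e e ⟩
        (con 1ℤ ⊕ t) ⊗ (con 1ℤ ⊕ t) ≈⟨ R.distribʳ _ _ _ ⟩
        (con 1ℤ ⊗ (con 1ℤ ⊕ t)) ⊕ (t ⊗ (con 1ℤ ⊕ t)) ≈⟨ R.+-cong (R.*-identityˡ _) (R.distribˡ _ _ _) ⟩
        (con 1ℤ ⊕ t) ⊕ ((t ⊗ con 1ℤ) ⊕ (t ⊗ t)) ≈⟨ R.+-congˡ (R.+-congʳ (R.*-identityʳ t)) ⟩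
        (con 1ℤ ⊕ t) ⊕ (t ⊕ (t ⊗ t)) ≈⟨ R.+-assoc _ _ _ ⟩
        con 1ℤ ⊕ (t ⊕ (t ⊕ (t ⊗ t))) ≈⟨ R.+-congˡ (R.+-assoc _ _ _) ⟨
        con 1ℤ ⊕ ((t ⊕ t) ⊕ (t ⊗ t)) ∎)
      where
      twice : con (+ 2) ⊗ t ≋ t ⊕ t
      twice = R.trans (R.*-congʳ (con-+ 1ℤ 1ℤ)) (R.trans (R.distribʳ t _ _) (R.+-cong (R.*-identityˡ t) (R.*-identityˡ t)))

    near1-cong : ∀ {k p r} → p ≋ r → Near1 k r → Near1 k p
    near1-cong p≋r (t , m , e) = t , m , R.trans p≋r e

    near1-power : ∀ j p → Near1 1 p → Near1 (suc j) (p ⇑ (2 ℕ.^ j))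
    near1-power zero    p u = near1-cong (R.*-identityʳ p) u
    near1-power (suc j) p u = near1-cong double (near1-square j (p ⇑ (2 ℕ.^ j)) (near1-power j p u))
      where
      double : p ⇑ (2 ℕ.^ suc j) ≋ (p ⇑ (2 ℕ.^ j)) ⊗ (p ⇑ (2 ℕ.^ j))
      double = R.trans (RE.^-homo-* p (2 ℕ.^ j) (2 ℕ.^ j ℕ.+ 0))
        (R.*-congˡ {p ⇑ (2 ℕ.^ j)} (RE.^-congʳ p (ℕ.+-identityʳ (2 ℕ.^ j))))

    near1-K : ∀ {k p} → K ≤ k → Near1 k p → p ≋ con 1ℤ
    near1-K K≤k (t , m , e) = R.trans e (R.trans (R.+-congˡ (I-K⇒≋0 (I-antitone K≤k m))) (R.+-identityʳ (con 1ℤ)))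

    near1 : ∀ p → eval p ≈ 1# → Near1 1 p
    near1 p eq = p ⊕ ⊖ con 1ℤ , eval≈0⇒I-1 (p ⊕ ⊖ con 1ℤ) (trans (eval-⊖1 p) (trans (+-congʳ eq) 1+1≈0)) ,
      (let open ≋-Reasoning in begin
        p ≈⟨ R.+-identityʳ p ⟨
        p ⊕ con 0ℤ ≈⟨ R.+-congˡ (R.-‿inverseˡ (con 1ℤ)) ⟨
        p ⊕ (⊖ con 1ℤ ⊕ con 1ℤ) ≈⟨ R.+-assoc p (⊖ con 1ℤ) (con 1ℤ) ⟨
        p ⊕ ⊖ con 1ℤ ⊕ con 1ℤ ≈⟨ R.+-comm (p ⊕ ⊖ con 1ℤ) (con 1ℤ) ⟩
        con 1ℤ ⊕ (p ⊕ ⊖ con 1ℤ) ∎)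

  -- The Teichmüller lift of γ modulo 2^K.
  opaque
    z : Polynomial
    -- The exponent is q^K. Raising to the power q fixes F, so z still reduces to γ; and X^n is 1
    -- modulo 2, so f K squarings make it 1 modulo 2^K.
    z = X ⇑ (2 ℕ.^ (f ℕ.* K))

    eval-z : eval z ≈ γ
    eval-z = trans (eval-⇑ X (2 ℕ.^ (f ℕ.* K))) (trans (reflexive (cong (γ ^_) (≡.sym (ℕ.^-*-assoc 2 f K)))) (q-power K))
      where
      q-power : ∀ k → γ ^ ((2 ℕ.^ f) ℕ.^ k) ≈ γ
      q-power zero    = *-identityʳ γ
      q-power (suc k) = let open ≈-Reasoning in begin
        γ ^ (2 ℕ.^ f ℕ.* (2 ℕ.^ f) ℕ.^ k) ≈⟨ ^-assocʳ γ (2 ℕ.^ f) ((2 ℕ.^ f) ℕ.^ k) ⟨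
        (γ ^ (2 ℕ.^ f)) ^ ((2 ℕ.^ f) ℕ.^ k) ≈⟨ ^-congˡ ((2 ℕ.^ f) ℕ.^ k) (trans (reflexive (cong (γ ^_) (≡.sym 1+n≡2^f))) (x^q≈x γ)) ⟩
        γ ^ ((2 ℕ.^ f) ℕ.^ k) ≈⟨ q-power k ⟩
        γ ∎

    zⁿ≋1 : z ⇑ n ≋ con 1ℤ
    zⁿ≋1 = let open ≋-Reasoning in begin
      (X ⇑ (2 ℕ.^ (f ℕ.* K))) ⇑ n ≈⟨ RE.^-assocʳ X (2 ℕ.^ (f ℕ.* K)) n ⟩
      X ⇑ (2 ℕ.^ (f ℕ.* K) ℕ.* n) ≈⟨ RE.^-congʳ X (ℕ.*-comm (2 ℕ.^ (f ℕ.* K)) n) ⟩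
      X ⇑ (n ℕ.* 2 ℕ.^ (f ℕ.* K)) ≈⟨ RE.^-assocʳ X n (2 ℕ.^ (f ℕ.* K)) ⟨
      (X ⇑ n) ⇑ (2 ℕ.^ (f ℕ.* K)) ≈⟨ near1-K (ℕ.m≤n⇒m≤1+n (ℕ.m≤n*m K f {{ℕ.>-nonZero 0<f}}))
              (near1-power (f ℕ.* K) (X ⇑ n) (near1 (X ⇑ n) (trans (eval-⇑ X n) γⁿ≈1))) ⟩
      con 1ℤ ∎

  1⇑k≋1 : ∀ k → con 1ℤ ⇑ k ≋ con 1ℤ
  1⇑k≋1 zero    = R.refl
  1⇑k≋1 (suc k) = R.trans (R.*-identityˡ _) (1⇑k≋1 k)

  z-periodic : ∀ a k → z ⇑ (a ℕ.+ k ℕ.* n) ≋ z ⇑ a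
  z-periodic a k = let open ≋-Reasoning in begin
    z ⇑ (a ℕ.+ k ℕ.* n) ≈⟨ RE.^-homo-* z a (k ℕ.* n) ⟩
    (z ⇑ a) ⊗ (z ⇑ (k ℕ.* n)) ≈⟨ R.*-congˡ (RE.^-congʳ z (ℕ.*-comm k n)) ⟩
    (z ⇑ a) ⊗ (z ⇑ (n ℕ.* k)) ≈⟨ R.*-congˡ (RE.^-assocʳ z n k) ⟨
    (z ⇑ a) ⊗ ((z ⇑ n) ⇑ k) ≈⟨ R.*-congˡ (R.trans (RE.^-congˡ k zⁿ≋1) (1⇑k≋1 k)) ⟩
    (z ⇑ a) ⊗ con 1ℤ ≈⟨ R.*-identityʳ _ ⟩
    z ⇑ a ∎

  z-power-sum : ∀ e → ¬ γ ^ e ≈ 1# → RF.Σ< n (λ k → z ⇑ (e ℕ.* k)) ≋ con 0ℤ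
  z-power-sum e γᵉ≉1 = R.trans regroup (geometric-0 n (z ⇑ e) zᵉ≉1 zᵉⁿ≋1)
    where
    regroup : RF.Σ< n (λ k → z ⇑ (e ℕ.* k)) ≋ RF.Σ< n ((z ⇑ e) ⇑_)
    regroup = RF.Σ-cong′ n {λ k → z ⇑ (e ℕ.* k)} {(z ⇑ e) ⇑_} (λ k → R.sym (RE.^-assocʳ z e k))
    zᵉ≉1 : ¬ eval (z ⇑ e) ≈ 1#
    zᵉ≉1 eq = γᵉ≉1 (trans (^-congˡ e (sym eval-z)) (trans (sym (eval-⇑ z e)) eq))
    zᵉⁿ≋1 : (z ⇑ e) ⇑ n ≋ con 1ℤ
    zᵉⁿ≋1 = R.trans (RE.^-assocʳ z e n) (z-periodic 0 e)

-- Gauss and Jacobi sums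

  zero-or-power : ∀ x → x ≈ 0# ⊎ ∃[ k ] (γ ^ k ≈ x)
  zero-or-power x with x ≈? 0#
  ... | yes x≈0 = inj₁ x≈0
  ... | no x≉0  = inj₂ (proj₁ (log x x≉0) , proj₂ (proj₂ (log x x≉0)))

  -- The multiplicative character γ^k ↦ z^(ek), extended by 0 to x = 0.
  opaque
    private
      character : ℕ → ℕ → Polynomial
      character e zero    = con 0ℤ
      character e (suc k) = z ⇑ (e ℕ.* k)

    W : ℕ → Carrier → Polynomial
    W e x = character e (idx x)

    W-cong : ∀ e {x y} → x ≈ y → W e x ≋ W e y
    W-cong e x≈y = R.reflexive (cong (character e) (idx-cong x≈y))

    W-0 : ∀ e → W e 0# ≋ con 0ℤ
    W-0 e = R.reflexive (cong (character e) (idx-elt 0 (s≤s z≤n)))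

    W-γ : ∀ e k → W e (γ ^ k) ≋ z ⇑ (e ℕ.* k)
    W-γ e k = R.trans (R.reflexive (cong (character e) (≡.trans (idx-cong (γ^-% k)) (idx-elt (suc (k % n)) (s≤s (DM.m%n<n k n))))))
      (R.trans (R.sym (z-periodic (e ℕ.* (k % n)) (e ℕ.* (k / n)))) (RE.^-congʳ z (≡.trans
        (cong (e ℕ.* (k % n) ℕ.+_) (ℕ.*-assoc e (k / n) n))
        (≡.trans (≡.sym (ℕ.*-distribˡ-+ e (k % n) (k / n ℕ.* n))) (cong (e ℕ.*_) (≡.sym (DM.m≡m%n+[m/n]*n k n)))))))

    -- Modulo 2 the Teichmüller character is the power map. At x = 0 this needs 0 < e, since `W` is
    -- 0 there while 0^0 = 1.
    eval-W : ∀ e → 0 < e → ∀ x → eval (W e x) ≈ x ^ e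
    eval-W e 0<e x = trans (at (idx x)) (^-congˡ e (elt-idx x))
      where
      at : ∀ i → eval (character e i) ≈ elt i ^ e
      at zero    = trans ι-0 (sym (trans (reflexive (cong (0# ^_) (≡.sym (ℕ.suc-pred e {{ℕ.>-nonZero 0<e}})))) (zeroˡ _)))
      at (suc k) = trans (eval-⇑ z (e ℕ.* k)) (trans (^-congˡ (e ℕ.* k) eval-z)
        (trans (reflexive (cong (γ ^_) (ℕ.*-comm e k))) (sym (^-assocʳ γ k e))))

  private
    on-powers : ∀ {g h : Carrier → Polynomial} → (∀ {x y} → x ≈ y → g x ≋ g y) → (∀ {x y} → x ≈ y → h x ≋ h y) →
                g 0# ≋ h 0# → (∀ k → g (γ ^ k) ≋ h (γ ^ k)) → ∀ x → g x ≋ h x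
    on-powers g-cong h-cong at-0 at-γ x with zero-or-power x
    ... | inj₁ x≈0      = R.trans (g-cong x≈0) (R.trans at-0 (h-cong (sym x≈0)))
    ... | inj₂ (k , eq) = R.trans (g-cong (sym eq)) (R.trans (at-γ k) (h-cong eq))

  W-+ : ∀ a b x → W (a ℕ.+ b) x ≋ W a x ⊗ W b x
  W-+ a b = on-powers (W-cong (a ℕ.+ b)) (λ eq → R.*-cong (W-cong a eq) (W-cong b eq))
    (R.trans (W-0 (a ℕ.+ b)) (R.sym (R.trans (R.*-congʳ (W-0 a)) (R.zeroˡ (W b 0#)))))
    (λ k → R.trans (W-γ (a ℕ.+ b) k) (R.trans (RE.^-congʳ z (ℕ.*-distribʳ-+ k a b))
      (R.trans (RE.^-homo-* z (a ℕ.* k) (b ℕ.* k)) (R.sym (R.*-cong (W-γ a k) (W-γ b k))))))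

  W-periodic : ∀ e x → W (e ℕ.+ n) x ≋ W e x
  W-periodic e = on-powers (W-cong (e ℕ.+ n)) (W-cong e) (R.trans (W-0 (e ℕ.+ n)) (R.sym (W-0 e)))
    (λ k → R.trans (W-γ (e ℕ.+ n) k) (R.trans (RE.^-congʳ z (≡.trans (ℕ.*-distribʳ-+ k e n) (cong (e ℕ.* k ℕ.+_) (ℕ.*-comm n k))))
      (R.trans (z-periodic (e ℕ.* k) k) (R.sym (W-γ e k)))))

  W-* : ∀ e x y → W e (x * y) ≋ W e x ⊗ W e y
  W-* e x y = on-powers {λ x → W e (x * y)} {λ x → W e x ⊗ W e y} (λ eq → W-cong e (*-congʳ eq)) (λ eq → R.*-congʳ (W-cong e eq))
    (R.trans (W-cong e (zeroˡ y)) (R.trans (W-0 e) (R.sym (R.trans (R.*-congʳ (W-0 e)) (R.zeroˡ (W e y))))))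
    (λ j → on-powers {λ y → W e (γ ^ j * y)} {λ y → W e (γ ^ j) ⊗ W e y} (λ eq → W-cong e (*-congˡ eq))
        (λ eq → R.*-congˡ {W e (γ ^ j)} (W-cong e eq))
      (R.trans (W-cong e (zeroʳ (γ ^ j))) (R.trans (W-0 e) (R.sym (R.trans (R.*-congˡ {W e (γ ^ j)} (W-0 e)) (R.zeroʳ (W e (γ ^ j)))))))
      (λ k → R.trans (W-cong e (sym (^-homo-* γ j k))) (R.trans (W-γ e (j ℕ.+ k)) (R.trans (RE.^-congʳ z (ℕ.*-distribˡ-+ e j k))
        (R.trans (RE.^-homo-* z (e ℕ.* j) (e ℕ.* k)) (R.sym (R.*-cong (W-γ e j) (W-γ e k))))))) y) x

  ΣW≋0 : ∀ e → ¬ γ ^ e ≈ 1# → RF.ΣF (W e) ≋ con 0ℤ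
  ΣW≋0 e γᵉ≉1 = R.trans (RF.Σ-cons n (W e ∘ elt)) (R.trans (R.+-cong (W-0 e)
    (R.trans (RF.Σ-cong′ n (W-γ e)) (z-power-sum e γᵉ≉1))) (R.+-identityˡ (con 0ℤ)))

  G : ℕ → Polynomial
  G e = RF.ΣF (λ x → con (ψ x) ⊗ W e x)

  G-periodic : ∀ e → G (e ℕ.+ n) ≋ G e
  G-periodic e = RF.ΣF-cong (λ x → R.*-congˡ {con (ψ x)} (W-periodic e x))

  conψ-cong : ∀ {x y} → x ≈ y → con (ψ x) ≋ con (ψ y)
  conψ-cong eq = R.reflexive (cong con (ψ-cong eq))

  -- ψ(x) = ψ(x²), and the character of exponent 2e at x is that of exponent e at x²; squaring
  -- permutes F.
  G-double : ∀ e → G (e ℕ.+ e) ≋ G e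
  G-double e = R.trans
    (RF.ΣF-cong (λ x → R.*-cong (R.reflexive (cong con (≡.sym (ψ-sq x)))) (R.trans (W-+ e e x) (R.sym (W-* e x x)))))
    (RF.ΣF-bijection squaring (λ x → con (ψ x) ⊗ W e x) (λ eq → R.*-cong (conψ-cong eq) (W-cong e eq)))

  -- The usual Jacobi sum, as 1 + x = 1 - x in characteristic 2.
  J : ℕ → ℕ → Polynomial
  J a b = RF.ΣF (λ x → W a x ⊗ W b (1# + x))

  private
    Jₛ : ℕ → ℕ → Carrier → Polynomial
    Jₛ a b s = RF.ΣF (λ x → W a x ⊗ W b (s + x))

    Jₛ-cong : ∀ a b {s t} → s ≈ t → Jₛ a b s ≋ Jₛ a b t
    Jₛ-cong a b {s} {t} eq = RF.ΣF-cong {λ x → W a x ⊗ W b (s + x)} {λ x → W a x ⊗ W b (t + x)}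
      (λ x → R.*-congˡ {W a x} (W-cong b (+-congʳ eq)))

  -- For s ≠ 0, substitute s x for x. For s = 0 the left side is the sum of the character of
  -- exponent a + b, which vanishes by nontriviality.
  Jₛ≋WJ : ∀ a b → ¬ γ ^ (a ℕ.+ b) ≈ 1# → ∀ s → Jₛ a b s ≋ W (a ℕ.+ b) s ⊗ J a b
  Jₛ≋WJ a b nontrivial = on-powers (Jₛ-cong a b) (λ eq → R.*-congʳ (W-cong (a ℕ.+ b) eq)) at-0 at-γ
    where
    at-0 : Jₛ a b 0# ≋ W (a ℕ.+ b) 0# ⊗ J a b
    at-0 = R.trans (RF.ΣF-cong (λ x → R.trans (R.*-congˡ {W a x} (W-cong b (+-identityˡ x))) (R.sym (W-+ a b x))))
      (R.trans (ΣW≋0 (a ℕ.+ b) nontrivial) (R.sym (R.trans (R.*-congʳ (W-0 (a ℕ.+ b))) (R.zeroˡ (J a b)))))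
    at-γ : ∀ k → Jₛ a b (γ ^ k) ≋ W (a ℕ.+ b) (γ ^ k) ⊗ J a b
    at-γ k = let open ≋-Reasoning ; s = γ ^ k in begin
      Jₛ a b s ≈⟨ RF.ΣF-bijection (scaling s (γ^-≉0 k)) (λ x → W a x ⊗ W b (s + x))
          (λ eq → R.*-cong (W-cong a eq) (W-cong b (+-congˡ eq))) ⟨
      RF.ΣF (λ x → W a (s * x) ⊗ W b (s + s * x)) ≈⟨ RF.ΣF-cong (λ x → R.*-cong (W-* a s x)
          (R.trans (W-cong b (trans (+-congʳ (sym (*-identityʳ s))) (sym (distribˡ s 1# x)))) (W-* b s (1# + x)))) ⟩
      RF.ΣF (λ x → (W a s ⊗ W a x) ⊗ (W b s ⊗ W b (1# + x))) ≈⟨ RF.ΣF-cong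
          (λ x → R.trans (RE.interchange (W a s) (W a x) (W b s) (W b (1# + x))) (R.*-congʳ (R.sym (W-+ a b s)))) ⟩
      RF.ΣF (λ x → W (a ℕ.+ b) s ⊗ (W a x ⊗ W b (1# + x))) ≈⟨ RF.Σ-*ˡ (suc n) (W (a ℕ.+ b) s) (λ i → W a (elt i) ⊗ W b (1# + elt i)) ⟨
      W (a ℕ.+ b) s ⊗ J a b ∎

  -- The double sum over x and y is grouped by s = x + y, on which the additive character depends.
  G-⊗ : ∀ a b → ¬ γ ^ (a ℕ.+ b) ≈ 1# → G a ⊗ G b ≋ G (a ℕ.+ b) ⊗ J a b
  G-⊗ a b nontrivial = let open ≋-Reasoning in begin
    G a ⊗ G b ≈⟨ RF.Σ-product (suc n) (suc n) (λ i → term a (elt i)) (λ i → term b (elt i)) ⟩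
    RF.ΣF (λ x → RF.ΣF (λ y → term a x ⊗ term b y)) ≈⟨ RF.ΣF-cong substitute ⟩
    RF.ΣF (λ x → RF.ΣF (λ s → con (ψ s) ⊗ (W a x ⊗ W b (s + x)))) ≈⟨ RF.Σ-swap (suc n) (suc n)
        (λ i j → con (ψ (elt j)) ⊗ (W a (elt i) ⊗ W b (elt j + elt i))) ⟩
    RF.ΣF (λ s → RF.ΣF (λ x → con (ψ s) ⊗ (W a x ⊗ W b (s + x)))) ≈⟨ RF.ΣF-cong
        (λ s → R.sym (RF.Σ-*ˡ (suc n) (con (ψ s)) (λ i → W a (elt i) ⊗ W b (s + elt i)))) ⟩
    RF.ΣF (λ s → con (ψ s) ⊗ Jₛ a b s) ≈⟨ RF.ΣF-cong (λ s → R.trans (R.*-congˡ {con (ψ s)} (Jₛ≋WJ a b nontrivial s))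
        (R.sym (R.*-assoc (con (ψ s)) (W (a ℕ.+ b) s) (J a b)))) ⟩
    RF.ΣF (λ s → (con (ψ s) ⊗ W (a ℕ.+ b) s) ⊗ J a b) ≈⟨ RF.Σ-*ʳ (suc n) (J a b) (λ i → con (ψ (elt i)) ⊗ W (a ℕ.+ b) (elt i)) ⟨
    G (a ℕ.+ b) ⊗ J a b ∎
    where
    term : ℕ → Carrier → Polynomial
    term e x = con (ψ x) ⊗ W e x
    substitute : ∀ x → RF.ΣF (λ y → term a x ⊗ term b y) ≋ RF.ΣF (λ s → con (ψ s) ⊗ (W a x ⊗ W b (s + x)))
    substitute x = R.trans (RF.ΣF-cong rewrite-term)
      (RF.ΣF-bijection (translation x) (λ s → con (ψ s) ⊗ (W a x ⊗ W b (s + x)))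
        (λ eq → R.*-cong (conψ-cong eq) (R.*-congˡ {W a x} (W-cong b (+-congʳ eq)))))
      where
      rewrite-term : ∀ y → term a x ⊗ term b y ≋ con (ψ (y + x)) ⊗ (W a x ⊗ W b (y + x + x))
      rewrite-term y = R.trans (RE.interchange (con (ψ x)) (W a x) (con (ψ y)) (W b y))
        (R.*-cong (R.trans (R.sym (con-* (ψ x) (ψ y))) (R.reflexive (cong con (≡.sym (≡.trans (ψ-cong (+-comm y x)) (ψ-+ x y))))))
          (R.*-congˡ {W a x} (W-cong b (sym (trans (+-assoc y x x) (trans (+-congˡ (x+x≈0 x)) (+-identityʳ y)))))))

  private
    -- Σ (1 + y)^r y^e over y ≠ 0. Splitting off one factor 1 + y at a time, as in `S-suc`, replaces
    -- binomial coefficients.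
    S : ℕ → ℕ → Carrier
    S r e = FF.Σ< n (λ k → (γ ^ k + 1#) ^ r * γ ^ (e ℕ.* k))

    S-suc : ∀ r e → S (suc r) e ≈ S r (suc e) + S r e
    S-suc r e = trans (FF.Σ-cong′ n step) (FF.Σ-+ n (λ k → (γ ^ k + 1#) ^ r * γ ^ (suc e ℕ.* k)) (λ k → (γ ^ k + 1#) ^ r * γ ^ (e ℕ.* k)))
      where
      step : ∀ k → (γ ^ k + 1#) ^ suc r * γ ^ (e ℕ.* k) ≈ (γ ^ k + 1#) ^ r * γ ^ (suc e ℕ.* k) + (γ ^ k + 1#) ^ r * γ ^ (e ℕ.* k)
      step k = let open ≈-Reasoning ; p = (γ ^ k + 1#) ^ r ; g = γ ^ (e ℕ.* k) in begin
        (γ ^ k + 1#) * p * g ≈⟨ *-congʳ (*-comm _ p) ⟩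
        p * (γ ^ k + 1#) * g ≈⟨ *-assoc _ _ _ ⟩
        p * ((γ ^ k + 1#) * g) ≈⟨ *-congˡ (trans (distribʳ g (γ ^ k) 1#) (+-cong (sym (^-homo-* γ k (e ℕ.* k))) (*-identityˡ g))) ⟩
        p * (γ ^ (suc e ℕ.* k) + g) ≈⟨ distribˡ p _ g ⟩
        p * γ ^ (suc e ℕ.* k) + p * g ∎

    S-zero : ∀ e → S 0 e ≈ FF.Σ< n (λ k → γ ^ (e ℕ.* k))
    S-zero e = FF.Σ-cong′ n (λ k → *-identityˡ _)

    γ^n+s≉1 : ∀ s → 0 < s → s < n → ¬ γ ^ (n ℕ.+ s) ≈ 1#
    γ^n+s≉1 s 0<s s<n eq = γ^≉1 s 0<s s<n (trans (sym (γ^-periodic s 1))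
      (trans (reflexive (cong (γ ^_) (≡.trans (cong (s ℕ.+_) (ℕ.*-identityˡ n)) (ℕ.+-comm s n)))) eq))

    S-above : ∀ r s → 0 < s → s ℕ.+ r < n → S r (n ℕ.+ s) ≈ 0#
    S-above zero s 0<s s<n = trans (S-zero (n ℕ.+ s)) (power-sum (n ℕ.+ s) (γ^n+s≉1 s 0<s (ℕ.≤-<-trans (ℕ.m≤m+n s 0) s<n)))
    S-above (suc r) s 0<s s<n = trans (S-suc r (n ℕ.+ s)) (trans (+-cong
      (trans (reflexive (cong (S r) (≡.sym (ℕ.+-suc n s)))) (S-above r (suc s) (s≤s z≤n)
          (ℕ.≤-<-trans (ℕ.≤-reflexive (≡.sym (ℕ.+-suc s r))) s<n)))
      (S-above r s 0<s (ℕ.<-trans (ℕ.+-monoʳ-< s (ℕ.n<1+n r)) s<n))) (+-identityˡ 0#))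

    S-n : ∀ r → r < n → S r n ≈ 1#
    S-n zero r<n = trans (S-zero n) (trans (FF.Σ-cong′ n (λ k → trans (reflexive (cong (γ ^_) (ℕ.*-comm n k))) (γ^-periodic 0 k))) Σ1≈1)
    S-n (suc r) r<n = trans (S-suc r n) (trans (+-cong (trans (reflexive (cong (S r) (ℕ.+-comm 1 n))) (S-above r 1 (s≤s z≤n) r<n))
      (S-n r (ℕ.<-trans (ℕ.n<1+n r) r<n))) (+-identityˡ 1#))

    -- Two further factors 1 + y contribute 1 + 1 = 0, so the value at r = 1 persists for odd r: it
    -- is the parity of the coefficient r.
    S-m : ∀ h → 1 < n → suc (h ℕ.+ h) < n → S (suc (h ℕ.+ h)) m ≈ 1#
    S-m zero 1<n _ = trans (S-suc 0 m) (trans (+-cong (S-n 0 (s≤s z≤n))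
        (trans (S-zero m) (power-sum m (γ^≉1 m (ℕ.s≤s⁻¹ 1<n) (ℕ.n<1+n m))))) (+-identityʳ 1#))
    S-m (suc h) 1<n 3+2h<n = let open ≈-Reasoning in begin
      S (suc (suc h ℕ.+ suc h)) m ≡⟨ cong (λ i → S (suc (suc i)) m) (ℕ.+-suc h h) ⟩
      S (suc (suc (suc (h ℕ.+ h)))) m ≈⟨ S-suc (suc (suc (h ℕ.+ h))) m ⟩
      S (suc (suc (h ℕ.+ h))) n + S (suc (suc (h ℕ.+ h))) m ≈⟨ +-cong (S-n _ (ℕ.<-trans (ℕ.n<1+n _) <n)) (S-suc (suc (h ℕ.+ h)) m) ⟩
      1# + (S (suc (h ℕ.+ h)) n + S (suc (h ℕ.+ h)) m) ≈⟨ +-congˡ (+-cong (S-n _ 1+2h<n) (S-m h 1<n 1+2h<n)) ⟩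
      1# + (1# + 1#) ≈⟨ trans (+-congˡ 1+1≈0) (+-identityʳ 1#) ⟩
      1# ∎
      where
      <n : suc (suc (suc (h ℕ.+ h))) < n
      <n = ℕ.≤-<-trans (ℕ.≤-reflexive (cong (λ i → suc (suc i)) (≡.sym (ℕ.+-suc h h)))) 3+2h<n
      1+2h<n : suc (h ℕ.+ h) < n
      1+2h<n = ℕ.<-trans (ℕ.n<1+n _) (ℕ.<-trans (ℕ.n<1+n _) <n)

  -- Modulo 2 this Jacobi sum is Σ_x x^r (1+x)^(n-1) = Σ_y (1+y)^r y^(n-1), and of the expansion of
  -- (1+y)^r only the term r y survives the summation.
  eval-J : ∀ h → 1 < n → suc (h ℕ.+ h) < n → eval (J (suc (h ℕ.+ h)) m) ≈ 1#
  eval-J h 1<n r<n = let open ≈-Reasoning in begin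
    eval (J r m) ≈⟨ eval-Σ (suc n) (λ i → W r (elt i) ⊗ W m (1# + elt i)) ⟩
    FF.ΣF (λ x → eval (W r x) * eval (W m (1# + x))) ≈⟨ FF.ΣF-cong (λ x → *-cong (eval-W r (s≤s z≤n) x) (eval-W m 0<m (1# + x))) ⟩
    FF.ΣF (λ x → x ^ r * (1# + x) ^ m) ≈⟨ FF.ΣF-cong (λ x → *-cong (^-congˡ r
        (sym (trans (+-assoc x 1# 1#) (trans (+-congˡ 1+1≈0) (+-identityʳ x))))) (^-congˡ m (+-comm 1# x))) ⟩
    FF.ΣF (λ x → (x + 1# + 1#) ^ r * (x + 1#) ^ m) ≈⟨ FF.ΣF-bijection (translation 1#) (λ y → (y + 1#) ^ r * y ^ m)
        (λ eq → *-cong (^-congˡ r (+-congʳ eq)) (^-congˡ m eq)) ⟩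
    FF.ΣF (λ y → (y + 1#) ^ r * y ^ m) ≈⟨ FF.Σ-cons n (λ i → (elt i + 1#) ^ r * elt i ^ m) ⟩
    (0# + 1#) ^ r * 0# ^ m + FF.Σ< n (λ k → (γ ^ k + 1#) ^ r * (γ ^ k) ^ m) ≈⟨ +-cong
        (trans (*-congˡ 0^m≈0) (zeroʳ _)) (FF.Σ-cong′ n (λ k → *-congˡ
        (trans (^-assocʳ γ k m) (reflexive (cong (γ ^_) (ℕ.*-comm k m)))))) ⟩
    0# + S r m ≈⟨ +-identityˡ _ ⟩
    S r m ≈⟨ S-m h 1<n r<n ⟩
    1# ∎
    where
    r = suc (h ℕ.+ h)
    0<m : 0 < m
    0<m = ℕ.s≤s⁻¹ 1<n
    0^m≈0 : 0# ^ m ≈ 0#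
    0^m≈0 = trans (reflexive (cong (0# ^_) (≡.sym (ℕ.suc-pred m {{ℕ.>-nonZero 0<m}})))) (zeroˡ _)

  -- Modulo 2 the additive character is constantly 1, so the Gauss sum reduces to the power sum Σ
  -- x^e, which vanishes.
  I-G : ∀ e → 0 < e → ¬ γ ^ e ≈ 1# → I 1 (G e)
  I-G e 0<e γᵉ≉1 = eval≈0⇒I-1 (G e) (let open ≈-Reasoning in begin
    eval (G e) ≈⟨ eval-Σ (suc n) (λ i → con (ψ (elt i)) ⊗ W e (elt i)) ⟩
    FF.ΣF (λ x → ι (ψ x) * eval (W e x)) ≈⟨ FF.ΣF-cong (λ x → trans (*-cong (ι-ψ x) (eval-W e 0<e x)) (*-identityˡ _)) ⟩
    FF.ΣF (λ x → x ^ e) ≈⟨ FF.Σ-cons n (λ i → elt i ^ e) ⟩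
    0# ^ e + FF.Σ< n (λ k → (γ ^ k) ^ e) ≈⟨ +-cong (trans (reflexive (cong (0# ^_) (≡.sym (ℕ.suc-pred e {{ℕ.>-nonZero 0<e}})))) (zeroˡ _))
              (FF.Σ-cong′ n (λ k → trans (^-assocʳ γ k e) (reflexive (cong (γ ^_) (ℕ.*-comm k e))))) ⟩
    0# + FF.Σ< n (λ k → γ ^ (e ℕ.* k)) ≈⟨ trans (+-identityˡ _) (power-sum e γᵉ≉1) ⟩
    0# ∎)
    where
    ι-ψ : ∀ x → ι (ψ x) ≈ 1#
    ι-ψ x with ψ-±1 x
    ... | inj₁ eq = trans (reflexive (cong ι eq)) ι-1
    ... | inj₂ eq = trans (reflexive (cong ι eq)) ι--1

-- Stickelberger's divisibility

  n-odd : ∃[ h ] n ≡ suc (h ℕ.+ h)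
  n-odd = odd (ℕ.pred (2 ℕ.^ ℕ.pred f)) (ℕ.suc-injective (≡.trans 1+n≡2^f (≡.trans
      (cong (2 ℕ.^_) (≡.sym (ℕ.suc-pred f {{ℕ.>-nonZero 0<f}})))
      (cong (2 ℕ.*_) (≡.sym (ℕ.suc-pred (2 ℕ.^ ℕ.pred f) {{ℕ.m^n≢0 2 (ℕ.pred f)}}))))))
    where
    odd : ∀ h → n ≡ h ℕ.+ suc (h ℕ.+ 0) → ∃[ h ] n ≡ suc (h ℕ.+ h)
    odd h eq = h , ≡.trans eq (≡.trans (ℕ.+-suc h (h ℕ.+ 0)) (cong (λ k → suc (h ℕ.+ k)) (ℕ.+-identityʳ h)))

  -- The exponent n - a stands for -a: in Stickelberger's theorem it is the binary digits of a that
  -- measure the divisibility. Appending a digit 0 to a doubles the exponent, since 2(n - a) = (n -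
  -- 2a) + n.
  I-G-double : ∀ s a → a ℕ.+ a < n → I s (G (n ∸ a)) → I s (G (n ∸ (a ℕ.+ a)))
  I-G-double s a 2a<n = I-cong (R.trans (R.sym (G-double (n ∸ a)))
    (R.trans (R.reflexive (cong G exponent)) (G-periodic (n ∸ (a ℕ.+ a)))))
    where
    exponent : n ∸ a ℕ.+ (n ∸ a) ≡ n ∸ (a ℕ.+ a) ℕ.+ n
    exponent = ℕ.+-cancelʳ-≡ (a ℕ.+ a) _ _ (≡.trans (interchange (n ∸ a) (n ∸ a) a a)
      (≡.trans (cong₂ ℕ._+_ (ℕ.m∸n+n≡m a≤n) (ℕ.m∸n+n≡m a≤n))
      (≡.trans (cong (ℕ._+ n) (≡.sym (ℕ.m∸n+n≡m (ℕ.<⇒≤ 2a<n)))) (xy∙z≈xz∙y (n ∸ (a ℕ.+ a)) (a ℕ.+ a) n))))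
      where
      open import Algebra.Properties.CommutativeSemigroup ℕ.+-commutativeSemigroup using (interchange; xy∙z≈xz∙y)
      a≤n : a ≤ n
      a≤n = ℕ.≤-trans (ℕ.m≤m+n a a) (ℕ.<⇒≤ 2a<n)

  -- One more binary digit 1: G(n-2a) G(n-1) = J G(n-2a-1), where J is a unit and G(n-1) is even.
  I-G-double+1 : ∀ s a → 0 < a → suc (a ℕ.+ a) < n → I s (G (n ∸ a)) → I (suc s) (G (n ∸ suc (a ℕ.+ a)))
  I-G-double+1 s a 0<a 1+2a<n div = I-cong (R.trans (R.reflexive (cong G exponent)) (G-periodic e))
    (I-cancel (J r m) (G (r ℕ.+ m)) (λ eq → 1≉0 (trans (sym J≈1) eq))
      (I-cong (R.trans (R.*-comm (G m) (G r)) (R.trans (G-⊗ r m nontrivial) (R.*-comm (G (r ℕ.+ m)) (J r m))))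
        (I-* {1} (I-G m 0<m (γ^≉1 m 0<m (ℕ.n<1+n m))) (I-G-double s a 2a<n div))))
    where
    2a<n : a ℕ.+ a < n
    2a<n = ℕ.<-trans (ℕ.n<1+n _) 1+2a<n
    1<n : 1 < n
    1<n = ℕ.≤-trans (s≤s (s≤s z≤n)) 1+2a<n
    0<m : 0 < m
    0<m = ℕ.s≤s⁻¹ 1<n
    r = n ∸ (a ℕ.+ a)
    e = n ∸ suc (a ℕ.+ a)
    1+e≡r : suc e ≡ r
    1+e≡r = ≡.sym (ℕ.+-∸-assoc 1 2a<n)
    exponent : r ℕ.+ m ≡ e ℕ.+ n
    exponent = ≡.trans (cong (ℕ._+ m) (≡.sym 1+e≡r)) (≡.sym (ℕ.+-suc e m))
    nontrivial : ¬ γ ^ (r ℕ.+ m) ≈ 1#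
    nontrivial eq = γ^≉1 e (ℕ.m<n⇒0<n∸m 1+2a<n) (ℕ.∸-monoʳ-< {n} {o = 0} (s≤s z≤n) (ℕ.<⇒≤ 1+2a<n))
      (trans (sym (γ^-periodic e 1)) (trans (reflexive (cong (γ ^_) (≡.trans (cong (e ℕ.+_) (ℕ.*-identityˡ n)) (≡.sym exponent)))) eq))
    h = proj₁ n-odd
    n≡1+2h = proj₂ n-odd
    a≤h : a ≤ h
    a≤h = ℕ.≮⇒≥ λ h<a → ℕ.<⇒≱ 2a<n (ℕ.≤-trans (ℕ.≤-reflexive n≡1+2h) (ℕ.≤-trans (ℕ.+-mono-≤ h<a (ℕ.<⇒≤ h<a)) ℕ.≤-refl))
    -- r is odd because n is, which is what `eval-J` asks for.
    r≡1+2k : r ≡ suc (h ∸ a ℕ.+ (h ∸ a))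
    r≡1+2k = ℕ.+-cancelʳ-≡ (a ℕ.+ a) _ _ (≡.trans (ℕ.m∸n+n≡m (ℕ.<⇒≤ 2a<n)) (≡.trans n≡1+2h
      (cong suc (≡.sym (≡.trans (interchange (h ∸ a) (h ∸ a) a a) (cong₂ ℕ._+_ (ℕ.m∸n+n≡m a≤h) (ℕ.m∸n+n≡m a≤h)))))))
      where open import Algebra.Properties.CommutativeSemigroup ℕ.+-commutativeSemigroup using (interchange)
    r<n : r < n
    r<n = ℕ.∸-monoʳ-< {n} {o = 0} (ℕ.≤-trans 0<a (ℕ.m≤m+n a a)) (ℕ.<⇒≤ 2a<n)
    J≈1 : eval (J r m) ≈ 1#
    J≈1 = trans (reflexive (cong (λ i → eval (J i m)) r≡1+2k)) (eval-J (h ∸ a) 1<n (subst (_< n) r≡1+2k r<n))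

  module _ (N M j : ℕ) .{{_ : ℕ.NonZero N}} (n≡MN : n ≡ M ℕ.* N) (0<j : 0 < j) (j<N : j < N) (1<n : 1 < n) where

    -- Long division of j by N in base 2. As 2^f j = j + M j N, the prefix after f steps is M j, so
    -- `digit` runs through the f binary digits of M j from the top.
    residue prefix digit digitSum : ℕ → ℕ
    residue i = (2 ℕ.^ i ℕ.* j) % N
    prefix i  = (2 ℕ.^ i ℕ.* j) / N
    digit i   = (residue i ℕ.+ residue i) / N
    digitSum zero    = 0
    digitSum (suc i) = digitSum i ℕ.+ digit i

    private
      double : ∀ i → 2 ℕ.^ suc i ℕ.* j ≡ residue i ℕ.+ residue i ℕ.+ (prefix i ℕ.+ prefix i) ℕ.* N
      double i = ≡.trans (cong (ℕ._* j) (cong (2 ℕ.^ i ℕ.+_) (ℕ.+-identityʳ (2 ℕ.^ i)))) (≡.trans (ℕ.*-distribʳ-+ j (2 ℕ.^ i) (2 ℕ.^ i))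
        (≡.trans (cong₂ ℕ._+_ eq eq) (≡.trans (interchange (residue i) (prefix i ℕ.* N) (residue i) (prefix i ℕ.* N))
        (cong (residue i ℕ.+ residue i ℕ.+_) (≡.sym (ℕ.*-distribʳ-+ N (prefix i) (prefix i)))))))
        where
        open import Algebra.Properties.CommutativeSemigroup ℕ.+-commutativeSemigroup using (interchange)
        eq : 2 ℕ.^ i ℕ.* j ≡ residue i ℕ.+ prefix i ℕ.* N
        eq = DM.m≡m%n+[m/n]*n (2 ℕ.^ i ℕ.* j) N

      prefix-suc : ∀ i → prefix (suc i) ≡ digit i ℕ.+ (prefix i ℕ.+ prefix i)
      prefix-suc i = ≡.trans (cong (λ k → k / N) (double i)) (≡.trans (DM.+-distrib-/-∣ʳ (residue i ℕ.+ residue i)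
          (ℕD.n∣m*n (prefix i ℕ.+ prefix i)))
        (cong (digit i ℕ.+_) (DM.m*n/n≡m (prefix i ℕ.+ prefix i) N)))

      residue-suc : ∀ i → residue i ℕ.+ residue i ≡ residue (suc i) ℕ.+ digit i ℕ.* N
      residue-suc i = ≡.trans (DM.m≡m%n+[m/n]*n (residue i ℕ.+ residue i) N) (cong (ℕ._+ digit i ℕ.* N)
        (≡.sym (≡.trans (cong (_% N) (double i)) (DM.[m+kn]%n≡m%n (residue i ℕ.+ residue i) (prefix i ℕ.+ prefix i) N))))

      digit≤1 : ∀ i → digit i ≡ 0 ⊎ digit i ≡ 1
      digit≤1 i = small (digit i) (ℕ.*-cancelʳ-< N (digit i) 2 (ℕ.≤-<-trans (DM.m/n*n≤m (residue i ℕ.+ residue i) N)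
        (ℕ.<-≤-trans (ℕ.+-mono-< (DM.m%n<n (2 ℕ.^ i ℕ.* j) N) (DM.m%n<n (2 ℕ.^ i ℕ.* j) N))
          (ℕ.≤-reflexive (cong (N ℕ.+_) (≡.sym (ℕ.+-identityʳ N)))))))
        where
        small : ∀ k → k < 2 → k ≡ 0 ⊎ k ≡ 1
        small zero          _ = inj₁ ≡.refl
        small (suc zero)    _ = inj₂ ≡.refl
        small (suc (suc k)) (s≤s (s≤s ()))

      2^f*j : 2 ℕ.^ f ℕ.* j ≡ j ℕ.+ M ℕ.* j ℕ.* N
      2^f*j = ≡.trans (cong (ℕ._* j) (≡.trans (≡.sym 1+n≡2^f) (cong suc n≡MN)))
        (cong (j ℕ.+_) (xy∙z≈xz∙y M N j))
        where open import Algebra.Properties.CommutativeSemigroup ℕ.*-commutativeSemigroup using (xy∙z≈xz∙y)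

      prefix-f : prefix f ≡ M ℕ.* j
      prefix-f = ≡.trans (cong (λ k → k / N) 2^f*j) (≡.trans (DM.+-distrib-/-∣ʳ j (ℕD.n∣m*n (M ℕ.* j)))
        (cong₂ ℕ._+_ (DM.m<n⇒m/n≡0 j<N) (DM.m*n/n≡m (M ℕ.* j) N)))

      residue-f : residue f ≡ residue 0
      residue-f = ≡.trans (cong (_% N) 2^f*j) (≡.trans (DM.[m+kn]%n≡m%n j (M ℕ.* j) N) (cong (_% N) (≡.sym (ℕ.*-identityˡ j))))

      0<M : 0 < M
      0<M = ℕ.n≢0⇒n>0 (λ M≡0 → ℕ.<⇒≢ (s≤s z≤n) (≡.sym (≡.trans n≡MN (cong (ℕ._* N) M≡0))))

      Mj<n : M ℕ.* j < n
      Mj<n = subst (M ℕ.* j <_) (≡.sym n≡MN) (ℕ.*-monoʳ-< M {{ℕ.>-nonZero 0<M}} j<N)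

      prefix<n : ∀ i → i ≤ f → prefix i < n
      prefix<n i i≤f = ℕ.≤-<-trans (ℕ.≤-trans (DM./-monoˡ-≤ N (ℕ.*-monoˡ-≤ j (ℕ.^-monoʳ-≤ 2 i≤f))) (ℕ.≤-reflexive prefix-f)) Mj<n

      -- While only zeros have been read, the prefix is 0 and its character is trivial; divisibility
      -- is claimed from the first digit 1 on.
      Divisible : ℕ → ℕ → Set
      Divisible s p = (p ≡ 0 × s ≡ 0) ⊎ (0 < p × I s (G (n ∸ p)))

      append : ∀ s p δ → δ ≡ 0 ⊎ δ ≡ 1 → δ ℕ.+ (p ℕ.+ p) < n → Divisible s p → Divisible (s ℕ.+ δ) (δ ℕ.+ (p ℕ.+ p))
      append s .0 .0 (inj₁ ≡.refl) _ (inj₁ (≡.refl , ≡.refl)) = inj₁ (≡.refl , ≡.refl)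
      append s .0 .1 (inj₂ ≡.refl) _ (inj₁ (≡.refl , ≡.refl)) = inj₂ (s≤s z≤n , I-G m (ℕ.s≤s⁻¹ 1<n) (γ^≉1 m (ℕ.s≤s⁻¹ 1<n) (ℕ.n<1+n m)))
      append s p .0 (inj₁ ≡.refl) 2p<n (inj₂ (0<p , div)) =
        inj₂ (ℕ.≤-trans 0<p (ℕ.m≤m+n p p) , subst (λ t → I t (G (n ∸ (p ℕ.+ p)))) (≡.sym (ℕ.+-identityʳ s)) (I-G-double s p 2p<n div))
      append s p .1 (inj₂ ≡.refl) 2p<n (inj₂ (0<p , div)) =
        inj₂ (s≤s z≤n , subst (λ t → I t (G (n ∸ suc (p ℕ.+ p)))) (ℕ.+-comm 1 s) (I-G-double+1 s p 0<p 2p<n div))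

      prefixes : ∀ i → i ≤ f → Divisible (digitSum i) (prefix i)
      prefixes zero    _   = inj₁ (DM.m<n⇒m/n≡0 (ℕ.≤-<-trans (ℕ.≤-reflexive (ℕ.*-identityˡ j)) j<N) , ≡.refl)
      prefixes (suc i) i<f = subst (Divisible (digitSum (suc i))) (≡.sym (prefix-suc i))
        (append (digitSum i) (prefix i) (digit i) (digit≤1 i) (subst (_< n) (prefix-suc i) (prefix<n (suc i) i<f)) (prefixes i (ℕ.<⇒≤ i<f)))

    I-G-digitSum : I (digitSum f) (G (n ∸ M ℕ.* j))
    I-G-digitSum = finish (prefixes f ℕ.≤-refl)
      where
      finish : Divisible (digitSum f) (prefix f) → I (digitSum f) (G (n ∸ M ℕ.* j))
      finish (inj₁ (p≡0 , _)) = ⊥-elim (ℕ.<⇒≢ (ℕ.*-mono-≤ 0<M 0<j) (≡.trans (≡.sym p≡0) prefix-f))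
      finish (inj₂ (_ , div)) = subst (λ p → I (digitSum f) (G (n ∸ p))) prefix-f div

    -- Summing 2 r_i = r_(i+1) + N d_i over one period telescopes, because the residue returns to
    -- its starting value after f steps.
    N*digitSum : Z.Σ< f (λ i → + residue i) ≡ + (digitSum f ℕ.* N)
    N*digitSum = ℤ+.∙-cancelʳ (+ residue 0) _ _ (≡.trans (telescope f) (cong (λ k → + (digitSum f ℕ.* N) ℤ.+ + k) residue-f))
      where
      open ≡.≡-Reasoning
      shuffle : ∀ s r c t → s ℤ.+ r ≡ c ℤ.+ t → ∀ t′ c′ → t ℤ.+ t ≡ t′ ℤ.+ c′ → s ℤ.+ t ℤ.+ r ≡ c ℤ.+ c′ ℤ.+ t′
      shuffle s r c t eq t′ c′ eq′ = begin
        s ℤ.+ t ℤ.+ r ≡⟨ l₁ s t r ⟩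
        s ℤ.+ r ℤ.+ t ≡⟨ cong (ℤ._+ t) eq ⟩
        c ℤ.+ t ℤ.+ t ≡⟨ ℤ.+-assoc c t t ⟩
        c ℤ.+ (t ℤ.+ t) ≡⟨ cong (ℤ._+_ c) eq′ ⟩
        c ℤ.+ (t′ ℤ.+ c′) ≡⟨ l₂ c t′ c′ ⟩
        c ℤ.+ c′ ℤ.+ t′ ∎
        where
        l₁ : ∀ s t r → s ℤ.+ t ℤ.+ r ≡ s ℤ.+ r ℤ.+ t
        l₁ = solve-∀
        l₂ : ∀ c t c′ → c ℤ.+ (t ℤ.+ c′) ≡ c ℤ.+ c′ ℤ.+ t
        l₂ = solve-∀
      telescope : ∀ i → Z.Σ< i (λ k → + residue k) ℤ.+ + residue 0 ≡ + (digitSum i ℕ.* N) ℤ.+ + residue i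
      telescope zero    = cong (ℤ._+ + residue 0) (Z.Σ-empty _)
      telescope (suc i) = ≡.trans (cong (ℤ._+ + residue 0) (Z.Σ-snoc i (λ k → + residue k)))
        (≡.trans (shuffle (Z.Σ< i (λ k → + residue k)) (+ residue 0) (+ (digitSum i ℕ.* N)) (+ residue i) (telescope i)
          (+ residue (suc i)) (+ (digit i ℕ.* N)) (cong +_ (residue-suc i)))
          (cong (λ k → + k ℤ.+ + residue (suc i)) (≡.sym (ℕ.*-distribʳ-+ N (digitSum i) (digit i)))))

    -- By `N*digitSum` the bound says that the digit sum is at least K, and divisibility by 2^K
    -- means vanishing in the ring.
    G≋0 : + (K ℕ.* N) ℤ.≤ Z.Σ< f (λ i → + residue i) → G (n ∸ M ℕ.* j) ≋ con 0ℤ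
    G≋0 bound = I-K⇒≋0 (I-antitone (ℕ.*-cancelʳ-≤ K (digitSum f) N (ℤ.drop‿+≤+ (subst (+ (K ℕ.* N) ℤ.≤_) N*digitSum bound))) I-G-digitSum)

-- Arithmetic modulo prime powers

-- Two witnesses, so that no subtraction is needed.
infix 4 _≡_mod_
_≡_mod_ : ℕ → ℕ → ℕ → Set
x ≡ y mod N = ∃[ a ] ∃[ b ] x ℕ.+ a ℕ.* N ≡ y ℕ.+ b ℕ.* N

%≡⇒mod : ∀ {x y} N .{{_ : NonZero N}} → x % N ≡ y % N → x ≡ y mod N
%≡⇒mod {x} {y} N eq = y / N , x / N , (begin
  x ℕ.+ y / N ℕ.* N ≡⟨ cong (ℕ._+ y / N ℕ.* N) (DM.m≡m%n+[m/n]*n x N) ⟩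
  x % N ℕ.+ x / N ℕ.* N ℕ.+ y / N ℕ.* N ≡⟨ cong (λ r → r ℕ.+ x / N ℕ.* N ℕ.+ y / N ℕ.* N) eq ⟩
  y % N ℕ.+ x / N ℕ.* N ℕ.+ y / N ℕ.* N ≡⟨ swap (y % N) (x / N ℕ.* N) (y / N ℕ.* N) ⟩
  y % N ℕ.+ y / N ℕ.* N ℕ.+ x / N ℕ.* N ≡⟨ cong (ℕ._+ x / N ℕ.* N) (DM.m≡m%n+[m/n]*n y N) ⟨
  y ℕ.+ x / N ℕ.* N ∎)
  where
  open ≡.≡-Reasoning
  swap : ∀ a b c → a ℕ.+ b ℕ.+ c ≡ a ℕ.+ c ℕ.+ b
  swap = solve-ℕ

mod-* : ∀ {x y} N p → x ≡ y mod N → x ℕ.* p ≡ y ℕ.* p mod (N ℕ.* p)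
mod-* {x} {y} N p (a , b , eq) = a , b , ≡.trans (distrib x a N p) (≡.trans (cong (ℕ._* p) eq) (≡.sym (distrib y b N p)))
  where
  distrib : ∀ x a N p → x ℕ.* p ℕ.+ a ℕ.* (N ℕ.* p) ≡ (x ℕ.+ a ℕ.* N) ℕ.* p
  distrib = solve-ℕ

[y+z]%≡y%⇒∣z : ∀ y z N .{{_ : NonZero N}} → (y ℕ.+ z) % N ≡ y % N → N ∣ z
[y+z]%≡y%⇒∣z y z N eq with %≡⇒mod {y ℕ.+ z} {y} N eq
... | a , b , eq′ = ℕD.∣m+n∣m⇒∣n (divides b (≡.trans (ℕ.+-comm (a ℕ.* N) z)
        (ℕ.+-cancelˡ-≡ y _ _ (≡.trans (≡.sym (ℕ.+-assoc y z _)) eq′)))) (divides a ≡.refl)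

prime-power-cancel : ∀ {p} → Prime p → ∀ k x y → p ∤ x → p ℕ.^ k ∣ x ℕ.* y → p ℕ.^ k ∣ y
prime-power-cancel pr zero    x y _   _ = ℕD.1∣ y
prime-power-cancel {p} pr (suc k) x y p∤x d with euclidsLemma x y pr (ℕD.∣-trans (ℕD.m∣m*n (p ℕ.^ k)) d)
... | inj₁ p∣x = ⊥-elim (p∤x p∣x)
... | inj₂ (divides y′ ≡.refl) = subst (p ℕ.^ suc k ∣_) (ℕ.*-comm p y′) (ℕD.*-monoʳ-∣ p
        (prime-power-cancel pr k x y′ p∤x (ℕD.*-cancelˡ-∣ p {{prime⇒nonZero pr}} (subst (p ℕ.^ suc k ∣_) (shuffle x y′ p) d))))
  where
  shuffle : ∀ x y′ p → x ℕ.* (y′ ℕ.* p) ≡ p ℕ.* (x ℕ.* y′)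
  shuffle = solve-ℕ

module OnePlusPrime (p h : ℕ) (pr : Prime p) (p≡1+2h : p ≡ 1 ℕ.+ 2 ℕ.* h) where
  open import Data.Nat.Base using (_+_; _*_; _^_)
  instance
    p-nonZero : NonZero p
    p-nonZero = prime⇒nonZero pr

  1<p : 1 < p
  1<p = ℕ.nonTrivial⇒n>1 p {{prime⇒nonTrivial pr}}

  p^-nonZero : ∀ k → NonZero (p ^ k)
  p^-nonZero k = ℕ.m^n≢0 p k

  -- s e is the geometric sum ((1+p)^e - 1) / p.
  s : ℕ → ℕ
  s zero    = 0
  s (suc e) = 1 + (1 + p) * s e

  [1+p]^ : ∀ e → (1 + p) ^ e ≡ 1 + p * s e
  [1+p]^ zero    = cong suc (≡.sym (ℕ.*-zeroʳ p))
  [1+p]^ (suc e) = ≡.trans (cong ((1 + p) *_) ([1+p]^ e)) (expand p (s e))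
    where
    expand : ∀ p s → (1 + p) * (1 + p * s) ≡ 1 + p * (1 + (1 + p) * s)
    expand = solve-ℕ

  s-+ : ∀ a b → s (a + b) ≡ s a + s b + p * (s a * s b)
  s-+ zero    b = ≡.sym (≡.trans (cong (s b ℕ.+_) (ℕ.*-zeroʳ p)) (ℕ.+-identityʳ (s b)))
  s-+ (suc a) b = ≡.trans (cong (λ t → 1 + (1 + p) * t) (s-+ a b)) (expand p (s a) (s b))
    where
    expand : ∀ p x y → 1 + (1 + p) * (x + y + p * (x * y))
             ≡ 1 + (1 + p) * x + y + p * ((1 + (1 + p) * x) * y)
    expand = solve-ℕ

  s≡e+p* : ∀ e → ∃[ t ] s e ≡ e + p * t
  s≡e+p* zero = 0 , ≡.sym (ℕ.*-zeroʳ p)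
  s≡e+p* (suc e) with s≡e+p* e
  ... | t , eq = t + s e , cong suc (≡.trans (cong (_+ p * s e) eq) (regroup e p t (s e)))
    where
    regroup : ∀ e p t s → e + p * t + p * s ≡ e + p * (t + s)
    regroup = solve-ℕ

  private
    triangle : ℕ → ℕ
    triangle zero    = 0
    triangle (suc i) = triangle i + i

    2*triangle : ∀ i → 2 * triangle i + i ≡ i * i
    2*triangle zero    = ≡.refl
    2*triangle (suc i) = ≡.trans (l₁ (triangle i) i) (≡.trans (cong (λ t → t + 2 * i + 1) (2*triangle i)) (l₂ i))
      where
      l₁ : ∀ t i → 2 * (t + i) + (1 + i) ≡ 2 * t + i + 2 * i + 1
      l₁ = solve-ℕ
      l₂ : ∀ i → i * i + 2 * i + 1 ≡ (1 + i) * (1 + i)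
      l₂ = solve-ℕ

    triangle-p : triangle p ≡ p * h
    triangle-p = ℕ.*-cancelˡ-≡ _ _ 2 (ℕ.+-cancelʳ-≡ p _ _ (≡.trans (2*triangle p)
      (≡.trans (cong (p *_) p≡1+2h) (expand p h))))
      where
      expand : ∀ p h → p * (1 + 2 * h) ≡ 2 * (p * h) + p
      expand = solve-ℕ

    -- The binomial expansion of (1 + p s(e))^i to second order, less 1 and divided by p.
    s-multiple : ∀ e i → ∃[ w ] s (i * e) ≡ s e * (i + p * s e * triangle i + p * p * w)
    s-multiple e zero = 0 , vanish p (s e)
      where
      vanish : ∀ p x → 0 ≡ x * (0 + p * x * 0 + p * p * 0)
      vanish = solve-ℕ
    s-multiple e (suc i) with s-multiple e i
    ... | w , eq = w + s e * (s e * triangle i + p * w) ,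
          ≡.trans (s-+ e (i * e)) (≡.trans (cong (λ t → s e + t + p * (s e * t)) eq) (expand p (s e) i (triangle i) w))
      where
      expand : ∀ p x i t w → x + x * (i + p * x * t + p * p * w) + p * (x * (x * (i + p * x * t + p * p * w)))
        ≡ x * (1 + i + p * x * (t + i) + p * p * (w + x * (x * t + p * w)))
      expand = solve-ℕ

  -- Lifting the exponent: passing from e to p e gains exactly one factor p. Oddness of p enters
  -- through the second-order term, since p (p - 1)/2 = p h is a multiple of p.
  s-p* : ∀ e → ∃[ u ] s (p * e) ≡ p * ((1 + p * u) * s e)
  s-p* e with s-multiple e p
  ... | w , eq = s e * h + w , ≡.trans eq (≡.trans (cong (λ t → s e * (p + p * s e * t + p * p * w)) triangle-p) (expand p (s e) h w))
    where
    expand : ∀ p x h w → x * (p + p * x * (p * h) + p * p * w) ≡ p * ((1 + p * (x * h + w)) * x)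
    expand = solve-ℕ

  p∤1+p* : ∀ u → p ∤ 1 + p * u
  p∤1+p* u d = ℕ.<⇒≢ 1<p (≡.sym (ℕD.∣1⇒≡1 (ℕD.∣m+n∣m⇒∣n (subst (p ∣_) (ℕ.+-comm 1 (p * u)) d) (ℕD.m∣m*n u))))

  -- s(e) ≡ e modulo p makes e a multiple of p, and `s-p*` then removes one factor p on each side.
  p^k∣s⇒p^k∣ : ∀ k e → p ^ k ∣ s e → p ^ k ∣ e
  p^k∣s⇒p^k∣ zero    e _ = ℕD.1∣ e
  p^k∣s⇒p^k∣ (suc k) e d with s≡e+p* e
  ... | t , eq with ℕD.∣m+n∣m⇒∣n {p} {p * t} {e} (subst (p ∣_) (≡.trans eq (ℕ.+-comm e (p * t))) (ℕD.∣-trans (ℕD.m∣m*n (p ^ k)) d)) (ℕD.m∣m*n t)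
  ... | divides e₁ ≡.refl with s-p* e₁
  ... | u , eq₁ = subst (p ^ suc k ∣_) (ℕ.*-comm p e₁) (ℕD.*-monoʳ-∣ p (p^k∣s⇒p^k∣ k e₁
          (prime-power-cancel pr k (1 + p * u) (s e₁) (p∤1+p* u)
            (ℕD.*-cancelˡ-∣ p (subst (p ^ suc k ∣_) (≡.trans (cong s (ℕ.*-comm e₁ p)) eq₁) d)))))

  p^k∣s[p^k] : ∀ k → p ^ k ∣ s (p ^ k)
  p^k∣s[p^k] zero    = ℕD.1∣ s 1
  p^k∣s[p^k] (suc k) with s-p* (p ^ k)
  ... | u , eq = subst (p ^ suc k ∣_) (≡.sym eq) (ℕD.*-monoʳ-∣ p (ℕD.∣n⇒∣m*n (1 + p * u) (p^k∣s[p^k] k)))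

  module _ (k : ℕ) where
    private
      L = p ^ k
      N = p ^ suc k
      instance
        N-nonZero : NonZero N
        N-nonZero = p^-nonZero (suc k)
        L-nonZero : NonZero L
        L-nonZero = p^-nonZero k

    [1+p]^L%N : (1 + p) ^ L % N ≡ 1 % N
    [1+p]^L%N = ≡.trans (cong (_% N) ([1+p]^ L)) (DM.%-remove-+ʳ 1 (ℕD.*-monoʳ-∣ p (p^k∣s[p^k] k)))

    -- The difference of the two numbers is p (1 + p)^a c s(b - a); one factor p of N is used up and
    -- the rest must divide s(b - a).
    power-difference : ∀ c a b → p ∤ c → a ≤ b → ((1 + p) ^ b * c) % N ≡ ((1 + p) ^ a * c) % N → L ∣ b ∸ a
    power-difference c a b p∤c a≤b eq = p^k∣s⇒p^k∣ k (b ∸ a) (prime-power-cancel pr k ((1 + p) ^ a * c) (s (b ∸ a)) p∤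
      (ℕD.*-cancelˡ-∣ p ([y+z]%≡y%⇒∣z ((1 + p) ^ a * c) (p * ((1 + p) ^ a * c * s (b ∸ a))) N (≡.trans (cong (_% N) (≡.sym split)) eq))))
      where
      split : (1 + p) ^ b * c ≡ (1 + p) ^ a * c + p * ((1 + p) ^ a * c * s (b ∸ a))
      split = ≡.trans (cong (λ t → (1 + p) ^ t * c) (≡.sym (ℕ.m+[n∸m]≡n a≤b)))
        (≡.trans (cong (_* c) (≡.trans (ℕ.^-distribˡ-+-* (1 + p) a (b ∸ a)) (cong ((1 + p) ^ a *_) ([1+p]^ (b ∸ a)))))
        (expand ((1 + p) ^ a) p (s (b ∸ a)) c))
        where
        expand : ∀ x p s c → x * (1 + p * s) * c ≡ x * c + p * (x * c * s)
        expand = solve-ℕ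
      p∤ : p ∤ (1 + p) ^ a * c
      p∤ d = [ (λ d′ → p∤1+p* (s a) (subst (p ∣_) ([1+p]^ a) d′)) , p∤c ]′ (euclidsLemma ((1 + p) ^ a) c pr d)

    module _ (c : ℕ) (p∤c : p ∤ c) where
      private
        value : ℕ → ℕ
        value l = ((1 + p) ^ l * c) % N

        value%p : ∀ l → value l % p ≡ c % p
        value%p l = ≡.trans (DM.m∣n⇒o%n%m≡o%m p N ((1 + p) ^ l * c) {{p-nonZero}} (ℕD.m∣m*n L))
          (≡.trans (cong (_% p) (≡.trans (cong (_* c) ([1+p]^ l)) (expand p (s l) c))) (DM.[m+kn]%n≡m%n c (s l * c) p))
          where
          expand : ∀ p s c → (1 + p * s) * c ≡ c + s * c * p
          expand = solve-ℕ

        value/p< : ∀ l → value l / p < L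
        value/p< l = DM.m<n*o⇒m/o<n (subst (value l <_) (ℕ.*-comm p L) (DM.m%n<n ((1 + p) ^ l * c) N))

        value-split : ∀ l → value l ≡ c % p + value l / p * p
        value-split l = ≡.trans (DM.m≡m%n+[m/n]*n (value l) p) (cong (_+ value l / p * p) (value%p l))

        injective-≤ : ∀ i j → j < L → i ≤ j → value i ≡ value j → i ≡ j
        injective-≤ i j j<L i≤j eq with ℕ.m≤n⇒m<n∨m≡n i≤j
        ... | inj₂ i≡j = i≡j
        ... | inj₁ i<j = ⊥-elim (ℕ.<⇒≱ (ℕ.≤-<-trans (ℕ.m∸n≤m j i) j<L)
                (ℕD.∣⇒≤ {{ℕ.>-nonZero (ℕ.m<n⇒0<n∸m i<j)}} (power-difference c i j p∤c i≤j (≡.sym eq))))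

        injective : ∀ i j → i < L → j < L → value i / p ≡ value j / p → i ≡ j
        injective i j i<L j<L eq = [ (λ i≤j → injective-≤ i j j<L i≤j eq′) ,
          (λ j≤i → ≡.sym (injective-≤ j i i<L j≤i (≡.sym eq′))) ]′ (ℕ.≤-total i j)
          where
          eq′ : value i ≡ value j
          eq′ = ≡.trans (value-split i) (≡.trans (cong (λ t → c % p + t * p) eq) (≡.sym (value-split j)))

      -- The residues (1+p)^l c for l < p^k are exactly the c % p + k p: 1+p generates 1 + pℤ modulo p^(k+1).
      powers : ∃[ ρ ] (∀ l → ((1 + p) ^ l * c) % N ≡ c % p + Reindexing.to {L} ρ l * p)
      powers = proj₁ quotients , λ l → ≡.trans (value-split l) (cong (λ t → c % p + t * p) (≡.sym (proj₂ quotients l)))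
        where
        quotients : ∃[ ρ ] (∀ l → Reindexing.to {L} ρ l ≡ value l / p)
        quotients = injective⇒reindexing L (λ l → value l / p) (λ l _ → value/p< l) injective

      reach : ∀ c′ → c′ % p ≡ c % p → ∃[ l ] ((1 + p) ^ l * c) % N ≡ c′ % N
      reach c′ eq = from t , ≡.trans (proj₂ powers (from t)) (≡.trans (cong₂ (λ a b → a + b * p) (≡.sym eq)
          (to-from t t<L)) (≡.sym c′-split))
        where
        open Reindexing (proj₁ powers)
        t : ℕ
        t = (c′ % N) / p
        t<L : t < L
        t<L = DM.m<n*o⇒m/o<n (subst (c′ % N <_) (ℕ.*-comm p L) (DM.m%n<n c′ N))
        c′-split : c′ % N ≡ c′ % p + t * p
        c′-split = ≡.trans (DM.m≡m%n+[m/n]*n (c′ % N) p) (cong (_+ t * p) (DM.m∣n⇒o%n%m≡o%m p N c′ {{p-nonZero}} (ℕD.m∣m*n L)))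

  -- If p ∤ j and the exponent k is positive, then j and j + p^k agree modulo p, so a power of 1 + p
  -- carries one to the other modulo p^(k+1). Otherwise a factor p is divided out of j, of p^k and
  -- of the modulus.
  translate : ∀ k j → p ^ k ∤ j → ∃[ l ] (1 + p) ^ l * j ≡ j + p ^ k mod (p ^ suc k)
  translate zero    j 1∤j = ⊥-elim (1∤j (ℕD.1∣ j))
  translate (suc k) j p^∤j with p ℕD.∣? j
  ... | no p∤j = proj₁ l , %≡⇒mod (p ^ suc (suc k)) {{p^-nonZero (suc (suc k))}} (proj₂ l)
    where
    l : ∃[ l ] _%_ ((1 + p) ^ l * j) (p ^ suc (suc k)) {{p^-nonZero (suc (suc k))}}
               ≡ _%_ (j + p ^ suc k) (p ^ suc (suc k)) {{p^-nonZero (suc (suc k))}}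
    l = reach (suc k) j p∤j (j + p ^ suc k) (DM.%-remove-+ʳ j (ℕD.m∣m*n (p ^ k)))
  ... | yes (divides j₁ ≡.refl) = proj₁ l , subst₂ (λ x y → x ≡ y mod (p ^ suc (suc k))) (ℕ.*-assoc ((1 + p) ^ proj₁ l) j₁ p)
            (≡.trans (ℕ.*-distribʳ-+ p j₁ (p ^ k)) (cong (j₁ * p ℕ.+_) (ℕ.*-comm (p ^ k) p)))
            (subst (λ M → (1 + p) ^ proj₁ l * j₁ * p ≡ (j₁ + p ^ k) * p mod M) (ℕ.*-comm (p ^ suc k) p) (mod-* (p ^ suc k) p (proj₂ l)))
    where
    l : ∃[ l ] (1 + p) ^ l * j₁ ≡ j₁ + p ^ k mod (p ^ suc k)
    l = translate k j₁ (λ d → p^∤j (subst (_∣ j₁ * p) (ℕ.*-comm (p ^ k) p) (ℕD.*-monoˡ-∣ p d)))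

-- Euler's totient at prime powers

module Totient (p : ℕ) (pr : Prime p) where
  open import Data.Nat.Base using (_+_; _*_; _^_)
  private
    instance
      p-nonZero′ : NonZero p
      p-nonZero′ = prime⇒nonZero pr

    count : ∀ {P : ℕ → Set} → Decidable P → (ℕ → ℕ) → ℕ → ℕ
    count P? h n = length (filter P? (applyUpTo h n))

    count-+ : ∀ {P : ℕ → Set} (P? : Decidable P) h m n → count P? h (m + n) ≡ count P? h m + count P? (λ k → h (m + k)) n
    count-+ P? h zero    n = ≡.refl
    count-+ P? h (suc m) n with P? (h 0)
    ... | yes _ = cong suc (count-+ P? (h ∘ suc) m n)
    ... | no  _ = count-+ P? (h ∘ suc) m n

    count-all : ∀ {P : ℕ → Set} (P? : Decidable P) h n → (∀ k → k < n → P (h k)) → count P? h n ≡ n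
    count-all P? h zero    _   = ≡.refl
    count-all P? h (suc n) all with P? (h 0)
    ... | yes _ = cong suc (count-all P? (h ∘ suc) n (λ k k<n → all (suc k) (s≤s k<n)))
    ... | no ¬P = ⊥-elim (¬P (all 0 (s≤s z≤n)))

    count-reject : ∀ {P : ℕ → Set} (P? : Decidable P) h n → ¬ P (h 0) → count P? h (suc n) ≡ count P? (h ∘ suc) n
    count-reject P? h n ¬P with P? (h 0)
    ... | yes P0 = ⊥-elim (¬P P0)
    ... | no _   = ≡.refl

    count-cong : ∀ {P : ℕ → Set} (P? : Decidable P) {h h′} n → (∀ k → h k ≡ h′ k) → count P? h n ≡ count P? h′ n
    count-cong P? {h} {h′} n eq = cong (length ∘ filter P?) (go h h′ n eq)
      where
      go : ∀ (h h′ : ℕ → ℕ) n → (∀ k → h k ≡ h′ k) → applyUpTo h n ≡ applyUpTo h′ n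
      go h h′ zero    eq = ≡.refl
      go h h′ (suc n) eq = cong₂ _∷_ (eq 0) (go (h ∘ suc) (h′ ∘ suc) n (eq ∘ suc))

  coprime-power : ∀ k x → p ∤ x → Coprime x (p ^ k)
  coprime-power zero    x _   (_ , d∣1) = ℕD.∣1⇒≡1 d∣1
  coprime-power (suc k) x p∤x {d} (d∣x , d∣p^) = coprime-power k x p∤x (d∣x , coprime-divisor d⊥p d∣p^)
    where
    d⊥p : Coprime d p
    d⊥p (e∣d , e∣p) with prime⇒irreducible pr e∣p
    ... | inj₁ e≡1    = e≡1
    ... | inj₂ ≡.refl = ⊥-elim (p∤x (ℕD.∣-trans e∣d d∣x))

  -- The numbers below p^(k+1) form p^k blocks of length p, and only the first of each block is
  -- divisible by p.
  φ-power : ∀ k → φ (p ^ suc k) ≡ p ^ k * ℕ.pred p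
  φ-power k = ≡.trans (cong (count P? id) (ℕ.*-comm p (p ^ k))) (blocks (p ^ k) 0)
    where
    N = p ^ suc k
    P? : Decidable (λ x → Coprime x N)
    P? x = coprime? x N
    reject : ∀ o → ¬ Coprime (o * p + 0) N
    reject o cop = ℕ.<⇒≢ (ℕ.nonTrivial⇒n>1 p {{prime⇒nonTrivial pr}})
      (≡.sym (cop (divides o (ℕ.+-identityʳ (o * p)) , ℕD.m∣m*n (p ^ k))))
    accept : ∀ o j → j < ℕ.pred p → Coprime (o * p + suc j) N
    accept o j j<p = coprime-power (suc k) _ λ d → ℕD.>⇒∤ (ℕ.<-≤-trans (s≤s j<p) (ℕ.≤-reflexive (ℕ.suc-pred p)))
      (ℕD.∣m+n∣m⇒∣n d (divides o ≡.refl))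
    block : ∀ o → count P? (λ j → o * p + j) p ≡ ℕ.pred p
    block o = ≡.trans (cong (count P? (λ j → o * p + j)) (≡.sym (ℕ.suc-pred p)))
      (≡.trans (count-reject P? (λ j → o * p + j) (ℕ.pred p) (reject o))
      (count-all P? (λ j → o * p + suc j) (ℕ.pred p) (accept o)))
    blocks : ∀ t o → count P? (λ j → o * p + j) (t * p) ≡ t * ℕ.pred p
    blocks zero    o = ≡.refl
    blocks (suc t) o = ≡.trans (count-+ P? (λ j → o * p + j) p (t * p)) (cong₂ _+_ (block o)
      (≡.trans (count-cong P? (t * p) (λ j → ≡.trans (≡.sym (ℕ.+-assoc (o * p) p j))
          (cong (_+ j) (ℕ.+-comm (o * p) p)))) (blocks t (suc o))))

-- Mersenne primes

Σ-const : ∀ n c → Z.Σ< n (λ _ → c) ≡ + n ℤ.* c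
Σ-const zero    c = Z.Σ-empty _
Σ-const (suc n) c = ≡.trans (Z.Σ-cons n _) (≡.trans (cong (ℤ._+_ c) (Σ-const n c)) (≡.sym (ℤ.suc-* (+ n) c)))

Σ-mono : ∀ n {f g : ℕ → ℤ} → (∀ k → k < n → f k ℤ.≤ g k) → Z.Σ< n f ℤ.≤ Z.Σ< n g
Σ-mono zero    f≤g = ℤ.≤-reflexive (≡.trans (Z.Σ-empty _) (≡.sym (Z.Σ-empty _)))
Σ-mono (suc n) {f} {g} f≤g = subst₂ ℤ._≤_ (≡.sym (Z.Σ-cons n f)) (≡.sym (Z.Σ-cons n g))
  (ℤ.+-mono-≤ (f≤g 0 (s≤s z≤n)) (Σ-mono n (λ k k<n → f≤g (suc k) (s≤s k<n))))

2*Σid : ∀ n → + 2 ℤ.* Z.Σ< n (+_) ℤ.+ + n ≡ + n ℤ.* + n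
2*Σid zero    = cong (λ t → + 2 ℤ.* t ℤ.+ + 0) (Z.Σ-empty _)
2*Σid (suc n) = ≡.trans (cong (λ t → + 2 ℤ.* t ℤ.+ + suc n) (Z.Σ-snoc n (+_)))
  (≡.trans (l₁ (Z.Σ< n (+_)) (+ n)) (≡.trans (cong (λ t → t ℤ.+ + 2 ℤ.* + n ℤ.+ 1ℤ) (2*Σid n)) (l₂ (+ n))))
  where
  l₁ : ∀ s n → + 2 ℤ.* (s ℤ.+ n) ℤ.+ (1ℤ ℤ.+ n) ≡ + 2 ℤ.* s ℤ.+ n ℤ.+ + 2 ℤ.* n ℤ.+ 1ℤ
  l₁ = solve-∀
  l₂ : ∀ n → n ℤ.* n ℤ.+ + 2 ℤ.* n ℤ.+ 1ℤ ≡ (1ℤ ℤ.+ n) ℤ.* (1ℤ ℤ.+ n)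
  l₂ = solve-∀

-- Sums are formed in ℤ for its ring laws; this returns to ℕ for divisibility and for the step from
-- p ∣ t to p ≤ t.
pos-Σ : ∀ n (g : ℕ → ℕ) → ∃[ t ] Z.Σ< n (λ k → + g k) ≡ + t × (0 < n → (∀ k → 0 < g k) → 0 < t)
pos-Σ zero    g = 0 , Z.Σ-empty _ , λ 0<0 _ → 0<0
pos-Σ (suc n) g with pos-Σ n (g ∘ suc)
... | t , eq , _ = g 0 ℕ.+ t , ≡.trans (Z.Σ-cons n _) (cong (ℤ._+_ (+ g 0)) eq) , λ _ pos → ℕ.≤-trans (pos 0) (ℕ.m≤m+n (g 0) t)

module MersennePrime (p r h : ℕ) (pr : Prime p) (1+p≡2^r : 1 ℕ.+ p ≡ 2 ℕ.^ r) (p≡1+2h : p ≡ 1 ℕ.+ 2 ℕ.* h) where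
  open import Data.Nat.Base using (_+_; _*_; _^_)
  open OnePlusPrime p h pr p≡1+2h public

  0<r : 0 < r
  0<r = pos r 1+p≡2^r
    where
    pos : ∀ r → 1 + p ≡ 2 ^ r → 0 < r
    pos zero    eq = ⊥-elim (ℕ.<⇒≢ (ℕ.>-nonZero⁻¹ p) (≡.sym (ℕ.suc-injective eq)))
    pos (suc r) _  = s≤s z≤n

  p∤2 : p ∤ 2
  p∤2 d = p∤1+p* 0 (subst (p ∣_) (cong suc (≡.sym (ℕ.*-zeroʳ p)))
    (ℕD.∣m+n∣m⇒∣n (subst (p ∣_) (≡.trans p≡1+2h (ℕ.+-comm 1 (2 * h))) ℕD.∣-refl) (ℕD.∣m⇒∣m*n h d)))

  p∤2^*j : ∀ i j → p ∤ j → p ∤ 2 ^ i * j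
  p∤2^*j zero    j p∤j d = p∤j (subst (p ∣_) (ℕ.*-identityˡ j) d)
  p∤2^*j (suc i) j p∤j d = [ p∤2 , p∤2^*j i j p∤j ]′ (euclidsLemma 2 (2 ^ i * j) pr (subst (p ∣_) (ℕ.*-assoc 2 (2 ^ i) j) d))

  -- The Mersenne property: every r-th power of 2 is a power of 1 + p, which fixes classes modulo p,
  -- while the remaining 2^s moves them.
  2^[l*r+s] : ∀ l s → 2 ^ (l * r + s) ≡ (1 + p) ^ l * 2 ^ s
  2^[l*r+s] l s = ≡.trans (ℕ.^-distribˡ-+-* 2 (l * r) s) (cong (_* 2 ^ s)
    (≡.trans (cong (2 ^_) (ℕ.*-comm l r)) (≡.trans (≡.sym (ℕ.^-*-assoc 2 r l)) (cong (_^ l) (≡.sym 1+p≡2^r)))))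

  odd-power : ∀ k → ∃[ g ] p ^ k ≡ 1 + 2 * g
  odd-power zero    = 0 , ≡.refl
  odd-power (suc k) with odd-power k
  ... | g , eq = g + h + 2 * (h * g) , ≡.trans (cong₂ _*_ p≡1+2h eq) (expand h g)
    where
    expand : ∀ h g → (1 + 2 * h) * (1 + 2 * g) ≡ 1 + 2 * (g + h + 2 * (h * g))
    expand = solve-ℕ

  private
    orbit : ℕ → ℤ
    orbit j = Z.Σ< r (λ s → + ((2 ^ s * j) % p))

    Σ2^ : ∀ i → Z.Σ< i (λ s → + (2 ^ s)) ℤ.+ 1ℤ ≡ + (2 ^ i)
    Σ2^ zero    = cong (ℤ._+ 1ℤ) (Z.Σ-empty _)
    Σ2^ (suc i) = ≡.trans (cong (ℤ._+ 1ℤ) (Z.Σ-snoc i (λ s → + (2 ^ s)))) (≡.trans (swap (Z.Σ< i (λ s → + (2 ^ s))) (+ (2 ^ i)))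
      (≡.trans (cong (ℤ._+ + (2 ^ i)) (Σ2^ i)) (cong (λ t → + (2 ^ i + t)) (≡.sym (ℕ.+-identityʳ (2 ^ i))))))
      where
      swap : ∀ a b → a ℤ.+ b ℤ.+ 1ℤ ≡ a ℤ.+ 1ℤ ℤ.+ b
      swap = solve-∀

    Σ2^r : Z.Σ< r (λ s → + (2 ^ s)) ≡ + p
    Σ2^r = ℤ+.∙-cancelʳ 1ℤ _ _ (≡.trans (Σ2^ r) (≡.trans (cong +_ (≡.sym 1+p≡2^r)) (ℤ.+-comm 1ℤ (+ p))))

    -- The sum of the residues 2^s j % p is a positive multiple of p, being congruent to (1 + 2 + ⋯ + 2^(r-1)) j = p j.
    p≤orbit : ∀ j → p ∤ j → + p ℤ.≤ orbit j
    p≤orbit j p∤j with pos-Σ r (λ s → (2 ^ s * j) % p) | pos-Σ r (λ s → (2 ^ s * j) / p)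
    ... | t , eq , t-pos | u , eq′ , _ = subst (+ p ℤ.≤_) (≡.sym eq) (ℤ.+≤+ (ℕD.∣⇒≤ {{ℕ.>-nonZero 0<t}} p∣t))
      where
      0<t : 0 < t
      0<t = t-pos 0<r (λ s → ℕ.n≢0⇒n>0 (λ rem≡0 → p∤2^*j s j p∤j (ℕD.m%n≡0⇒n∣m (2 ^ s * j) p rem≡0)))
      t+up : + t ℤ.+ + u ℤ.* + p ≡ + p ℤ.* + j
      t+up = begin
        + t ℤ.+ + u ℤ.* + p ≡⟨ cong₂ (λ a b → a ℤ.+ b ℤ.* + p) eq eq′ ⟨
        orbit j ℤ.+ Z.Σ< r (λ s → + ((2 ^ s * j) / p)) ℤ.* + p ≡⟨ cong (ℤ._+_ (orbit j)) (Z.Σ-*ʳ r (+ p) _) ⟩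
        orbit j ℤ.+ Z.Σ< r (λ s → + ((2 ^ s * j) / p) ℤ.* + p) ≡⟨ Z.Σ-+ r _ _ ⟨
        Z.Σ< r (λ s → + ((2 ^ s * j) % p) ℤ.+ + ((2 ^ s * j) / p) ℤ.* + p) ≡⟨ Z.Σ-cong′ r split ⟩
        Z.Σ< r (λ s → + (2 ^ s) ℤ.* + j) ≡⟨ Z.Σ-*ʳ r (+ j) _ ⟨
        Z.Σ< r (λ s → + (2 ^ s)) ℤ.* + j ≡⟨ cong (ℤ._* + j) Σ2^r ⟩
        + p ℤ.* + j ∎
        where
        open ≡.≡-Reasoning
        split : ∀ s → + ((2 ^ s * j) % p) ℤ.+ + ((2 ^ s * j) / p) ℤ.* + p ≡ + (2 ^ s) ℤ.* + j
        split s = ≡.trans (cong (ℤ._+_ (+ ((2 ^ s * j) % p))) (≡.sym (ℤ.pos-* ((2 ^ s * j) / p) p)))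
          (≡.trans (cong +_ (≡.sym (DM.m≡m%n+[m/n]*n (2 ^ s * j) p))) (ℤ.pos-* (2 ^ s) j))
      p∣t : p ∣ t
      p∣t = ℕD.∣m+n∣m⇒∣n (subst (p ∣_) (≡.trans (≡.sym (ℤ.+-injective (≡.trans (cong (ℤ._+_ (+ t)) (ℤ.pos-* u p))
          (≡.trans t+up (≡.sym (ℤ.pos-* p j))))))
              (ℕ.+-comm t (u * p))) (ℕD.m∣m*n j)) (ℕD.n∣m*n u)

  module _ (k g : ℕ) (L≡1+2g : p ^ k ≡ 1 + 2 * g) where
    private
      L = p ^ k
      N = p ^ suc k
      instance
        N-nonZero : NonZero N
        N-nonZero = p^-nonZero (suc k)

      ΣL : Z.Σ< L (+_) ≡ + L ℤ.* + g
      ΣL = ℤ.*-cancelˡ-≡ (+ 2) _ _ (ℤ+.∙-cancelʳ (+ L) _ _ (≡.trans (2*Σid L) (≡.trans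
             (cong (ℤ._*_ (+ L)) (≡.trans (cong +_ L≡1+2g) (cong (ℤ._+_ 1ℤ) (ℤ.pos-* 2 g)))) (expand (+ L) (+ g)))))
        where
        expand : ∀ l g → l ℤ.* (1ℤ ℤ.+ + 2 ℤ.* g) ≡ + 2 ℤ.* (l ℤ.* g) ℤ.+ l
        expand = solve-∀

      -- By `powers` the residues fill the class of c modulo p, so they sum to L (c % p) + p L (L -
      -- 1)/2, where (L - 1)/2 = g.
      row : ∀ c → p ∤ c → Z.Σ< L (λ l → + (((1 + p) ^ l * c) % N)) ≡ + L ℤ.* + (c % p) ℤ.+ + L ℤ.* + g ℤ.* + p
      row c p∤c = begin
        Z.Σ< L (λ l → + (((1 + p) ^ l * c) % N)) ≡⟨ Z.Σ-cong′ L (λ l → ≡.trans (cong +_ (proj₂ (powers k c p∤c) l))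
          (cong (ℤ._+_ (+ (c % p))) (ℤ.pos-* (to l) p))) ⟩
        Z.Σ< L (λ l → + (c % p) ℤ.+ + to l ℤ.* + p) ≡⟨ Z.Σ-+ L (λ _ → + (c % p)) (λ l → + to l ℤ.* + p) ⟩
        Z.Σ< L (λ _ → + (c % p)) ℤ.+ Z.Σ< L (λ l → + to l ℤ.* + p) ≡⟨ cong₂ ℤ._+_ (Σ-const L (+ (c % p)))
          (≡.sym (Z.Σ-*ʳ L (+ p) (λ l → + to l))) ⟩
        + L ℤ.* + (c % p) ℤ.+ Z.Σ< L (λ l → + to l) ℤ.* + p ≡⟨ cong (λ t → + L ℤ.* + (c % p) ℤ.+ t ℤ.* + p)
          (≡.trans (Z.Σ-reindex (proj₁ (powers k c p∤c)) (λ i → + i)) ΣL) ⟩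
        + L ℤ.* + (c % p) ℤ.+ + L ℤ.* + g ℤ.* + p ∎
        where
        open ≡.≡-Reasoning
        open Reindexing (proj₁ (powers k c p∤c)) using (to)

    residue-sum : ∀ j → p ∤ j → Z.Σ< (L * r) (λ i → + ((2 ^ i * j) % N)) ≡ + L ℤ.* (orbit j ℤ.+ + r ℤ.* (+ g ℤ.* + p))
    residue-sum j p∤j = begin
      Z.Σ< (L * r) (λ i → + ((2 ^ i * j) % N)) ≡⟨ Z.Σ-block L r _ ⟩
      Z.Σ< L (λ l → Z.Σ< r (λ s → + ((2 ^ (l * r + s) * j) % N))) ≡⟨ Z.Σ-cong′ L
          (λ l → Z.Σ-cong′ r (λ s → cong (λ t → + (t % N)) (≡.trans (cong (_* j) (2^[l*r+s] l s))
          (ℕ.*-assoc ((1 + p) ^ l) (2 ^ s) j)))) ⟩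
      Z.Σ< L (λ l → Z.Σ< r (λ s → + (((1 + p) ^ l * (2 ^ s * j)) % N))) ≡⟨ Z.Σ-swap L r _ ⟩
      Z.Σ< r (λ s → Z.Σ< L (λ l → + (((1 + p) ^ l * (2 ^ s * j)) % N))) ≡⟨ Z.Σ-cong′ r
          (λ s → ≡.trans (row (2 ^ s * j) (p∤2^*j s j p∤j)) (factor (+ L) (+ ((2 ^ s * j) % p)) (+ g) (+ p))) ⟩
      Z.Σ< r (λ s → + L ℤ.* (+ ((2 ^ s * j) % p) ℤ.+ + g ℤ.* + p)) ≡⟨ Z.Σ-*ˡ r (+ L) _ ⟨
      + L ℤ.* Z.Σ< r (λ s → + ((2 ^ s * j) % p) ℤ.+ + g ℤ.* + p) ≡⟨ cong (ℤ._*_ (+ L))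
          (≡.trans (Z.Σ-+ r _ _) (cong (ℤ._+_ (orbit j)) (Σ-const r (+ g ℤ.* + p)))) ⟩
      + L ℤ.* (orbit j ℤ.+ + r ℤ.* (+ g ℤ.* + p)) ∎
      where
      open ≡.≡-Reasoning
      factor : ∀ l c g p → l ℤ.* c ℤ.+ l ℤ.* g ℤ.* p ≡ l ℤ.* (c ℤ.+ g ℤ.* p)
      factor = solve-∀

    -- The orbit contributes at least p, and L (p + r g p) = (1 + r g) N; this is the source of θ =
    -- 1 + r g.
    residue-bound : ∀ j → p ∤ j → + ((1 + r * g) * N) ℤ.≤ Z.Σ< (L * r) (λ i → + ((2 ^ i * j) % N))
    residue-bound j p∤j = subst₂ ℤ._≤_ (≡.sym total) (≡.sym (residue-sum j p∤j))
      (ℤ.*-monoˡ-≤-nonNeg (+ L) (ℤ.+-monoˡ-≤ (+ r ℤ.* (+ g ℤ.* + p)) (p≤orbit j p∤j)))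
      where
      total : + ((1 + r * g) * N) ≡ + L ℤ.* (+ p ℤ.+ + r ℤ.* (+ g ℤ.* + p))
      total = ≡.trans (ℤ.pos-* (1 + r * g) N) (≡.trans (cong₂ (λ a b → (1ℤ ℤ.+ a) ℤ.* b) (ℤ.pos-* r g) (ℤ.pos-* p L))
          (expand (+ r) (+ g) (+ p) (+ L)))
        where
        expand : ∀ r g p l → (1ℤ ℤ.+ r ℤ.* g) ℤ.* (p ℤ.* l) ≡ l ℤ.* (p ℤ.+ r ℤ.* (g ℤ.* p))
        expand = solve-∀

    2^f%N : 2 ^ (L * r) % N ≡ 1 % N
    2^f%N = ≡.trans (cong (_% N) (≡.trans (cong (2 ^_) (≡.sym (ℕ.+-identityʳ (L * r))))
        (≡.trans (2^[l*r+s] L 0) (ℕ.*-identityʳ _)))) ([1+p]^L%N k)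

    -- Modulo p, the part 2^s₀ with s₀ = e % r must be 1, and being at most p it forces s₀ = 0. Then
    -- (1 + p)^t ≡ 1 modulo N forces L to divide t = e / r.
    order-minimal : ∀ e → 1 ≤ e → 2 ^ e % N ≡ 1 % N → L * r ≤ e
    order-minimal e 1≤e eq = subst (L * r ≤_) (≡.sym e≡t*r) (ℕ.*-monoˡ-≤ r (ℕD.∣⇒≤ {{ℕ.>-nonZero 0<t}}
      (power-difference k 1 0 t p∤1 z≤n (≡.trans (cong (_% N) (≡.sym 2^e)) eq))))
      where
      instance
        r-nonZero : NonZero r
        r-nonZero = ℕ.>-nonZero 0<r
      t s₀ : ℕ
      t  = e / r
      s₀ = e % r
      p∤1 : p ∤ 1
      p∤1 d = ℕ.<⇒≢ 1<p (≡.sym (ℕD.∣1⇒≡1 d))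
      e-split : e ≡ t * r + s₀
      e-split = ≡.trans (DM.m≡m%n+[m/n]*n e r) (ℕ.+-comm s₀ (t * r))
      2^s₀<p+1 : 2 ^ s₀ < 1 + p
      2^s₀<p+1 = subst (2 ^ s₀ <_) (≡.sym 1+p≡2^r) (ℕ.^-monoʳ-< 2 (s≤s (s≤s z≤n)) (DM.m%n<n e r))
      2^s₀%p : 2 ^ s₀ % p ≡ 1
      2^s₀%p = begin
        2 ^ s₀ % p ≡⟨ DM.[m+kn]%n≡m%n (2 ^ s₀) (s t * 2 ^ s₀) p ⟨
        (2 ^ s₀ + s t * 2 ^ s₀ * p) % p ≡⟨ cong (_% p) (≡.sym (≡.trans
          (≡.trans (cong (2 ^_) e-split) (2^[l*r+s] t s₀)) (≡.trans (cong (_* 2 ^ s₀) ([1+p]^ t)) (expand p (s t) (2 ^ s₀))))) ⟩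
        2 ^ e % p ≡⟨ DM.m∣n⇒o%n%m≡o%m p N (2 ^ e) {{p-nonZero}} (ℕD.m∣m*n L) ⟨
        2 ^ e % N % p ≡⟨ cong (_% p) eq ⟩
        1 % N % p ≡⟨ DM.m∣n⇒o%n%m≡o%m p N 1 {{p-nonZero}} (ℕD.m∣m*n L) ⟩
        1 % p ≡⟨ DM.m<n⇒m%n≡m 1<p ⟩
        1 ∎
        where
        open ≡.≡-Reasoning
        expand : ∀ p s c → (1 + p * s) * c ≡ c + s * c * p
        expand = solve-ℕ
      s₀≡0 : s₀ ≡ 0
      s₀≡0 = zero-exponent s₀ 2^s₀<p+1 2^s₀%p
        where
        zero-exponent : ∀ i → 2 ^ i < 1 + p → 2 ^ i % p ≡ 1 → i ≡ 0
        zero-exponent zero    _  _   = ≡.refl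
        zero-exponent (suc i) lt rem = ⊥-elim ([ (λ <p → ℕ.<⇒≢ 1<2^ (≡.sym (≡.trans (≡.sym (DM.m<n⇒m%n≡m <p)) rem)))
              , (λ ≡p → ℕ.<⇒≢ (s≤s z≤n) (≡.trans (≡.sym (DM.n%n≡0 p)) (≡.trans (cong (_% p) (≡.sym ≡p)) rem))) ]′
                (ℕ.m≤n⇒m<n∨m≡n (ℕ.s≤s⁻¹ lt)))
          where
          1<2^ : 1 < 2 ^ suc i
          1<2^ = ℕ.^-monoʳ-< 2 (s≤s (s≤s z≤n)) {0} {suc i} (s≤s z≤n)
      e≡t*r : e ≡ t * r
      e≡t*r = ≡.trans e-split (≡.trans (cong (t * r ℕ.+_) s₀≡0) (ℕ.+-identityʳ _))
      0<t : 0 < t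
      0<t = ℕ.n≢0⇒n>0 (λ t≡0 → ℕ.<⇒≢ 1≤e (≡.sym (≡.trans e≡t*r (cong (_* r) t≡0))))
      2^e : 2 ^ e ≡ (1 + p) ^ t * 1
      2^e = ≡.trans (cong (2 ^_) (≡.trans e≡t*r (≡.sym (ℕ.+-identityʳ _)))) (2^[l*r+s] t 0)

-- Gauss periods

module GaussPeriods {c ℓ : Level} {q : ℕ} (F : FiniteField c ℓ q)
  (γ : FiniteField.Carrier F) (prim : IsPrimitive F γ)
  (p r h : ℕ) (pr : Prime p) (1+p≡2^r : 1 ℕ.+ p ≡ 2 ℕ.^ r) (p≡1+2h : p ≡ 1 ℕ.+ 2 ℕ.* h) (k : ℕ)
  (q≡2^f : q ≡ 2 ℕ.^ (p ℕ.^ k ℕ.* r)) where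
  open FiniteField F
  open Characteristic2 F γ prim (p ℕ.^ k ℕ.* r) q≡2^f
  open MersennePrime p r h pr 1+p≡2^r p≡1+2h
  open import Algebra.Properties.Semiring.Exp semiring using (^-congˡ; ^-homo-*; ^-assocʳ)
  open import Algebra.Properties.CommutativeSemiring.Exp commutativeSemiring using (^-distrib-*)
  private
    module ZF = SumF ℤ-ring

  L N : ℕ
  L = p ℕ.^ k
  N = p ℕ.^ suc k

  instance
    N-nonZero : NonZero N
    N-nonZero = p^-nonZero (suc k)
    L-nonZero : NonZero L
    L-nonZero = p^-nonZero k

  opaque
    N∣n : N ℕD.∣ n
    N∣n = [y+z]%≡y%⇒∣z 1 n N (≡.trans (cong (_% N) 1+n≡2^f) (2^f%N k (proj₁ (odd-power k)) (proj₂ (odd-power k))))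

  M : ℕ
  M = ℕD.quotient N∣n

  n≡M*N : n ≡ M ℕ.* N
  n≡M*N = ℕD._∣_.equality N∣n

  n≡N*M : n ≡ N ℕ.* M
  n≡N*M = ≡.trans n≡M*N (ℕ.*-comm M N)

  0<M : 0 < M
  0<M = ℕ.n≢0⇒n>0 (λ M≡0 → ℕ.<⇒≢ (s≤s z≤n) (≡.sym (≡.trans n≡M*N (cong (ℕ._* N) M≡0))))

  γ^-mod-N : ∀ a b → γ ^ a ≈ γ ^ b → a % N ≡ b % N
  γ^-mod-N a b eq = ≡.trans (≡.sym (DM.m∣n⇒o%n%m≡o%m N n a N∣n)) (≡.trans (cong (_% N) (γ^≈⇒%≡ a b eq)) (DM.m∣n⇒o%n%m≡o%m N n b N∣n))

  γ^-wrap : ∀ a t → γ ^ (a ℕ.+ t ℕ.* M ℕ.* N) ≈ γ ^ a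
  γ^-wrap a t = trans (reflexive (cong (λ e → γ ^ (a ℕ.+ e)) (≡.trans (ℕ.*-assoc t M N) (cong (t ℕ.*_) (≡.sym n≡M*N))))) (γ^-periodic a t)

  η : ℕ → ℤ
  η a = Z.Σ< M (λ i → ψ (γ ^ (a ℕ.+ i ℕ.* N)))

  η-periodic : ∀ a → η (a ℕ.+ N) ≡ η a
  η-periodic a = ≡.trans (Z.Σ-cong′ M (λ i → cong (ψ ∘ (γ ^_)) (ℕ.+-assoc a N (i ℕ.* N))))
    (Z.Σ-periodic M (λ i → ψ (γ ^ (a ℕ.+ i ℕ.* N))) wrap 1)
    where
    wrap : ∀ i → ψ (γ ^ (a ℕ.+ (i ℕ.+ M) ℕ.* N)) ≡ ψ (γ ^ (a ℕ.+ i ℕ.* N))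
    wrap i = ψ-cong (trans (reflexive (cong (γ ^_) (shuffle a i M N))) (γ^-wrap (a ℕ.+ i ℕ.* N) 1))
      where
      shuffle : ∀ a i M N → a ℕ.+ (i ℕ.+ M) ℕ.* N ≡ a ℕ.+ i ℕ.* N ℕ.+ 1 ℕ.* M ℕ.* N
      shuffle = solve-ℕ

  η-periodic* : ∀ a t → η (a ℕ.+ t ℕ.* N) ≡ η a
  η-periodic* a zero    = cong η (ℕ.+-identityʳ a)
  η-periodic* a (suc t) = ≡.trans (cong η (≡.sym (ℕ.+-assoc a N (t ℕ.* N)))) (≡.trans (η-periodic* (a ℕ.+ N) t) (η-periodic a))

  η-mod : ∀ {a b} → a ≡ b mod N → η a ≡ η b
  η-mod {a} {b} (s , t , eq) = ≡.trans (≡.sym (η-periodic* a s)) (≡.trans (cong η eq) (η-periodic* b t))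

  private
    -- E (γ^a) = N η_a, but as a sum over all x ≠ 0 it allows substitutions.
    E : Carrier → ℤ
    E b = ZF.ΣF* (λ x → ψ (b * x ^ N))

    E-η : ∀ a → E (γ ^ a) ≡ + N ℤ.* η a
    E-η a = begin
      Z.Σ< n (λ e → ψ (γ ^ a * (γ ^ e) ^ N)) ≡⟨ cong (λ m → Z.Σ< m (λ e → ψ (γ ^ a * (γ ^ e) ^ N))) n≡N*M ⟩
      Z.Σ< (N ℕ.* M) (λ e → ψ (γ ^ a * (γ ^ e) ^ N)) ≡⟨ Z.Σ-block N M _ ⟩
      Z.Σ< N (λ t → Z.Σ< M (λ i → ψ (γ ^ a * (γ ^ (t ℕ.* M ℕ.+ i)) ^ N))) ≡⟨ Z.Σ-cong′ N (λ t → Z.Σ-cong′ M (λ i → ψ-cong (unwrap t i))) ⟩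
      Z.Σ< N (λ t → η a) ≡⟨ Σ-const N (η a) ⟩
      + N ℤ.* η a ∎
      where
      open ≡.≡-Reasoning
      shuffle : ∀ a t i M N → a ℕ.+ (t ℕ.* M ℕ.+ i) ℕ.* N ≡ a ℕ.+ i ℕ.* N ℕ.+ t ℕ.* M ℕ.* N
      shuffle = solve-ℕ
      unwrap : ∀ t i → γ ^ a * (γ ^ (t ℕ.* M ℕ.+ i)) ^ N ≈ γ ^ (a ℕ.+ i ℕ.* N)
      unwrap t i = trans (*-congˡ (^-assocʳ γ (t ℕ.* M ℕ.+ i) N)) (trans (sym (^-homo-* γ a ((t ℕ.* M ℕ.+ i) ℕ.* N)))
        (trans (reflexive (cong (γ ^_) (shuffle a t i M N))) (γ^-wrap (a ℕ.+ i ℕ.* N) t)))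

    -- Substituting x² for x makes the argument the square of b x^N, and ψ is invariant under
    -- squaring.
    E-sq : ∀ b → E (b * b) ≡ E b
    E-sq b = ≡.trans (≡.sym (ZF.ΣF*-bijection squaring (λ x → ψ (b * b * x ^ N)) (zeroˡ 0#) (λ eq → ψ-cong (*-congˡ (^-congˡ N eq)))))
      (ZF.ΣF*-cong (λ x → ≡.trans (ψ-cong (trans (*-congˡ (^-distrib-* x x N)) (interchange b b (x ^ N) (x ^ N)))) (ψ-sq (b * x ^ N))))
      where open import Algebra.Properties.CommutativeSemigroup *-commutativeSemigroup using (interchange)

  η-double : ∀ a → η (a ℕ.+ a) ≡ η a
  η-double a = ℤ.*-cancelˡ-≡ (+ N) _ _ (≡.trans (≡.sym (E-η (a ℕ.+ a))) (≡.trans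
    (ZF.ΣF*-cong {λ x → ψ (γ ^ (a ℕ.+ a) * x ^ N)} {λ x → ψ (γ ^ a * γ ^ a * x ^ N)}
        (λ x → ψ-cong (*-congʳ (^-homo-* γ a a)))) (≡.trans (E-sq (γ ^ a)) (E-η a))))

  η-2^ : ∀ i a → η (2 ℕ.^ i ℕ.* a) ≡ η a
  η-2^ zero    a = cong η (ℕ.+-identityʳ a)
  η-2^ (suc i) a = ≡.trans (cong η (≡.trans (ℕ.*-assoc 2 (2 ℕ.^ i) a) (cong (2 ℕ.^ i ℕ.* a ℕ.+_) (ℕ.+-identityʳ (2 ℕ.^ i ℕ.* a)))))
    (≡.trans (η-double (2 ℕ.^ i ℕ.* a)) (η-2^ i a))

  η-translate : ∀ j → ¬ L ℕD.∣ j → η (j ℕ.+ L) ≡ η j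
  η-translate j L∤j = ≡.trans (≡.sym (η-mod (proj₂ l))) (≡.trans (cong (λ t → η (t ℕ.* j))
      (≡.trans (≡.sym (ℕ.*-identityʳ ((1 ℕ.+ p) ℕ.^ proj₁ l))) (≡.sym (2^[l*r+s] (proj₁ l) 0)))) (η-2^ (proj₁ l ℕ.* r ℕ.+ 0) j))
    where
    l : ∃[ l ] (1 ℕ.+ p) ℕ.^ l ℕ.* j ≡ j ℕ.+ L mod N
    l = translate k j L∤j

  L∤j+L : ∀ j → ¬ L ℕD.∣ j → ¬ L ℕD.∣ j ℕ.+ L
  L∤j+L j L∤j d = L∤j (ℕD.∣m+n∣m⇒∣n (subst (L ℕD.∣_) (ℕ.+-comm j L) d) ℕD.∣-refl)

  η-translate* : ∀ t j → ¬ L ℕD.∣ j → η (j ℕ.+ t ℕ.* L) ≡ η j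
  η-translate* zero    j L∤j = cong η (ℕ.+-identityʳ j)
  η-translate* (suc t) j L∤j = ≡.trans (cong η (≡.sym (ℕ.+-assoc j L (t ℕ.* L))))
    (≡.trans (η-translate* t (j ℕ.+ L) (L∤j+L j L∤j)) (η-translate j L∤j))

  Σψ*≡-1 : ∀ b → ¬ b ≈ 0# → Z.Σ< n (λ e → ψ (γ ^ e * b)) ≡ -1ℤ
  Σψ*≡-1 b b≉0 = drop (ψ 0#) _ ψ-0 (≡.trans (≡.sym (≡.trans (Z.Σ-cons n _)
      (cong₂ ℤ._+_ (ψ-cong (zeroʳ b)) (Z.Σ-cong′ n (λ e → ψ-cong (*-comm b (γ ^ e))))))) (Σψ-scaled≡0 b b≉0))
    where
    drop : ∀ x y → x ≡ 1ℤ → x ℤ.+ y ≡ 0ℤ → y ≡ -1ℤ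
    drop .1ℤ y ≡.refl eq = ≡.trans (≡.sym (cancel y)) (cong (ℤ._+_ -1ℤ) eq)
      where
      cancel : ∀ y → -1ℤ ℤ.+ (1ℤ ℤ.+ y) ≡ y
      cancel = solve-∀

  Σψ*-zero : ∀ b → b ≈ 0# → Z.Σ< n (λ e → ψ (γ ^ e * b)) ≡ + n
  Σψ*-zero b b≈0 = ≡.trans (Z.Σ-cong′ n (λ e → ≡.trans (ψ-cong (trans (*-congˡ b≈0) (zeroʳ (γ ^ e)))) ψ-0))
      (≡.trans (Σ-const n 1ℤ) (ℤ.*-identityʳ (+ n)))

  B : ℕ → ℤ
  B d = Z.Σ< N (λ j → η j ℤ.* η (j ℕ.+ d))

  private
    -- Letting e run over all n exponents repeats each residue modulo N exactly M times and
    -- completes the innermost sum to one over F*.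
    M*B : ∀ d → + M ℤ.* B d ≡ Z.Σ< M (λ i → Z.Σ< M (λ i′ → Z.Σ< n (λ e → ψ (γ ^ e * (γ ^ (i ℕ.* N) + γ ^ (d ℕ.+ i′ ℕ.* N))))))
    M*B d = begin
      + M ℤ.* B d ≡⟨ Σ-const M (B d) ⟨
      Z.Σ< M (λ t → B d) ≡⟨ Z.Σ-cong′ M (λ t → Z.Σ-cong′ N (λ j → cong₂ ℤ._*_ (at t j)
          (≡.trans (at t (j ℕ.+ d)) (cong η (≡.sym (ℕ.+-assoc (t ℕ.* N) j d)))))) ⟩
      Z.Σ< M (λ t → Z.Σ< N (λ j → η (t ℕ.* N ℕ.+ j) ℤ.* η (t ℕ.* N ℕ.+ j ℕ.+ d))) ≡⟨ Z.Σ-block M N _ ⟨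
      Z.Σ< (M ℕ.* N) (λ e → η e ℤ.* η (e ℕ.+ d)) ≡⟨ cong (λ m → Z.Σ< m (λ e → η e ℤ.* η (e ℕ.+ d))) n≡M*N ⟨
      Z.Σ< n (λ e → η e ℤ.* η (e ℕ.+ d)) ≡⟨ Z.Σ-cong′ n (λ e → Z.Σ-product M M _ _) ⟩
      Z.Σ< n (λ e → Z.Σ< M (λ i → Z.Σ< M (λ i′ → ψ (γ ^ (e ℕ.+ i ℕ.* N)) ℤ.* ψ (γ ^ (e ℕ.+ d ℕ.+ i′ ℕ.* N))))) ≡⟨
          Z.Σ-cong′ n (λ e → Z.Σ-cong′ M (λ i → Z.Σ-cong′ M (λ i′ → merge e i i′))) ⟩
      Z.Σ< n (λ e → Z.Σ< M (λ i → Z.Σ< M (λ i′ → term e i i′))) ≡⟨ Z.Σ-swap n M _ ⟩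
      Z.Σ< M (λ i → Z.Σ< n (λ e → Z.Σ< M (λ i′ → term e i i′))) ≡⟨ Z.Σ-cong′ M (λ i → Z.Σ-swap n M _) ⟩
      Z.Σ< M (λ i → Z.Σ< M (λ i′ → Z.Σ< n (λ e → term e i i′))) ∎
      where
      open ≡.≡-Reasoning
      term : ℕ → ℕ → ℕ → ℤ
      term e i i′ = ψ (γ ^ e * (γ ^ (i ℕ.* N) + γ ^ (d ℕ.+ i′ ℕ.* N)))
      at : ∀ t j → η j ≡ η (t ℕ.* N ℕ.+ j)
      at t j = ≡.trans (≡.sym (η-periodic* j t)) (cong η (ℕ.+-comm j (t ℕ.* N)))
      merge : ∀ e i i′ → ψ (γ ^ (e ℕ.+ i ℕ.* N)) ℤ.* ψ (γ ^ (e ℕ.+ d ℕ.+ i′ ℕ.* N)) ≡ term e i i′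
      merge e i i′ = ≡.trans (≡.sym (ψ-+ (γ ^ (e ℕ.+ i ℕ.* N)) (γ ^ (e ℕ.+ d ℕ.+ i′ ℕ.* N))))
          (ψ-cong (trans (+-cong (^-homo-* γ e (i ℕ.* N))
        (trans (reflexive (cong (γ ^_) (ℕ.+-assoc e d (i′ ℕ.* N)))) (^-homo-* γ e (d ℕ.+ i′ ℕ.* N))))
          (sym (distribˡ (γ ^ e) (γ ^ (i ℕ.* N)) (γ ^ (d ℕ.+ i′ ℕ.* N))))))

    x+y≈0⇒x≈y : ∀ {x y} → x + y ≈ 0# → x ≈ y
    x+y≈0⇒x≈y {x} {y} eq = trans (inverseˡ-unique x y eq) (-x≈x y)
      where open import Algebra.Properties.Group +-group using (inverseˡ-unique)

  -- The two powers of γ have exponents that differ modulo N, so their sum is never 0 and each of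
  -- the M² inner sums is -1.
  B-nonzero : ∀ d → 0 < d → d < N → B d ≡ ℤ.- + M
  B-nonzero d 0<d d<N = ℤ.*-cancelˡ-≡ (+ M) _ _ {{ℕ.>-nonZero 0<M}} (≡.trans (M*B d) (≡.trans
    (Z.Σ-cong′ M (λ i → Z.Σ-cong′ M (λ i′ → Σψ*≡-1 _ (distinct i i′))))
    (≡.trans (Z.Σ-cong′ M (λ i → Σ-const M -1ℤ)) (≡.trans (Σ-const M (+ M ℤ.* -1ℤ))
        (cong (ℤ._*_ (+ M)) (≡.trans (ℤ.*-comm (+ M) -1ℤ) (ℤ.-1*i≡-i (+ M))))))))
    where
    distinct : ∀ i i′ → ¬ γ ^ (i ℕ.* N) + γ ^ (d ℕ.+ i′ ℕ.* N) ≈ 0#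
    distinct i i′ eq = ℕ.<⇒≢ 0<d (≡.trans (≡.sym (DM.m*n%n≡0 i N)) (≡.trans
        (γ^-mod-N (i ℕ.* N) (d ℕ.+ i′ ℕ.* N) (x+y≈0⇒x≈y eq)) (≡.trans (DM.[m+kn]%n≡m%n d i′ N) (DM.m<n⇒m%n≡m d<N))))

  -- Now the diagonal terms i = i′ vanish inside ψ: each row has one inner sum n and M - 1 inner
  -- sums -1.
  B-zero : B 0 ≡ + suc n ℤ.- + M
  B-zero = ℤ.*-cancelˡ-≡ (+ M) _ _ {{ℕ.>-nonZero 0<M}} (≡.trans (M*B 0) (≡.trans
    (Z.Σ-cong M row) (Σ-const M (+ suc n ℤ.- + M))))
    where
    off : ∀ i i′ → i < M → i′ < M → ¬ i′ ≡ i → ¬ γ ^ (i ℕ.* N) + γ ^ (i′ ℕ.* N) ≈ 0#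
    off i i′ i<M i′<M i′≢i eq = i′≢i (≡.sym (ℕ.*-cancelʳ-≡ i i′ N (γ^-injective (i ℕ.* N) (i′ ℕ.* N) (bound i i<M)
        (bound i′ i′<M) (x+y≈0⇒x≈y eq))))
      where
      bound : ∀ i → i < M → i ℕ.* N < n
      bound i i<M = subst (i ℕ.* N <_) (≡.sym n≡M*N) (ℕ.*-monoˡ-< N i<M)
    inner : ℕ → ℕ → ℤ
    inner i i′ = Z.Σ< n (λ e → ψ (γ ^ e * (γ ^ (i ℕ.* N) + γ ^ (i′ ℕ.* N))))
    row : ∀ i → i < M → Z.Σ< M (inner i) ≡ + suc n ℤ.- + M
    row i i<M = begin
      Z.Σ< M (inner i) ≡⟨ Z.Σ-cong′ M (λ i′ → expand (inner i i′)) ⟩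
      Z.Σ< M (λ i′ → (inner i i′ ℤ.+ 1ℤ) ℤ.+ -1ℤ) ≡⟨ Z.Σ-+ M _ _ ⟩
      Z.Σ< M (λ i′ → inner i i′ ℤ.+ 1ℤ) ℤ.+ Z.Σ< M (λ _ → -1ℤ) ≡⟨ cong₂ ℤ._+_
          (Z.Σ-only M i _ i<M (λ i′ i′<M i′≢i → cong (ℤ._+ 1ℤ) (Σψ*≡-1 _ (off i i′ i<M i′<M i′≢i)))) (Σ-const M -1ℤ) ⟩
      inner i i ℤ.+ 1ℤ ℤ.+ + M ℤ.* -1ℤ ≡⟨ cong (λ t → t ℤ.+ 1ℤ ℤ.+ + M ℤ.* -1ℤ) (Σψ*-zero _ (x+x≈0 (γ ^ (i ℕ.* N)))) ⟩
      + n ℤ.+ 1ℤ ℤ.+ + M ℤ.* -1ℤ ≡⟨ collect (+ n) (+ M) ⟩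
      + suc n ℤ.- + M ∎
      where
      open ≡.≡-Reasoning
      expand : ∀ x → x ≡ (x ℤ.+ 1ℤ) ℤ.+ -1ℤ
      expand = solve-∀
      collect : ∀ n M → n ℤ.+ 1ℤ ℤ.+ M ℤ.* -1ℤ ≡ 1ℤ ℤ.+ n ℤ.- M
      collect = solve-∀

  u : ℕ → ℤ
  u t = η (t ℕ.* L)

  private
    U : ℤ
    U = Z.Σ< p u

    ρ : ℕ → ℤ
    ρ j = Z.Σ< p (λ s → η (j ℕ.+ s ℕ.* L))

    -- Chosen to vanish off the multiples of L, by periodicity of η.
    excess : ℕ → ℤ
    excess j = + p ℤ.* (η j ℤ.* η (j ℕ.+ 0)) ℤ.- η j ℤ.* ρ j

    excess-generic : ∀ j → ¬ L ℕD.∣ j → excess j ≡ 0ℤ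
    excess-generic j L∤j = ≡.trans (cong₂ (λ a b → + p ℤ.* (η j ℤ.* a) ℤ.- η j ℤ.* b) (cong η (ℕ.+-identityʳ j))
      (≡.trans (Z.Σ-cong′ p (λ s → η-translate* s j L∤j)) (Σ-const p (η j)))) (cancel (+ p) (η j))
      where
      cancel : ∀ p e → p ℤ.* (e ℤ.* e) ℤ.- e ℤ.* (p ℤ.* e) ≡ 0ℤ
      cancel = solve-∀

    ρ-multiple : ∀ t → ρ (t ℕ.* L) ≡ U
    ρ-multiple t = ≡.trans (Z.Σ-cong′ p (λ s → cong η (≡.sym (ℕ.*-distribʳ-+ L t s)))) (Z.Σ-periodic p u u-periodic t)
      where
      u-periodic : ∀ t → u (t ℕ.+ p) ≡ u t
      u-periodic t = ≡.trans (cong η (ℕ.*-distribʳ-+ L t p)) (η-periodic (t ℕ.* L))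

    Σexcess : Z.Σ< N excess ≡ + p ℤ.* Z.Σ< p (λ t → u t ℤ.* u t) ℤ.- U ℤ.* U
    Σexcess = begin
      Z.Σ< N excess ≡⟨ Z.Σ-block p L excess ⟩
      Z.Σ< p (λ t → Z.Σ< L (λ i → excess (t ℕ.* L ℕ.+ i))) ≡⟨ Z.Σ-cong′ p
          (λ t → Z.Σ-only L 0 _ (ℕ.>-nonZero⁻¹ L) (λ i i<L i≢0 → excess-generic _ (not-multiple t i i<L i≢0))) ⟩
      Z.Σ< p (λ t → excess (t ℕ.* L ℕ.+ 0)) ≡⟨ Z.Σ-cong′ p (λ t → ≡.trans (cong excess (ℕ.+-identityʳ (t ℕ.* L)))
              (cong₂ (λ a b → + p ℤ.* (u t ℤ.* a) ℤ.- u t ℤ.* b) (cong η (ℕ.+-identityʳ (t ℕ.* L))) (ρ-multiple t))) ⟩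
      Z.Σ< p (λ t → + p ℤ.* (u t ℤ.* u t) ℤ.- u t ℤ.* U) ≡⟨ Z.Σ-minus p _ _ ⟩
      Z.Σ< p (λ t → + p ℤ.* (u t ℤ.* u t)) ℤ.- Z.Σ< p (λ t → u t ℤ.* U) ≡⟨ cong₂ ℤ._-_ (Z.Σ-*ˡ p (+ p) _) (Z.Σ-*ʳ p U u) ⟨
      + p ℤ.* Z.Σ< p (λ t → u t ℤ.* u t) ℤ.- U ℤ.* U ∎
      where
      open ≡.≡-Reasoning
      not-multiple : ∀ t i → i < L → ¬ i ≡ 0 → ¬ L ℕD.∣ t ℕ.* L ℕ.+ i
      not-multiple t i i<L i≢0 d = ℕD.>⇒∤ {{ℕ.≢-nonZero i≢0}} i<L (ℕD.∣m+n∣m⇒∣n d (ℕD.n∣m*n t))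

    Σexcess′ : Z.Σ< N excess ≡ + p ℤ.* B 0 ℤ.- Z.Σ< p (λ s → B (s ℕ.* L))
    Σexcess′ = begin
      Z.Σ< N excess ≡⟨ Z.Σ-minus N _ _ ⟩
      Z.Σ< N (λ j → + p ℤ.* (η j ℤ.* η (j ℕ.+ 0))) ℤ.- Z.Σ< N (λ j → η j ℤ.* ρ j) ≡⟨ cong₂ ℤ._-_
          (≡.sym (Z.Σ-*ˡ N (+ p) _)) (≡.trans (Z.Σ-cong′ N (λ j → Z.Σ-*ˡ p (η j) _)) (Z.Σ-swap N p _)) ⟩
      + p ℤ.* B 0 ℤ.- Z.Σ< p (λ s → B (s ℕ.* L)) ∎
      where open ≡.≡-Reasoning

    ΣB : Z.Σ< p (λ s → B (s ℕ.* L)) ≡ + suc n ℤ.- + p ℤ.* + M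
    ΣB = begin
      Z.Σ< p (λ s → B (s ℕ.* L)) ≡⟨ Z.Σ-cong′ p (λ s → expand (B (s ℕ.* L)) (+ M)) ⟩
      Z.Σ< p (λ s → (B (s ℕ.* L) ℤ.+ + M) ℤ.+ ℤ.- + M) ≡⟨ Z.Σ-+ p _ _ ⟩
      Z.Σ< p (λ s → B (s ℕ.* L) ℤ.+ + M) ℤ.+ Z.Σ< p (λ _ → ℤ.- + M) ≡⟨ cong₂ ℤ._+_
          (Z.Σ-only p 0 _ (ℕ.>-nonZero⁻¹ p) others) (Σ-const p (ℤ.- + M)) ⟩
      B 0 ℤ.+ + M ℤ.+ + p ℤ.* ℤ.- + M ≡⟨ cong (λ t → t ℤ.+ + M ℤ.+ + p ℤ.* ℤ.- + M) B-zero ⟩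
      + suc n ℤ.- + M ℤ.+ + M ℤ.+ + p ℤ.* ℤ.- + M ≡⟨ collect (+ suc n) (+ M) (+ p) ⟩
      + suc n ℤ.- + p ℤ.* + M ∎
      where
      open ≡.≡-Reasoning
      expand : ∀ b m → b ≡ (b ℤ.+ m) ℤ.+ ℤ.- m
      expand = solve-∀
      collect : ∀ q m p → q ℤ.- m ℤ.+ m ℤ.+ p ℤ.* ℤ.- m ≡ q ℤ.- p ℤ.* m
      collect = solve-∀
      others : ∀ s → s < p → ¬ s ≡ 0 → B (s ℕ.* L) ℤ.+ + M ≡ 0ℤ
      others s s<p s≢0 = ≡.trans (cong (ℤ._+ + M) (B-nonzero (s ℕ.* L) (ℕ.*-mono-≤ (ℕ.n≢0⇒n>0 s≢0) (ℕ.>-nonZero⁻¹ L))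
          (ℕ.*-monoˡ-< L s<p))) (ℤ.+-inverseˡ (+ M))

  -- The sum of `excess` is evaluated twice: its support on the multiples of L gives the left side,
  -- and the correlations `B` give the right.
  u-variance : + p ℤ.* Z.Σ< p (λ t → u t ℤ.* u t) ℤ.- Z.Σ< p u ℤ.* Z.Σ< p u ≡ (+ p ℤ.- 1ℤ) ℤ.* + suc n
  u-variance = ≡.trans (≡.sym Σexcess) (≡.trans Σexcess′ (≡.trans (cong₂ (λ a b → + p ℤ.* a ℤ.- b) B-zero ΣB)
      (collect (+ p) (+ suc n) (+ M))))
    where
    collect : ∀ p q m → p ℤ.* (q ℤ.- m) ℤ.- (q ℤ.- p ℤ.* m) ≡ (p ℤ.- 1ℤ) ℤ.* q
    collect = solve-∀

  window : ℕ → ℤ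
  window a = Z.Σ< L (λ i → η (a ℕ.+ i))

  private
    rest : ℤ
    rest = Z.Σ< (ℕ.pred L) (λ i → η (suc i))

    L≡1+L′ : L ≡ suc (ℕ.pred L)
    L≡1+L′ = ≡.sym (ℕ.suc-pred L)

    window-multiple : ∀ t → window (t ℕ.* L) ≡ u t ℤ.+ rest
    window-multiple t = ≡.trans (cong (λ l → Z.Σ< l (λ i → η (t ℕ.* L ℕ.+ i))) L≡1+L′) (≡.trans (Z.Σ-cons (ℕ.pred L) _)
      (cong₂ ℤ._+_ (cong η (ℕ.+-identityʳ (t ℕ.* L))) (Z.Σ-cong (ℕ.pred L) (λ i i<L′ →
        ≡.trans (cong η (ℕ.+-comm (t ℕ.* L) (suc i))) (η-translate* t (suc i)
          (ℕD.>⇒∤ (ℕ.<-≤-trans (s≤s i<L′) (ℕ.≤-reflexive (≡.sym L≡1+L′)))))))))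

    -- Sliding the window by one loses η a and gains η (a + L), which agree off the multiples of L.
    window-step : ∀ a → ¬ L ℕD.∣ a → window (suc a) ≡ window a
    window-step a L∤a = ℤ+.∙-cancelˡ (η (a ℕ.+ 0)) _ _ (≡.trans (cong (ℤ._+_ (η (a ℕ.+ 0)))
        (Z.Σ-cong′ L (λ i → cong η (≡.sym (ℕ.+-suc a i)))))
      (≡.trans (≡.sym (Z.Σ-cons L (λ i → η (a ℕ.+ i)))) (≡.trans (Z.Σ-snoc L (λ i → η (a ℕ.+ i)))
        (≡.trans (cong (ℤ._+_ (window a)) (≡.trans (η-translate a L∤a) (cong η (≡.sym (ℕ.+-identityʳ a)))))
          (ℤ.+-comm (window a) (η (a ℕ.+ 0)))))))

    window-up : ∀ t i → suc i ≤ L → window (suc i ℕ.+ t ℕ.* L) ≡ window (suc (t ℕ.* L))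
    window-up t zero    _   = ≡.refl
    window-up t (suc i) i<L = ≡.trans (window-step (suc i ℕ.+ t ℕ.* L) (λ d → ℕD.>⇒∤ i<L
      (ℕD.∣m+n∣m⇒∣n (subst (L ℕD.∣_) (ℕ.+-comm (suc i) (t ℕ.* L)) d) (ℕD.n∣m*n t)))) (window-up t i (ℕ.<⇒≤ i<L))

    -- A window that starts strictly between t L and (t + 1) L slides up to (t + 1) L without
    -- changing its value.
    window-at : ∀ t i → i < L → ∃[ t′ ] window (i ℕ.+ t ℕ.* L) ≡ u t′ ℤ.+ rest
    window-at t zero    _   = t , window-multiple t
    window-at t (suc i) i<L = suc t , ≡.trans (window-up t i (ℕ.<⇒≤ i<L)) (≡.trans (≡.sym (≡.trans
      (cong (λ l → window (l ℕ.+ t ℕ.* L)) L≡1+L′) (window-up t (ℕ.pred L) (ℕ.≤-reflexive (≡.sym L≡1+L′))))) (window-multiple (suc t)))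

  -- A window of L consecutive exponents meets every residue class modulo L once; the classes other
  -- than 0 contribute a fixed amount.
  window-values : ∃[ s ] (∀ a → ∃[ t ] window a ≡ u t ℤ.+ s)
  window-values = rest , λ a → proj₁ (window-at (a / L) (a % L) (DM.m%n<n a L)) ,
    ≡.trans (cong window (DM.m≡m%n+[m/n]*n a L)) (proj₂ (window-at (a / L) (a % L) (DM.m%n<n a L)))

-- Integer sequences of prescribed variance

-- No integer lies strictly between 0 and 1.
0≤x²-x : ∀ x → 0ℤ ℤ.≤ x ℤ.* x ℤ.- x
0≤x²-x (+ zero)  = ℤ.≤-refl
0≤x²-x (+ suc n) = subst (0ℤ ℤ.≤_) (≡.trans (ℤ.pos-* (suc n) n) (expand (+ n))) (ℤ.+≤+ z≤n)
  where
  expand : ∀ n → (1ℤ ℤ.+ n) ℤ.* n ≡ (1ℤ ℤ.+ n) ℤ.* (1ℤ ℤ.+ n) ℤ.- (1ℤ ℤ.+ n)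
  expand = solve-∀
0≤x²-x -[1+ n ]  = ℤ.+≤+ z≤n

Σ-nonneg-zero : ∀ n (g : ℕ → ℤ) → (∀ t → 0ℤ ℤ.≤ g t) → Z.Σ< n g ≡ 0ℤ → ∀ t → t < n → g t ≡ 0ℤ
Σ-nonneg-zero (suc n) g g≥0 Σ≡0 = at
  where
  Σ≡0′ : g 0 ℤ.+ Z.Σ< n (g ∘ suc) ≡ 0ℤ
  Σ≡0′ = ≡.trans (≡.sym (Z.Σ-cons n g)) Σ≡0
  tail≥0 : 0ℤ ℤ.≤ Z.Σ< n (g ∘ suc)
  tail≥0 = subst (ℤ._≤ Z.Σ< n (g ∘ suc)) (Z.Σ-0 n) (Σ-mono n (λ k _ → g≥0 (suc k)))
  g0≡0 : g 0 ≡ 0ℤ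
  g0≡0 = ℤ.≤-antisym (ℤ.≤-trans (subst (ℤ._≤ g 0 ℤ.+ Z.Σ< n (g ∘ suc)) (ℤ.+-identityʳ (g 0))
      (ℤ.+-monoʳ-≤ (g 0) tail≥0)) (ℤ.≤-reflexive Σ≡0′)) (g≥0 0)
  tail≡0 : Z.Σ< n (g ∘ suc) ≡ 0ℤ
  tail≡0 = ≡.trans (≡.sym (ℤ.+-identityˡ _)) (≡.trans (cong (ℤ._+ Z.Σ< n (g ∘ suc)) (≡.sym g0≡0)) Σ≡0′)
  at : ∀ t → t < suc n → g t ≡ 0ℤ
  at zero    _         = g0≡0
  at (suc t) (s≤s t<n) = Σ-nonneg-zero n (g ∘ suc) (g≥0 ∘ suc) tail≡0 t t<n

Σ-affine : ∀ n a b v → Z.Σ< n (λ t → a ℤ.+ b ℤ.* v t) ≡ + n ℤ.* a ℤ.+ b ℤ.* Z.Σ< n v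
Σ-affine n a b v = ≡.trans (Z.Σ-+ n (λ _ → a) (λ t → b ℤ.* v t)) (cong₂ ℤ._+_ (Σ-const n a) (≡.sym (Z.Σ-*ˡ n b v)))

-- n² times the variance of v 0, …, v (n-1).
variance : ℕ → (ℕ → ℤ) → ℤ
variance n v = + n ℤ.* Z.Σ< n (λ t → v t ℤ.* v t) ℤ.- Z.Σ< n v ℤ.* Z.Σ< n v

variance-affine : ∀ n a b v → variance n (λ t → a ℤ.+ b ℤ.* v t) ≡ b ℤ.* b ℤ.* variance n v
variance-affine n a b v = ≡.trans (cong₂ (λ s t → + n ℤ.* s ℤ.- t ℤ.* t) squares (Σ-affine n a b v))
  (collect (+ n) a b (Z.Σ< n v) (Z.Σ< n (λ t → v t ℤ.* v t)))
  where
  collect : ∀ n a b s s₂ → n ℤ.* (n ℤ.* (a ℤ.* a) ℤ.+ (+ 2 ℤ.* a ℤ.* b ℤ.* s ℤ.+ b ℤ.* b ℤ.* s₂)) ℤ.-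
      (n ℤ.* a ℤ.+ b ℤ.* s) ℤ.* (n ℤ.* a ℤ.+ b ℤ.* s)
            ≡ b ℤ.* b ℤ.* (n ℤ.* s₂ ℤ.- s ℤ.* s)
  collect = solve-∀
  square : ∀ a b v → (a ℤ.+ b ℤ.* v) ℤ.* (a ℤ.+ b ℤ.* v) ≡ a ℤ.* a ℤ.+ (+ 2 ℤ.* a ℤ.* b ℤ.* v ℤ.+ b ℤ.* b ℤ.* (v ℤ.* v))
  square = solve-∀
  squares : Z.Σ< n (λ t → (a ℤ.+ b ℤ.* v t) ℤ.* (a ℤ.+ b ℤ.* v t)) ≡
            + n ℤ.* (a ℤ.* a) ℤ.+ (+ 2 ℤ.* a ℤ.* b ℤ.* Z.Σ< n v ℤ.+ b ℤ.* b ℤ.* Z.Σ< n (λ t → v t ℤ.* v t))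
  squares = ≡.trans (Z.Σ-cong′ n (λ t → square a b (v t))) (≡.trans (Z.Σ-+ n (λ _ → a ℤ.* a) _) (cong₂ ℤ._+_ (Σ-const n (a ℤ.* a))
    (≡.trans (Z.Σ-+ n (λ t → + 2 ℤ.* a ℤ.* b ℤ.* v t) (λ t → b ℤ.* b ℤ.* (v t ℤ.* v t)))
      (cong₂ ℤ._+_ (≡.sym (Z.Σ-*ˡ n (+ 2 ℤ.* a ℤ.* b) v)) (≡.sym (Z.Σ-*ˡ n (b ℤ.* b) (λ t → v t ℤ.* v t)))))))

module _ (p h : ℕ) (pr : Prime p) (p≡1+2h : p ≡ 1 ℕ.+ 2 ℕ.* h) where
  private
    instance
      p≢0 : NonZero p
      p≢0 = prime⇒nonZero pr

    +p≡1+2h : + p ≡ 1ℤ ℤ.+ + 2 ℤ.* + h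
    +p≡1+2h = ≡.trans (cong +_ p≡1+2h) (cong (ℤ._+_ 1ℤ) (ℤ.pos-* 2 h))

    -- If Σ v ≡ h modulo p, a translate w of v has Σ w = h, whence Σ w² = h = Σ w and w takes values in {0,1}.
    unit-gap : ∀ v c → variance p v ≡ + h ℤ.* (+ h ℤ.+ 1ℤ) → + 2 ℤ.* Z.Σ< p v ℤ.+ 1ℤ ≡ c ℤ.* + p →
               ∃[ a ] (∀ t → t < p → (v t ℤ.- a) ℤ.* (v t ℤ.- (a ℤ.+ 1ℤ)) ≡ 0ℤ)
    unit-gap v c var eq = a , λ t t<p → ≡.trans (quadratic (v t) a) (Σ-nonneg-zero p (λ t → w t ℤ.* w t ℤ.- w t)
        (λ t → 0≤x²-x (w t)) Σ[w²-w] t t<p)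
      where
      k a : ℤ
      k = Z.Σ< p v
      -- From 2k + 1 = c p and p = 2h + 1 follows p (k - h c) = k - h, so subtracting a from every
      -- term brings the sum to h.
      a = k ℤ.- + h ℤ.* c
      w : ℕ → ℤ
      w t = ℤ.- a ℤ.+ 1ℤ ℤ.* v t
      quadratic : ∀ v a → (v ℤ.- a) ℤ.* (v ℤ.- (a ℤ.+ 1ℤ)) ≡ (ℤ.- a ℤ.+ 1ℤ ℤ.* v) ℤ.* (ℤ.- a ℤ.+ 1ℤ ℤ.* v) ℤ.- (ℤ.- a ℤ.+ 1ℤ ℤ.* v)
      quadratic = solve-∀
      Σw : Z.Σ< p w ≡ + h
      Σw = ≡.trans (Σ-affine p (ℤ.- a) 1ℤ v) (ℤ.*-cancelˡ-≡ (+ 2) _ _ (begin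
        + 2 ℤ.* (+ p ℤ.* ℤ.- (k ℤ.- + h ℤ.* c) ℤ.+ 1ℤ ℤ.* k) ≡⟨ l₁ (+ p) k (+ h) c ⟩
        + 2 ℤ.* (+ h ℤ.* (c ℤ.* + p)) ℤ.- + 2 ℤ.* k ℤ.* (+ p ℤ.- 1ℤ) ≡⟨ cong₂
          (λ x y → + 2 ℤ.* (+ h ℤ.* x) ℤ.- + 2 ℤ.* k ℤ.* (y ℤ.- 1ℤ)) (≡.sym eq) +p≡1+2h ⟩
        + 2 ℤ.* (+ h ℤ.* (+ 2 ℤ.* k ℤ.+ 1ℤ)) ℤ.- + 2 ℤ.* k ℤ.* (1ℤ ℤ.+ + 2 ℤ.* + h ℤ.- 1ℤ) ≡⟨ l₂ k (+ h) ⟩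
        + 2 ℤ.* + h ∎))
        where
        open ≡.≡-Reasoning
        l₁ : ∀ p k h c → + 2 ℤ.* (p ℤ.* ℤ.- (k ℤ.- h ℤ.* c) ℤ.+ 1ℤ ℤ.* k) ≡ + 2 ℤ.* (h ℤ.* (c ℤ.* p)) ℤ.- + 2 ℤ.* k ℤ.* (p ℤ.- 1ℤ)
        l₁ = solve-∀
        l₂ : ∀ k h → + 2 ℤ.* (h ℤ.* (+ 2 ℤ.* k ℤ.+ 1ℤ)) ℤ.- + 2 ℤ.* k ℤ.* (1ℤ ℤ.+ + 2 ℤ.* h ℤ.- 1ℤ) ≡ + 2 ℤ.* h
        l₂ = solve-∀
      Σw² : Z.Σ< p (λ t → w t ℤ.* w t) ≡ + h
      Σw² = ℤ.*-cancelˡ-≡ (+ p) _ _ (begin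
        + p ℤ.* S₂ ≡⟨ l₁ (+ p ℤ.* S₂) (Z.Σ< p w) ⟩
        variance p w ℤ.+ Z.Σ< p w ℤ.* Z.Σ< p w ≡⟨ cong₂ (λ x y → x ℤ.+ y ℤ.* y)
          (≡.trans (variance-affine p (ℤ.- a) 1ℤ v) (≡.trans (ℤ.*-identityˡ (variance p v)) var)) Σw ⟩
        + h ℤ.* (+ h ℤ.+ 1ℤ) ℤ.+ + h ℤ.* + h ≡⟨ l₂ (+ h) ⟩
        (1ℤ ℤ.+ + 2 ℤ.* + h) ℤ.* + h ≡⟨ cong (ℤ._* + h) +p≡1+2h ⟨
        + p ℤ.* + h ∎)
        where
        open ≡.≡-Reasoning
        S₂ = Z.Σ< p (λ t → w t ℤ.* w t)
        l₁ : ∀ x y → x ≡ x ℤ.- y ℤ.* y ℤ.+ y ℤ.* y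
        l₁ = solve-∀
        l₂ : ∀ h → h ℤ.* (h ℤ.+ 1ℤ) ℤ.+ h ℤ.* h ≡ (1ℤ ℤ.+ + 2 ℤ.* h) ℤ.* h
        l₂ = solve-∀
      Σ[w²-w] : Z.Σ< p (λ t → w t ℤ.* w t ℤ.- w t) ≡ 0ℤ
      Σ[w²-w] = ≡.trans (Z.Σ-minus p (λ t → w t ℤ.* w t) w) (≡.trans (cong₂ ℤ._-_ Σw² Σw) (ℤ.+-inverseʳ (+ h)))

  -- As 4 h (h + 1) + 1 = p², the hypothesis gives (2k + 1)(2k - 1) = 4 p S₂ - p², so p divides one
  -- factor; negating v exchanges the two cases.
  two-values : ∀ v → variance p v ≡ + h ℤ.* (+ h ℤ.+ 1ℤ) → ∃[ a ] ∃[ b ] (∀ t → t < p → (v t ℤ.- a) ℤ.* (v t ℤ.- b) ≡ 0ℤ)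
  two-values v var = [ plus , minus ]′ (euclidsLemma ℤ.∣ + 2 ℤ.* k ℤ.+ 1ℤ ∣ ℤ.∣ + 2 ℤ.* k ℤ.- 1ℤ ∣ pr
      (subst (p ℕD.∣_) (ℤ.abs-* (+ 2 ℤ.* k ℤ.+ 1ℤ) (+ 2 ℤ.* k ℤ.- 1ℤ)) (∣⇒∣ᵤ (ℤD.divides (+ 4 ℤ.* S₂ ℤ.- + p) factors))))
    where
    k S₂ : ℤ
    k  = Z.Σ< p v
    S₂ = Z.Σ< p (λ t → v t ℤ.* v t)
    factors : (+ 2 ℤ.* k ℤ.+ 1ℤ) ℤ.* (+ 2 ℤ.* k ℤ.- 1ℤ) ≡ (+ 4 ℤ.* S₂ ℤ.- + p) ℤ.* + p
    factors = ≡.trans (l₁ k (+ p ℤ.* S₂)) (≡.trans (cong (λ x → + 4 ℤ.* (+ p ℤ.* S₂) ℤ.- + 4 ℤ.* x ℤ.- 1ℤ) var)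
      (≡.trans (l₂ (+ p ℤ.* S₂) (+ h)) (≡.trans (cong (λ x → + 4 ℤ.* (+ p ℤ.* S₂) ℤ.- x ℤ.* x) (≡.sym +p≡1+2h)) (l₃ (+ p) S₂))))
      where
      l₁ : ∀ k x → (+ 2 ℤ.* k ℤ.+ 1ℤ) ℤ.* (+ 2 ℤ.* k ℤ.- 1ℤ) ≡ + 4 ℤ.* x ℤ.- + 4 ℤ.* (x ℤ.- k ℤ.* k) ℤ.- 1ℤ
      l₁ = solve-∀
      l₂ : ∀ x h → + 4 ℤ.* x ℤ.- + 4 ℤ.* (h ℤ.* (h ℤ.+ 1ℤ)) ℤ.- 1ℤ ≡ + 4 ℤ.* x ℤ.- (1ℤ ℤ.+ + 2 ℤ.* h) ℤ.* (1ℤ ℤ.+ + 2 ℤ.* h)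
      l₂ = solve-∀
      l₃ : ∀ p s → + 4 ℤ.* (p ℤ.* s) ℤ.- p ℤ.* p ≡ (+ 4 ℤ.* s ℤ.- p) ℤ.* p
      l₃ = solve-∀
    plus : p ℕD.∣ ℤ.∣ + 2 ℤ.* k ℤ.+ 1ℤ ∣ → ∃[ a ] ∃[ b ] (∀ t → t < p → (v t ℤ.- a) ℤ.* (v t ℤ.- b) ≡ 0ℤ)
    plus d = proj₁ gap , proj₁ gap ℤ.+ 1ℤ , proj₂ gap
      where
      p∣ : + p ℤD.∣ + 2 ℤ.* k ℤ.+ 1ℤ
      p∣ = ∣ᵤ⇒∣ d
      gap = unit-gap v (ℤD._∣_.quotient p∣) var (ℤD._∣_.equality p∣)
    minus : p ℕD.∣ ℤ.∣ + 2 ℤ.* k ℤ.- 1ℤ ∣ → ∃[ a ] ∃[ b ] (∀ t → t < p → (v t ℤ.- a) ℤ.* (v t ℤ.- b) ≡ 0ℤ)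
    minus d = ℤ.- proj₁ gap , ℤ.- (proj₁ gap ℤ.+ 1ℤ) , λ t t<p → ≡.trans (l₂ (v t) (proj₁ gap)) (proj₂ gap t t<p)
      where
      p∣ : + p ℤD.∣ + 2 ℤ.* k ℤ.- 1ℤ
      p∣ = ∣ᵤ⇒∣ d
      -v : ℕ → ℤ
      -v t = 0ℤ ℤ.+ -1ℤ ℤ.* v t
      l₁ : ∀ p k → + 2 ℤ.* (p ℤ.* 0ℤ ℤ.+ -1ℤ ℤ.* k) ℤ.+ 1ℤ ≡ ℤ.- (+ 2 ℤ.* k ℤ.- 1ℤ)
      l₁ = solve-∀
      l₂ : ∀ v a → (v ℤ.- ℤ.- a) ℤ.* (v ℤ.- ℤ.- (a ℤ.+ 1ℤ)) ≡ (0ℤ ℤ.+ -1ℤ ℤ.* v ℤ.- a) ℤ.* (0ℤ ℤ.+ -1ℤ ℤ.* v ℤ.- (a ℤ.+ 1ℤ))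
      l₂ = solve-∀
      gap = unit-gap -v (ℤ.- ℤD._∣_.quotient p∣) (≡.trans (variance-affine p 0ℤ -1ℤ v) (≡.trans (ℤ.*-identityˡ (variance p v)) var))
        (≡.trans (cong (λ x → + 2 ℤ.* x ℤ.+ 1ℤ) (Σ-affine p 0ℤ -1ℤ v))
          (≡.trans (l₁ (+ p) k) (≡.trans (cong ℤ.-_ (ℤD._∣_.equality p∣)) (ℤ.neg-distribˡ-* (ℤD._∣_.quotient p∣) (+ p)))))

-- The Gauss periods of index N at multiples of L

module PeriodValues {c ℓ : Level} {q : ℕ} (F : FiniteField c ℓ q)
  (γ : FiniteField.Carrier F) (prim : IsPrimitive F γ)
  (p r h : ℕ) (pr : Prime p) (1+p≡2^r : 1 ℕ.+ p ≡ 2 ℕ.^ r) (p≡1+2h : p ≡ 1 ℕ.+ 2 ℕ.* h) (k : ℕ)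
  (q≡2^f : q ≡ 2 ℕ.^ (p ℕ.^ k ℕ.* r)) where
  open FiniteField F
  open MersennePrime p r h pr 1+p≡2^r p≡1+2h
  open GaussPeriods F γ prim p r h pr 1+p≡2^r p≡1+2h k q≡2^f public

  private
    g θ : ℕ
    g = proj₁ (odd-power k)
    θ = 1 ℕ.+ r ℕ.* g

  -- The precision is θ, so that divisibility by 2^θ becomes equality to 0.
  open Thickening F γ prim (p ℕ.^ k ℕ.* r) q≡2^f θ
  open import Algebra.Properties.Semiring.Exp semiring using (^-congˡ; ^-homo-*; ^-assocʳ)
  private
    module ZF = SumF ℤ-ring
    module RE where
      open import Algebra.Properties.Semiring.Exp R.semiring public
      open import Algebra.Properties.CommutativeSemigroup R.*-commutativeSemigroup public
    module ≋-Reasoning where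
      open import Relation.Binary.Reasoning.Setoid R.setoid public

    2≤n : 1 < n
    2≤n = ℕ.≤-trans 1<p (ℕ.≤-trans (ℕ.m≤m*n p L) (ℕD.∣⇒≤ N∣n))

    -- `G≋0` speaks of exponents n - M j′. Here j′ = N - j, which is again prime to p because p
    -- divides N.
    G[Mj]≋0 : ∀ j → j < N → ¬ p ℕD.∣ j → G (M ℕ.* j) ≋ con 0ℤ
    G[Mj]≋0 j j<N p∤j = subst (λ e → G e ≋ con 0ℤ) complement
      (G≋0 N M (N ∸ j) n≡M*N (ℕ.m<n⇒0<n∸m j<N) (ℕ.∸-monoʳ-< {N} {o = 0} 0<j (ℕ.<⇒≤ j<N)) 2≤n
        (residue-bound k g (proj₂ (odd-power k)) (N ∸ j) p∤N∸j))
      where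
      0<j : 0 < j
      0<j = ℕ.n≢0⇒n>0 (λ j≡0 → p∤j (subst (p ℕD.∣_) (≡.sym j≡0) (p ℕD.∣0)))
      complement : n ∸ M ℕ.* (N ∸ j) ≡ M ℕ.* j
      complement = ≡.trans (cong (_∸ M ℕ.* (N ∸ j)) n≡M*N) (≡.trans (≡.sym (ℕ.*-distribˡ-∸ M N (N ∸ j)))
          (cong (M ℕ.*_) (ℕ.m∸[m∸n]≡n (ℕ.<⇒≤ j<N))))
      p∤N∸j : ¬ p ℕD.∣ N ∸ j
      p∤N∸j d = p∤j (ℕD.∣m+n∣m⇒∣n (subst (p ℕD.∣_) (≡.sym (ℕ.m∸n+n≡m (ℕ.<⇒≤ j<N))) (ℕD.m∣m*n L)) d)

    G-powers : ∀ e → G e ≋ RF.Σ< n (λ i → con (ψ (γ ^ i)) ⊗ (z ⇑ (e ℕ.* i)))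
    G-powers e = R.trans (RF.Σ-cons n (λ i → con (ψ (elt i)) ⊗ W e (elt i))) (R.trans (R.+-cong
      (R.trans (R.*-congˡ {con (ψ 0#)} (W-0 e)) (R.zeroʳ (con (ψ 0#))))
          (RF.Σ-cong′ n (λ i → R.*-congˡ {con (ψ (γ ^ i))} (W-γ e i)))) (R.+-identityˡ _))

    con-Σ : ∀ m (a : ℕ → ℤ) → RF.Σ< m (λ i → con (a i)) ≋ con (Z.Σ< m a)
    con-Σ zero    a = R.trans (RF.Σ-empty _) (R.reflexive (cong con (≡.sym (Z.Σ-empty a))))
    con-Σ (suc m) a = R.trans (RF.Σ-cons m _) (R.trans (R.+-congˡ {con (a 0)} (con-Σ m (a ∘ suc)))
      (R.trans (R.sym (con-+ (a 0) (Z.Σ< m (a ∘ suc)))) (R.reflexive (cong con (≡.sym (Z.Σ-cons m a))))))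

    z-trivial : ∀ t → z ⇑ (t ℕ.* n) ≋ con 1ℤ
    z-trivial t = z-periodic 0 t

    -- z^M is a lifted root of unity of order N, so this sum detects whether N divides e.
    Φ : ℕ → Polynomial
    Φ e = RF.Σ< N ((z ⇑ (M ℕ.* e)) ⇑_)

    Φ-multiple : ∀ e → N ℕD.∣ e → Φ e ≋ con (+ N)
    Φ-multiple e (ℕD.divides t e≡tN) = R.trans (RF.Σ-cong′ N (λ j → R.trans (RE.^-congˡ j base) (1⇑k≋1 j)))
      (R.trans (con-Σ N (λ _ → 1ℤ)) (R.reflexive (cong con (≡.trans (Σ-const N 1ℤ) (ℤ.*-identityʳ (+ N))))))
      where
      base : z ⇑ (M ℕ.* e) ≋ con 1ℤ
      base = R.trans (RE.^-congʳ z (≡.trans (cong (M ℕ.*_) e≡tN) (≡.trans (x∙yz≈y∙xz M t N) (cong (t ℕ.*_) (≡.sym n≡M*N))))) (z-trivial t)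
        where open import Algebra.Properties.CommutativeSemigroup ℕ.*-commutativeSemigroup using (x∙yz≈y∙xz)

    Φ-other : ∀ e → ¬ N ℕD.∣ e → Φ e ≋ con 0ℤ
    Φ-other e N∤e = geometric-0 N (z ⇑ (M ℕ.* e)) nontrivial
      (R.trans (RE.^-assocʳ z (M ℕ.* e) N) (R.trans (RE.^-congʳ z (≡.trans (xy∙z≈y∙xz M e N) (cong (e ℕ.*_) (≡.sym n≡M*N)))) (z-trivial e)))
      where
      open import Algebra.Properties.CommutativeSemigroup ℕ.*-commutativeSemigroup using (xy∙z≈y∙xz)
      nontrivial : ¬ eval (z ⇑ (M ℕ.* e)) ≈ 1#
      nontrivial eq = N∤e (ℕD.*-cancelˡ-∣ M {{ℕ.>-nonZero 0<M}} (subst (ℕD._∣ M ℕ.* e) n≡M*N (ℕD.m%n≡0⇒n∣m (M ℕ.* e) n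
        (γ^≈⇒%≡ (M ℕ.* e) 0 (trans (^-congˡ (M ℕ.* e) (sym eval-z)) (trans (sym (eval-⇑ z (M ℕ.* e))) eq))))))

    -- The inverse Fourier transform of the Gauss sums of exponents M j; only those with p ∣ j are nonzero.
    T : ℕ → Polynomial
    T c = RF.Σ< N (λ j → (z ⇑ (M ℕ.* j ℕ.* c)) ⊗ G (M ℕ.* j))

    -- Expanding the Gauss sums and summing over j first leaves only the exponents i ≡ -c modulo N.
    -- The range of c makes N - c the representative of that class below N.
    T-inversion : ∀ c → 0 < c → c ≤ N → T c ≋ con (η (N ∸ c) ℤ.* + N)
    T-inversion c 0<c c≤N = let open ≋-Reasoning in begin
      T c ≈⟨ RF.Σ-cong′ N (λ j → R.trans (R.*-congˡ {z ⇑ (M ℕ.* j ℕ.* c)} (G-powers (M ℕ.* j))) (RF.Σ-*ˡ n (z ⇑ (M ℕ.* j ℕ.* c)) _)) ⟩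
      RF.Σ< N (λ j → RF.Σ< n (λ i → (z ⇑ (M ℕ.* j ℕ.* c)) ⊗ (con (ψ (γ ^ i)) ⊗ (z ⇑ (M ℕ.* j ℕ.* i))))) ≈⟨ RF.Σ-cong′
          N (λ j → RF.Σ-cong′ n (λ i → merge j i)) ⟩
      RF.Σ< N (λ j → RF.Σ< n (λ i → con (ψ (γ ^ i)) ⊗ ((z ⇑ (M ℕ.* (i ℕ.+ c))) ⇑ j))) ≈⟨ RF.Σ-swap N n
          (λ j i → con (ψ (γ ^ i)) ⊗ ((z ⇑ (M ℕ.* (i ℕ.+ c))) ⇑ j)) ⟩
      RF.Σ< n (λ i → RF.Σ< N (λ j → con (ψ (γ ^ i)) ⊗ ((z ⇑ (M ℕ.* (i ℕ.+ c))) ⇑ j))) ≈⟨ RF.Σ-cong′ n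
          (λ i → R.sym (RF.Σ-*ˡ N (con (ψ (γ ^ i))) ((z ⇑ (M ℕ.* (i ℕ.+ c))) ⇑_))) ⟩
      RF.Σ< n term ≈⟨ R.reflexive (cong (λ m → RF.Σ< m term) n≡M*N) ⟩
      RF.Σ< (M ℕ.* N) term ≈⟨ RF.Σ-block M N term ⟩
      RF.Σ< M (λ i → RF.Σ< N (λ j → term (i ℕ.* N ℕ.+ j))) ≈⟨ RF.Σ-cong′ M
          (λ i → RF.Σ-only N (N ∸ c) (λ j → term (i ℕ.* N ℕ.+ j)) (ℕ.∸-monoʳ-< {N} {o = 0} 0<c c≤N) (others i)) ⟩
      RF.Σ< M (λ i → term (i ℕ.* N ℕ.+ (N ∸ c))) ≈⟨ RF.Σ-cong′ M main ⟩
      RF.Σ< M (λ i → con (ψ (γ ^ (N ∸ c ℕ.+ i ℕ.* N))) ⊗ con (+ N)) ≈⟨ RF.Σ-*ʳ M (con (+ N)) (λ i → con (ψ (γ ^ (N ∸ c ℕ.+ i ℕ.* N)))) ⟨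
      RF.Σ< M (λ i → con (ψ (γ ^ (N ∸ c ℕ.+ i ℕ.* N)))) ⊗ con (+ N) ≈⟨ R.*-congʳ {con (+ N)} (con-Σ M (λ i → ψ (γ ^ (N ∸ c ℕ.+ i ℕ.* N)))) ⟩
      con (η (N ∸ c)) ⊗ con (+ N) ≈⟨ con-* (η (N ∸ c)) (+ N) ⟨
      con (η (N ∸ c) ℤ.* + N) ∎
      where
      term : ℕ → Polynomial
      term i = con (ψ (γ ^ i)) ⊗ Φ (i ℕ.+ c)
      exponent : ∀ M j c i → M ℕ.* j ℕ.* c ℕ.+ M ℕ.* j ℕ.* i ≡ M ℕ.* (i ℕ.+ c) ℕ.* j
      exponent = solve-ℕ
      merge : ∀ j i → (z ⇑ (M ℕ.* j ℕ.* c)) ⊗ (con (ψ (γ ^ i)) ⊗ (z ⇑ (M ℕ.* j ℕ.* i))) ≋ con (ψ (γ ^ i)) ⊗ ((z ⇑ (M ℕ.* (i ℕ.+ c))) ⇑ j)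
      merge j i = R.trans (RE.x∙yz≈y∙xz (z ⇑ (M ℕ.* j ℕ.* c)) (con (ψ (γ ^ i))) (z ⇑ (M ℕ.* j ℕ.* i))) (R.*-congˡ {con (ψ (γ ^ i))}
        (R.trans (R.sym (RE.^-homo-* z (M ℕ.* j ℕ.* c) (M ℕ.* j ℕ.* i)))
          (R.trans (RE.^-congʳ z (exponent M j c i)) (R.sym (RE.^-assocʳ z (M ℕ.* (i ℕ.+ c)) j)))))
      regroup : ∀ i → i ℕ.* N ℕ.+ (N ∸ c) ℕ.+ c ≡ suc i ℕ.* N
      regroup i = ≡.trans (ℕ.+-assoc (i ℕ.* N) (N ∸ c) c) (≡.trans (cong (i ℕ.* N ℕ.+_) (ℕ.m∸n+n≡m c≤N)) (ℕ.+-comm (i ℕ.* N) N))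
      main : ∀ i → term (i ℕ.* N ℕ.+ (N ∸ c)) ≋ con (ψ (γ ^ (N ∸ c ℕ.+ i ℕ.* N))) ⊗ con (+ N)
      main i = R.*-cong (R.reflexive (cong (λ e → con (ψ (γ ^ e))) (ℕ.+-comm (i ℕ.* N) (N ∸ c))))
          (Φ-multiple _ (ℕD.divides (suc i) (regroup i)))
      others : ∀ i j → j < N → ¬ j ≡ N ∸ c → term (i ℕ.* N ℕ.+ j) ≋ con 0ℤ
      others i j j<N j≢ = R.trans (R.*-congˡ {con (ψ (γ ^ (i ℕ.* N ℕ.+ j)))}
          (Φ-other (i ℕ.* N ℕ.+ j ℕ.+ c) not-multiple)) (R.zeroʳ (con (ψ (γ ^ (i ℕ.* N ℕ.+ j)))))
        where
        not-multiple : ¬ N ℕD.∣ i ℕ.* N ℕ.+ j ℕ.+ c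
        not-multiple d = small (ℕD.∣m+n∣m⇒∣n (subst (N ℕD.∣_) (ℕ.+-assoc (i ℕ.* N) j c) d) (ℕD.n∣m*n i))
          where
          small : ¬ N ℕD.∣ j ℕ.+ c
          small (ℕD.divides zero eq) = ℕ.<⇒≢ (ℕ.≤-trans 0<c (ℕ.m≤n+m c j)) (≡.sym eq)
          small (ℕD.divides (suc zero) eq) = j≢ (≡.trans (≡.sym (ℕ.m+n∸n≡m j c)) (cong (_∸ c) (≡.trans eq (ℕ.*-identityˡ N))))
          small (ℕD.divides (suc (suc t)) eq) = ℕ.<⇒≱ (ℕ.+-mono-<-≤ j<N c≤N)
            (ℕ.≤-trans (ℕ.+-monoʳ-≤ N (ℕ.m≤m+n N (t ℕ.* N))) (ℕ.≤-reflexive (≡.sym eq)))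

    -- If p ∤ j the Gauss sum is 0; if p ∣ j the exponent M j t L is a multiple of M p L = n, so the
    -- power of z is 1. Either way t disappears.
    T-constant : ∀ t → T (t ℕ.* L) ≋ RF.Σ< N (λ j → G (M ℕ.* j))
    T-constant t = RF.Σ-cong N (λ j j<N → at j j<N (p ℕD.∣? j))
      where
      at : ∀ j → j < N → Dec (p ℕD.∣ j) → (z ⇑ (M ℕ.* j ℕ.* (t ℕ.* L))) ⊗ G (M ℕ.* j) ≋ G (M ℕ.* j)
      at j j<N (no p∤j) = R.trans (R.*-congˡ {z ⇑ (M ℕ.* j ℕ.* (t ℕ.* L))} (G[Mj]≋0 j j<N p∤j))
          (R.trans (R.zeroʳ (z ⇑ (M ℕ.* j ℕ.* (t ℕ.* L)))) (R.sym (G[Mj]≋0 j j<N p∤j)))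
      at j j<N (yes (ℕD.divides j₁ j≡)) = R.trans (R.*-congʳ {G (M ℕ.* j)}
          (R.trans (RE.^-congʳ z exponent) (z-trivial (j₁ ℕ.* t)))) (R.*-identityˡ (G (M ℕ.* j)))
        where
        shuffle : ∀ M j p t L → M ℕ.* (j ℕ.* p) ℕ.* (t ℕ.* L) ≡ j ℕ.* t ℕ.* (M ℕ.* (p ℕ.* L))
        shuffle = solve-ℕ
        exponent : M ℕ.* j ℕ.* (t ℕ.* L) ≡ j₁ ℕ.* t ℕ.* n
        exponent = ≡.trans (cong (λ j → M ℕ.* j ℕ.* (t ℕ.* L)) j≡) (≡.trans (shuffle M j₁ p t L) (cong (j₁ ℕ.* t ℕ.*_) (≡.sym n≡M*N)))

    η-congruence : ∀ t t′ → 0 < t → t ≤ p → 0 < t′ → t′ ≤ p → con (η (N ∸ t ℕ.* L) ℤ.* + N) ≋ con (η (N ∸ t′ ℕ.* L) ℤ.* + N)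
    η-congruence t t′ 0<t t≤p 0<t′ t′≤p = R.trans (R.sym (T-inversion (t ℕ.* L) (ℕ.*-mono-≤ 0<t (ℕ.>-nonZero⁻¹ L)) (ℕ.*-monoˡ-≤ L t≤p)))
      (R.trans (T-constant t) (R.trans (R.sym (T-constant t′)) (T-inversion (t′ ℕ.* L)
          (ℕ.*-mono-≤ 0<t′ (ℕ.>-nonZero⁻¹ L)) (ℕ.*-monoˡ-≤ L t′≤p))))

    con-injective : ∀ a b → con a ≋ con b → 2^ θ ℤD.∣ a ℤ.- b
    con-injective a b eq = con≋0⇒∣ (a ℤ.- b) (R.trans (con-+ a (ℤ.- b)) (R.trans (R.+-congʳ {con (ℤ.- b)} eq)
      (R.trans (R.sym (con-+ b (ℤ.- b))) (R.reflexive (cong con (ℤ.+-inverseʳ b))))))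

    N-cancel : ∀ x → 2^ θ ℤD.∣ x ℤ.* + N → 2^ θ ℤD.∣ x
    N-cancel x d = ∣ᵤ⇒∣ (prime-power-cancel prime[2] θ N ℤ.∣ x ∣ 2∤N
      (subst (2 ℕ.^ θ ℕD.∣_) (≡.trans (ℤ.abs-* x (+ N)) (ℕ.*-comm ℤ.∣ x ∣ N)) (∣⇒∣ᵤ d)))
      where
      N-odd = odd-power (suc k)
      2∤N : ¬ 2 ℕD.∣ N
      2∤N d = ℕ.<⇒≢ (s≤s (s≤s z≤n)) (≡.sym (ℕD.∣1⇒≡1 (ℕD.∣m+n∣m⇒∣n (subst (2 ℕD.∣_)
          (≡.trans (proj₂ N-odd) (ℕ.+-comm 1 (2 ℕ.* proj₁ N-odd))) d) (ℕD.m∣m*n (proj₁ N-odd)))))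

  u-divisible : ∀ t → t < p → 2^ θ ℤD.∣ u t ℤ.- u 0
  u-divisible t t<p = N-cancel (u t ℤ.- u 0) (subst (2^ θ ℤD.∣_) (≡.trans
      (cong₂ (λ a b → η a ℤ.* + N ℤ.- η b ℤ.* + N) index-t (ℕ.n∸n≡0 N)) (factor (u t) (u 0) (+ N)))
    -- The shifts p - t and p correspond to the indices N - (p - t) L = t L and N - p L = 0.
    (con-injective _ _ (η-congruence (p ∸ t) p (ℕ.m<n⇒0<n∸m t<p) (ℕ.m∸n≤m p t) (ℕ.>-nonZero⁻¹ p) ℕ.≤-refl)))
    where
    factor : ∀ a b c → a ℤ.* c ℤ.- b ℤ.* c ≡ (a ℤ.- b) ℤ.* c
    factor = solve-∀
    index-t : N ∸ (p ∸ t) ℕ.* L ≡ t ℕ.* L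
    index-t = ≡.trans (≡.sym (ℕ.*-distribʳ-∸ L p (p ∸ t))) (cong (ℕ._* L) (ℕ.m∸[m∸n]≡n (ℕ.<⇒≤ t<p)))

  private
    quotients : ∀ t → Dec (t < p) → ℤ
    quotients t (yes t<p) = ℤD._∣_.quotient (u-divisible t t<p)
    quotients t (no _)    = 0ℤ

    v : ℕ → ℤ
    v t = quotients t (t ℕ.<? p)

    u-affine : ∀ t → t < p → u t ≡ u 0 ℤ.+ 2^ θ ℤ.* v t
    u-affine t t<p = go (t ℕ.<? p)
      where
      go : ∀ (d : Dec (t < p)) → u t ≡ u 0 ℤ.+ 2^ θ ℤ.* quotients t d
      go (no t≮p)   = ⊥-elim (t≮p t<p)
      go (yes t<p′) = ≡.trans (l₁ (u t) (u 0)) (cong (ℤ._+_ (u 0)) (≡.trans (ℤD._∣_.equality (u-divisible t t<p′)) (ℤ.*-comm _ (2^ θ))))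
        where
        l₁ : ∀ a b → a ≡ b ℤ.+ (a ℤ.- b)
        l₁ = solve-∀

    4q : + 4 ℤ.* + suc n ≡ 2^ θ ℤ.* 2^ θ ℤ.* + (1 ℕ.+ p)
    4q = ≡.trans (≡.sym (ℤ.pos-* 4 (suc n))) (≡.trans (cong +_ in-ℕ) (≡.trans
        (ℤ.pos-* (2 ℕ.^ θ ℕ.* 2 ℕ.^ θ) (1 ℕ.+ p)) (cong (ℤ._* + (1 ℕ.+ p)) (ℤ.pos-* (2 ℕ.^ θ) (2 ℕ.^ θ)))))
      where
      exponents : ∀ r g → 2 ℕ.+ (1 ℕ.+ 2 ℕ.* g) ℕ.* r ≡ (1 ℕ.+ r ℕ.* g) ℕ.+ (1 ℕ.+ r ℕ.* g) ℕ.+ r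
      exponents = solve-ℕ
      in-ℕ : 4 ℕ.* suc n ≡ 2 ℕ.^ θ ℕ.* 2 ℕ.^ θ ℕ.* (1 ℕ.+ p)
      in-ℕ = begin
        4 ℕ.* suc n ≡⟨ cong (4 ℕ.*_) 1+n≡2^f ⟩
        2 ℕ.^ 2 ℕ.* 2 ℕ.^ (L ℕ.* r) ≡⟨ ℕ.^-distribˡ-+-* 2 2 (L ℕ.* r) ⟨
        2 ℕ.^ (2 ℕ.+ L ℕ.* r) ≡⟨ cong (2 ℕ.^_) (≡.trans (cong (λ l → 2 ℕ.+ l ℕ.* r) (proj₂ (odd-power k))) (exponents r g)) ⟩
        2 ℕ.^ (θ ℕ.+ θ ℕ.+ r) ≡⟨ ℕ.^-distribˡ-+-* 2 (θ ℕ.+ θ) r ⟩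
        2 ℕ.^ (θ ℕ.+ θ) ℕ.* 2 ℕ.^ r ≡⟨ cong₂ ℕ._*_ (ℕ.^-distribˡ-+-* 2 θ θ) (≡.sym 1+p≡2^r) ⟩
        2 ℕ.^ θ ℕ.* 2 ℕ.^ θ ℕ.* (1 ℕ.+ p) ∎
        where open ≡.≡-Reasoning

    instance
      2^θ-nonZero : ℤ.NonZero (2^ θ)
      2^θ-nonZero = ℕ.m^n≢0 2 θ

    -- By `4q` the factor 2^(2θ) cancels from `u-variance`, leaving (p - 1)(p + 1)/4 = h (h + 1).
    v-variance : variance p v ≡ + h ℤ.* (+ h ℤ.+ 1ℤ)
    v-variance = ℤ.*-cancelˡ-≡ (2^ θ) _ _ (ℤ.*-cancelˡ-≡ (2^ θ) _ _ (ℤ.*-cancelˡ-≡ (+ 4) _ _ (begin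
      + 4 ℤ.* (Q ℤ.* (Q ℤ.* variance p v)) ≡⟨ cong (ℤ._*_ (+ 4)) (≡.trans (≡.sym (ℤ.*-assoc Q Q (variance p v)))
          (≡.sym (variance-affine p (u 0) Q v))) ⟩
      + 4 ℤ.* variance p (λ t → u 0 ℤ.+ Q ℤ.* v t) ≡⟨ cong (ℤ._*_ (+ 4))
          (cong₂ (λ a b → + p ℤ.* a ℤ.- b ℤ.* b) (Z.Σ-cong p (λ t t<p → ≡.sym
          (cong₂ ℤ._*_ (u-affine t t<p) (u-affine t t<p)))) (Z.Σ-cong p (λ t t<p → ≡.sym (u-affine t t<p)))) ⟩
      + 4 ℤ.* variance p u ≡⟨ cong (ℤ._*_ (+ 4)) u-variance ⟩
      + 4 ℤ.* ((+ p ℤ.- 1ℤ) ℤ.* + suc n) ≡⟨ l₁ (+ p) (+ suc n) ⟩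
      (+ p ℤ.- 1ℤ) ℤ.* (+ 4 ℤ.* + suc n) ≡⟨ cong (ℤ._*_ (+ p ℤ.- 1ℤ)) 4q ⟩
      (+ p ℤ.- 1ℤ) ℤ.* (Q ℤ.* Q ℤ.* (1ℤ ℤ.+ + p)) ≡⟨ cong (λ x → (x ℤ.- 1ℤ) ℤ.* (Q ℤ.* Q ℤ.* (1ℤ ℤ.+ x)))
          (≡.trans (cong +_ p≡1+2h) (cong (ℤ._+_ 1ℤ) (ℤ.pos-* 2 h))) ⟩
      (1ℤ ℤ.+ + 2 ℤ.* + h ℤ.- 1ℤ) ℤ.* (Q ℤ.* Q ℤ.* (1ℤ ℤ.+ (1ℤ ℤ.+ + 2 ℤ.* + h))) ≡⟨ l₂ Q (+ h) ⟩
      + 4 ℤ.* (Q ℤ.* (Q ℤ.* (+ h ℤ.* (+ h ℤ.+ 1ℤ)))) ∎)))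
      where
      open ≡.≡-Reasoning
      Q = 2^ θ
      l₁ : ∀ p q → + 4 ℤ.* ((p ℤ.- 1ℤ) ℤ.* q) ≡ (p ℤ.- 1ℤ) ℤ.* (+ 4 ℤ.* q)
      l₁ = solve-∀
      l₂ : ∀ Q h → (1ℤ ℤ.+ + 2 ℤ.* h ℤ.- 1ℤ) ℤ.* (Q ℤ.* Q ℤ.* (1ℤ ℤ.+ (1ℤ ℤ.+ + 2 ℤ.* h))) ≡ + 4 ℤ.* (Q ℤ.* (Q ℤ.* (h ℤ.* (h ℤ.+ 1ℤ))))
      l₂ = solve-∀

  u-two-values : ∃[ α ] ∃[ β ] (∀ t → (u t ℤ.- α) ℤ.* (u t ℤ.- β) ≡ 0ℤ)
  u-two-values = α , β , λ t → ≡.trans (cong (λ x → (x ℤ.- α) ℤ.* (x ℤ.- β)) (u-mod t)) (at (t % p) (DM.m%n<n t p))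
    where
    values = two-values p h pr p≡1+2h v v-variance
    a b α β : ℤ
    a = proj₁ values
    b = proj₁ (proj₂ values)
    α = u 0 ℤ.+ 2^ θ ℤ.* a
    β = u 0 ℤ.+ 2^ θ ℤ.* b
    at : ∀ t → t < p → (u t ℤ.- α) ℤ.* (u t ℤ.- β) ≡ 0ℤ
    at t t<p = ≡.trans (cong (λ x → (x ℤ.- α) ℤ.* (x ℤ.- β)) (u-affine t t<p)) (≡.trans (l₁ (u 0) (2^ θ) (v t) a b)
      (≡.trans (cong (ℤ._*_ (2^ θ ℤ.* 2^ θ)) (proj₂ (proj₂ values) t t<p)) (ℤ.*-zeroʳ (2^ θ ℤ.* 2^ θ))))
      where
      l₁ : ∀ u Q v a b → (u ℤ.+ Q ℤ.* v ℤ.- (u ℤ.+ Q ℤ.* a)) ℤ.* (u ℤ.+ Q ℤ.* v ℤ.- (u ℤ.+ Q ℤ.* b)) ≡ Q ℤ.* Q ℤ.* ((v ℤ.- a) ℤ.* (v ℤ.- b))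
      l₁ = solve-∀
    u-mod : ∀ t → u t ≡ u (t % p)
    u-mod t = ≡.trans (cong η (≡.trans (cong (ℕ._* L) (DM.m≡m%n+[m/n]*n t p))
        (≡.trans (ℕ.*-distribʳ-+ L (t % p) (t / p ℕ.* p)) (cong (t % p ℕ.* L ℕ.+_) (ℕ.*-assoc (t / p) p L)))))
      (η-periodic* (t % p ℕ.* L) (t / p))

  window-two-values : ∃[ α ] ∃[ β ] (∀ a → (window a ℤ.- α) ℤ.* (window a ℤ.- β) ≡ 0ℤ)
  window-two-values = α ℤ.+ s₀ , β ℤ.+ s₀ , λ a → ≡.trans (cong (λ x → (x ℤ.- (α ℤ.+ s₀)) ℤ.* (x ℤ.- (β ℤ.+ s₀)))
      (proj₂ (proj₂ window-values a)))
    (≡.trans (l₁ (u (proj₁ (proj₂ window-values a))) s₀ α β) (proj₂ (proj₂ u-two-values) (proj₁ (proj₂ window-values a))))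
    where
    s₀ = proj₁ window-values
    α = proj₁ u-two-values
    β = proj₁ (proj₂ u-two-values)
    l₁ : ∀ u s α β → (u ℤ.+ s ℤ.- (α ℤ.+ s)) ℤ.* (u ℤ.+ s ℤ.- (β ℤ.+ s)) ≡ (u ℤ.- α) ℤ.* (u ℤ.- β)
    l₁ = solve-∀

-- Strongly regular Cayley graphs

indicator : ∀ {a} {A : Set a} → Dec A → ℕ
indicator (yes _) = 1
indicator (no _)  = 0

indicator-yes : ∀ {a} {A : Set a} (d : Dec A) → A → indicator d ≡ 1
indicator-yes (yes _) _ = ≡.refl
indicator-yes (no ¬a) a = ⊥-elim (¬a a)

indicator-no : ∀ {a} {A : Set a} (d : Dec A) → ¬ A → indicator d ≡ 0
indicator-no (yes a) ¬a = ⊥-elim (¬a a)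
indicator-no (no _)  _  = ≡.refl

indicator-cong : ∀ {a b} {A : Set a} {B : Set b} (d : Dec A) (e : Dec B) → (A → B) → (B → A) → indicator d ≡ indicator e
indicator-cong (yes a) e f g = ≡.sym (indicator-yes e (f a))
indicator-cong (no ¬a) e f g = ≡.sym (indicator-no e (¬a ∘ g))

indicator-× : ∀ {a b} {A : Set a} {B : Set b} (d : Dec A) (e : Dec B) → indicator (d ×-dec e) ≡ indicator d ℕ.* indicator e
indicator-× (yes a) (yes b) = ≡.refl
indicator-× (yes a) (no ¬b) = ≡.refl
indicator-× (no ¬a) e       = ≡.refl

module Counting {a} {Q : ℕ → Set a} (Q? : ∀ i → Dec (Q i)) where

  -- Restricted to the solutions of Q, this count of smaller solutions numbers them consecutively
  -- from 0, which yields the bijections with `Fin`.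
  rank : ℕ → ℕ
  rank zero    = 0
  rank (suc m) = indicator (Q? m) ℕ.+ rank m

  +rank : ∀ m → + rank m ≡ Z.Σ< m (λ i → + indicator (Q? i))
  +rank zero    = ≡.sym (Z.Σ-empty _)
  +rank (suc m) = ≡.trans (ℤ.+-comm (+ indicator (Q? m)) (+ rank m)) (≡.trans
      (cong (ℤ._+ + indicator (Q? m)) (+rank m)) (≡.sym (Z.Σ-snoc m _)))

  rank-mono : ∀ {i m} → i ≤ m → rank i ≤ rank m
  rank-mono {i} {m} i≤m with ℕ.m≤n⇒m<n∨m≡n i≤m
  ... | inj₂ ≡.refl = ℕ.≤-refl
  rank-mono {i} {suc m} _ | inj₁ (s≤s i≤m) = ℕ.≤-trans (rank-mono i≤m) (ℕ.m≤n+m (rank m) (indicator (Q? m)))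

  rank-< : ∀ {i m} → Q i → i < m → rank i < rank m
  rank-< {i} {m} qi i<m = ℕ.<-≤-trans (ℕ.≤-reflexive (cong (ℕ._+ rank i) (≡.sym (indicator-yes (Q? i) qi)))) (rank-mono i<m)

  rank-injective : ∀ {i j} → Q i → Q j → rank i ≡ rank j → i ≡ j
  rank-injective {i} {j} qi qj eq with ℕ.<-cmp i j
  ... | tri< i<j _ _ = ⊥-elim (ℕ.<⇒≢ (rank-< qi i<j) eq)
  ... | tri≈ _ i≡j _ = i≡j
  ... | tri> _ _ j<i = ⊥-elim (ℕ.<⇒≢ (rank-< qj j<i) (≡.sym eq))

  enumerate : ∀ m j → j < rank m → ∃[ i ] (i < m × Q i × rank i ≡ j)
  enumerate (suc m) j j< with Q? m
  enumerate (suc m) j (s≤s j≤) | yes qm with ℕ.m≤n⇒m<n∨m≡n j≤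
  ... | inj₂ j≡ = m , ℕ.n<1+n m , qm , ≡.sym j≡
  ... | inj₁ j< with enumerate m j j<
  ...   | i , i<m , qi , eq = i , ℕ.m<n⇒m<1+n i<m , qi , eq
  enumerate (suc m) j j< | no _ with enumerate m j j<
  ...   | i , i<m , qi , eq = i , ℕ.m<n⇒m<1+n i<m , qi , eq

module Eigenvalues {c ℓ : Level} {q : ℕ} (F : FiniteField c ℓ q)
  (γ : FiniteField.Carrier F) (prim : IsPrimitive F γ) (f : ℕ) (q≡2^f : q ≡ 2 ℕ.^ f) where
  open FiniteField F
  open Characteristic2 F γ prim f q≡2^f
  open import Algebra.Properties.Group +-group using (x∙y⁻¹≈ε⇒x≈y)
  private module ZF = SumF ℤ-ring

  module _ {a} {P : Pred Carrier a} (P-resp : ∀ {x y} → x ≈ y → P x → P y) (P? : Decidable P) where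
    open Counting (λ i → P? (elt i))

    card : ℕ
    card = rank (suc n)

    +card : + card ≡ ZF.ΣF (λ x → + indicator (P? x))
    +card = +rank (suc n)

    hasCardinality : HasCardinality (subset setoid P) card
    hasCardinality = record
      { to = λ (x , px) → fromℕ< (rank-< (at-idx x px) (idx< x))
      ; from = λ j → elt (index j) , proj₁ (proj₂ (proj₂ (enumerated j)))
      ; to-cong = λ {x} {y} eq → Fin.toℕ-injective (≡.trans (Fin.toℕ-fromℕ< _)
          (≡.trans (cong rank (idx-cong eq)) (≡.sym (Fin.toℕ-fromℕ< _))))
      ; from-cong = λ { ≡.refl → refl }
      ; inverse = (λ {j} {x} eq → Fin.toℕ-injective (≡.trans (Fin.toℕ-fromℕ< _)
          (≡.trans (cong rank (≡.trans (idx-cong eq) (idx-elt (index j) (proj₁ (proj₂ (enumerated j))))))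
                    (proj₂ (proj₂ (proj₂ (enumerated j)))))))
                , (λ {x} {j} eq → trans (reflexive (cong elt (rank-injective {index j} {idx (proj₁ x)}
                  (proj₁ (proj₂ (proj₂ (enumerated j)))) (at-idx (proj₁ x) (proj₂ x))
                    (≡.trans (proj₂ (proj₂ (proj₂ (enumerated j)))) (≡.trans (cong toℕ eq) (Fin.toℕ-fromℕ< _)))))) (elt-idx (proj₁ x)))
      }
      where
      at-idx : ∀ x → P x → P (elt (idx x))
      at-idx x = P-resp (sym (elt-idx x))
      enumerated : ∀ (j : Fin card) → ∃[ i ] (i < suc n × P (elt i) × rank i ≡ toℕ j)
      enumerated j = enumerate (suc n) (toℕ j) (Fin.toℕ<n j)
      index : Fin card → ℕ
      index j = proj₁ (enumerated j)

  module _ {a} {D : Pred Carrier a} (D-resp : ∀ {x y} → x ≈ y → D x → D y) (D? : Decidable D) where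

    χ : Carrier → ℤ
    χ x = + indicator (D? x)

    χ-cong : ∀ {x y} → x ≈ y → χ x ≡ χ y
    χ-cong {x} {y} eq = cong +_ (indicator-cong (D? x) (D? y) (D-resp eq) (D-resp (sym eq)))

    -- The Fourier transform of the indicator of D; its values are the eigenvalues of the Cayley
    -- graph.
    χ̂ : Carrier → ℤ
    χ̂ b = ZF.ΣF (λ x → χ x ℤ.* ψ (b * x))

    private
      orthogonality : ∀ c → ¬ c ≈ 0# → ZF.ΣF (λ b → ψ (b * c)) ≡ 0ℤ
      orthogonality c c≉0 = ≡.trans (ZF.ΣF-cong (λ b → ψ-cong (*-comm b c))) (Σψ-scaled≡0 c c≉0)

      orthogonality-0 : ∀ c → c ≈ 0# → ZF.ΣF (λ b → ψ (b * c)) ≡ + suc n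
      orthogonality-0 c c≈0 = ≡.trans (ZF.ΣF-cong (λ b → ≡.trans (ψ-cong (trans (*-congˡ c≈0) (zeroʳ b))) ψ-0))
          (≡.trans (Σ-const (suc n) 1ℤ) (ℤ.*-identityʳ (+ suc n)))

      -- Orthogonality leaves only x + d = 0, that is x = d in characteristic 2.
      sift : ∀ (g : Carrier → ℤ) → (∀ {x y} → x ≈ y → g x ≡ g y) → ∀ d → ZF.ΣF
          (λ x → g x ℤ.* ZF.ΣF (λ b → ψ (b * (x + d)))) ≡ g d ℤ.* + suc n
      sift g g-cong d = ≡.trans (Z.Σ-only (suc n) (idx d) (λ i → g (elt i) ℤ.* ZF.ΣF (λ b → ψ (b * (elt i + d)))) (idx< d) others)
        (cong₂ ℤ._*_ (g-cong (elt-idx d)) (orthogonality-0 (elt (idx d) + d) (trans (+-congʳ (elt-idx d)) (x+x≈0 d))))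
        where
        others : ∀ i → i < suc n → ¬ i ≡ idx d → g (elt i) ℤ.* ZF.ΣF (λ b → ψ (b * (elt i + d))) ≡ 0ℤ
        others i i< i≢ = ≡.trans (cong (ℤ._*_ (g (elt i))) (orthogonality (elt i + d)
          (λ eq → i≢ (elt-injective i (idx d) i< (idx< d) (trans (x∙y⁻¹≈ε⇒x≈y (elt i) d (trans (+-congˡ (-x≈x d)) eq))
            (sym (elt-idx d))))))) (ℤ.*-zeroʳ (g (elt i)))

      -- The number of common neighbours of two vertices whose difference is d.
      A : Carrier → ℤ
      A d = ZF.ΣF (λ x → χ x ℤ.* χ (x + d))

      first-moment : ∀ d → ZF.ΣF (λ b → χ̂ b ℤ.* ψ (b * d)) ≡ χ d ℤ.* + suc n
      first-moment d = begin
        ZF.ΣF (λ b → χ̂ b ℤ.* ψ (b * d)) ≡⟨ ZF.ΣF-cong (λ b → Z.Σ-*ʳ (suc n) (ψ (b * d)) (λ i → χ (elt i) ℤ.* ψ (b * elt i))) ⟩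
        ZF.ΣF (λ b → ZF.ΣF (λ x → χ x ℤ.* ψ (b * x) ℤ.* ψ (b * d))) ≡⟨ Z.Σ-swap (suc n) (suc n) _ ⟩
        ZF.ΣF (λ x → ZF.ΣF (λ b → χ x ℤ.* ψ (b * x) ℤ.* ψ (b * d))) ≡⟨ ZF.ΣF-cong
          (λ x → ZF.ΣF-cong (λ b → ≡.trans (ℤ.*-assoc (χ x) (ψ (b * x)) (ψ (b * d)))
          (cong (ℤ._*_ (χ x)) (≡.trans (≡.sym (ψ-+ (b * x) (b * d))) (ψ-cong (sym (distribˡ b x d))))))) ⟩
        ZF.ΣF (λ x → ZF.ΣF (λ b → χ x ℤ.* ψ (b * (x + d)))) ≡⟨ ZF.ΣF-cong (λ x → Z.Σ-*ˡ (suc n) (χ x) (λ i → ψ (elt i * (x + d)))) ⟨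
        ZF.ΣF (λ x → χ x ℤ.* ZF.ΣF (λ b → ψ (b * (x + d)))) ≡⟨ sift χ χ-cong d ⟩
        χ d ℤ.* + suc n ∎
        where open ≡.≡-Reasoning

      second-moment : ∀ d → ZF.ΣF (λ b → χ̂ b ℤ.* χ̂ b ℤ.* ψ (b * d)) ≡ A d ℤ.* + suc n
      second-moment d = begin
        ZF.ΣF (λ b → χ̂ b ℤ.* χ̂ b ℤ.* ψ (b * d)) ≡⟨ ZF.ΣF-cong (λ b → expand b) ⟩
        ZF.ΣF (λ b → ZF.ΣF (λ x → χ x ℤ.* (χ̂ b ℤ.* ψ (b * (x + d))))) ≡⟨ Z.Σ-swap (suc n) (suc n) _ ⟩
        ZF.ΣF (λ x → ZF.ΣF (λ b → χ x ℤ.* (χ̂ b ℤ.* ψ (b * (x + d))))) ≡⟨ ZF.ΣF-cong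
          (λ x → Z.Σ-*ˡ (suc n) (χ x) (λ i → χ̂ (elt i) ℤ.* ψ (elt i * (x + d)))) ⟨
        ZF.ΣF (λ x → χ x ℤ.* ZF.ΣF (λ b → χ̂ b ℤ.* ψ (b * (x + d)))) ≡⟨ ZF.ΣF-cong
          (λ x → ≡.trans (cong (ℤ._*_ (χ x)) (first-moment (x + d))) (≡.sym (ℤ.*-assoc (χ x) (χ (x + d)) (+ suc n)))) ⟩
        ZF.ΣF (λ x → χ x ℤ.* χ (x + d) ℤ.* + suc n) ≡⟨ Z.Σ-*ʳ (suc n) (+ suc n) (λ i → χ (elt i) ℤ.* χ (elt i + d)) ⟨
        A d ℤ.* + suc n ∎
        where
        open ≡.≡-Reasoning
        l₁ : ∀ h s t → h ℤ.* s ℤ.* t ≡ s ℤ.* (h ℤ.* t)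
        l₁ = solve-∀
        l₂ : ∀ x s h t → x ℤ.* s ℤ.* (h ℤ.* t) ≡ x ℤ.* (h ℤ.* (s ℤ.* t))
        l₂ = solve-∀
        expand : ∀ b → χ̂ b ℤ.* χ̂ b ℤ.* ψ (b * d) ≡ ZF.ΣF (λ x → χ x ℤ.* (χ̂ b ℤ.* ψ (b * (x + d))))
        expand b = ≡.trans (l₁ (χ̂ b) (χ̂ b) (ψ (b * d))) (≡.trans (Z.Σ-*ʳ (suc n) (χ̂ b ℤ.* ψ (b * d)) (λ i → χ (elt i) ℤ.* ψ (b * elt i)))
          (ZF.ΣF-cong (λ x → ≡.trans (l₂ (χ x) (ψ (b * x)) (χ̂ b) (ψ (b * d)))
            (cong (λ s → χ x ℤ.* (χ̂ b ℤ.* s)) (≡.trans (≡.sym (ψ-+ (b * x) (b * d))) (ψ-cong (sym (distribˡ b x d))))))))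

    module _ (α β : ℤ) (two-valued : ∀ b → ¬ b ≈ 0# → (χ̂ b ℤ.- α) ℤ.* (χ̂ b ℤ.- β) ≡ 0ℤ) where
      private
        -- The sum of (χ̂ b - α)(χ̂ b - β) ψ(b d) over b has only its term at b = 0. Expanded by the
        -- two moments and by orthogonality for d ≠ 0, it becomes a linear relation between A d and
        -- χ d.
        A-formula : ∀ d → ¬ d ≈ 0# → A d ℤ.* + suc n ≡ (χ̂ 0# ℤ.- α) ℤ.* (χ̂ 0# ℤ.- β) ℤ.+ (α ℤ.+ β) ℤ.* (χ d ℤ.* + suc n)
        A-formula d d≉0 = rearrange (A d ℤ.* + suc n) (χ d ℤ.* + suc n) total (begin
          total ≡⟨ only-0 ⟨
          ZF.ΣF (λ b → (χ̂ b ℤ.- α) ℤ.* (χ̂ b ℤ.- β) ℤ.* ψ (b * d)) ≡⟨ ZF.ΣF-cong (λ b → expand (χ̂ b) α β (ψ (b * d))) ⟩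
          ZF.ΣF (λ b → (χ̂ b ℤ.* χ̂ b ℤ.* ψ (b * d)) ℤ.+ (ℤ.- (α ℤ.+ β) ℤ.* (χ̂ b ℤ.* ψ (b * d)) ℤ.+ α ℤ.* β ℤ.* ψ
            (b * d))) ≡⟨ ≡.trans (Z.Σ-+ (suc n) _ _) (cong₂ ℤ._+_ (second-moment d) (≡.trans (Z.Σ-+ (suc n) _ _)
              (cong₂ ℤ._+_ (≡.trans (≡.sym (Z.Σ-*ˡ (suc n) (ℤ.- (α ℤ.+ β)) (λ i → χ̂ (elt i) ℤ.* ψ (elt i * d))))
                (cong (ℤ._*_ (ℤ.- (α ℤ.+ β))) (first-moment d)))
              (≡.trans (≡.sym (Z.Σ-*ˡ (suc n) (α ℤ.* β) (λ i → ψ (elt i * d))))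
                (≡.trans (cong (ℤ._*_ (α ℤ.* β)) (orthogonality d d≉0)) (ℤ.*-zeroʳ (α ℤ.* β))))))) ⟩
          A d ℤ.* + suc n ℤ.+ (ℤ.- (α ℤ.+ β) ℤ.* (χ d ℤ.* + suc n) ℤ.+ 0ℤ) ∎)
          where
          open ≡.≡-Reasoning
          total : ℤ
          total = (χ̂ 0# ℤ.- α) ℤ.* (χ̂ 0# ℤ.- β)
          expand : ∀ x α β s → (x ℤ.- α) ℤ.* (x ℤ.- β) ℤ.* s ≡ x ℤ.* x ℤ.* s ℤ.+ (ℤ.- (α ℤ.+ β) ℤ.* (x ℤ.* s) ℤ.+ α ℤ.* β ℤ.* s)
          expand = solve-∀
          rearrange : ∀ a x t → t ≡ a ℤ.+ (ℤ.- (α ℤ.+ β) ℤ.* x ℤ.+ 0ℤ) → a ≡ t ℤ.+ (α ℤ.+ β) ℤ.* x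
          rearrange a x t eq = ≡.trans (l₁ a x (α ℤ.+ β)) (cong (ℤ._+ (α ℤ.+ β) ℤ.* x) (≡.sym eq))
            where
            l₁ : ∀ a x y → a ≡ a ℤ.+ (ℤ.- y ℤ.* x ℤ.+ 0ℤ) ℤ.+ y ℤ.* x
            l₁ = solve-∀
          only-0 : ZF.ΣF (λ b → (χ̂ b ℤ.- α) ℤ.* (χ̂ b ℤ.- β) ℤ.* ψ (b * d)) ≡ total
          only-0 = ≡.trans (Z.Σ-only (suc n) 0 (λ i → (χ̂ (elt i) ℤ.- α) ℤ.* (χ̂ (elt i) ℤ.- β) ℤ.* ψ (elt i * d)) (s≤s z≤n) vanish)
            (≡.trans (cong (ℤ._*_ total) (≡.trans (ψ-cong (zeroˡ d)) ψ-0)) (ℤ.*-identityʳ total))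
            where
            vanish : ∀ i → i < suc n → ¬ i ≡ 0 → (χ̂ (elt i) ℤ.- α) ℤ.* (χ̂ (elt i) ℤ.- β) ℤ.* ψ (elt i * d) ≡ 0ℤ
            vanish zero    _ 0≢0 = ⊥-elim (0≢0 ≡.refl)
            vanish (suc i) _ _   = ≡.trans (cong (ℤ._* ψ (γ ^ i * d)) (two-valued (γ ^ i) (γ^-≉0 i))) (ℤ.*-zeroˡ (ψ (γ ^ i * d)))

        A-depends-on-χ : ∀ d e → ¬ d ≈ 0# → ¬ e ≈ 0# → χ d ≡ χ e → A d ≡ A e
        A-depends-on-χ d e d≉0 e≉0 eq = ℤ.*-cancelʳ-≡ (A d) (A e) (+ suc n) (≡.trans (A-formula d d≉0)
          (≡.trans (cong (λ x → (χ̂ 0# ℤ.- α) ℤ.* (χ̂ 0# ℤ.- β) ℤ.+ (α ℤ.+ β) ℤ.* (x ℤ.* + suc n)) eq) (≡.sym (A-formula e e≉0))))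

        _~_ : Rel Carrier a
        _~_ = Cay F D

        x-[z+x]≈z : ∀ x z → x - (z + x) ≈ z
        x-[z+x]≈z x z = trans (+-congˡ (-x≈x (z + x))) (trans (x∙yz≈y∙xz x z x) (trans (+-congˡ (x+x≈0 x)) (+-identityʳ z)))
          where open import Algebra.Properties.CommutativeSemigroup +-commutativeSemigroup using (x∙yz≈y∙xz)

        y-[z+x]≈z+[x-y] : ∀ x y z → y - (z + x) ≈ z + (x - y)
        y-[z+x]≈z+[x-y] x y z = trans (+-congˡ (-x≈x (z + x))) (trans (+-comm y (z + x))
          (trans (+-assoc z x y) (+-congˡ (+-congˡ (sym (-x≈x y))))))

        neighbour-resp : ∀ x {z w} → z ≈ w → x ~ z → x ~ w
        neighbour-resp x eq = D-resp (+-congˡ (-‿cong eq))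

        common-resp : ∀ x y {z w} → z ≈ w → x ~ z × y ~ z → x ~ w × y ~ w
        common-resp x y eq (xz , yz) = neighbour-resp x eq xz , neighbour-resp y eq yz

        neighbour? : ∀ x → Decidable (x ~_)
        neighbour? x z = D? (x - z)

        common? : ∀ x y → Decidable (λ z → x ~ z × y ~ z)
        common? x y z = D? (x - z) ×-dec D? (y - z)

        degree : Carrier → ℕ
        degree x = card (neighbour-resp x) (neighbour? x)

        codegree : Carrier → Carrier → ℕ
        codegree x y = card (common-resp x y) (common? x y)

        +degree : ∀ x → + degree x ≡ ZF.ΣF χ
        +degree x = ≡.trans (+card (neighbour-resp x) (neighbour? x)) (≡.trans
          (≡.sym (ZF.ΣF-bijection (translation x) (λ z → χ (x - z)) (λ eq → χ-cong (+-congˡ (-‿cong eq)))))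
          (ZF.ΣF-cong (λ z → χ-cong (x-[z+x]≈z x z))))

        -- Substituting z + x for z turns the two differences into z and z + (x - y).
        +codegree : ∀ x y → + codegree x y ≡ A (x - y)
        +codegree x y = ≡.trans (+card (common-resp x y) (common? x y))
          (≡.trans (ZF.ΣF-cong (λ z → ≡.trans (cong +_ (indicator-× (D? (x - z)) (D? (y - z))))
          (ℤ.pos-* (indicator (D? (x - z))) (indicator (D? (y - z)))))) (≡.trans
          (≡.sym (ZF.ΣF-bijection (translation x) (λ z → χ (x - z) ℤ.* χ (y - z))
            (λ eq → cong₂ ℤ._*_ (χ-cong (+-congˡ (-‿cong eq))) (χ-cong (+-congˡ (-‿cong eq))))))
          (ZF.ΣF-cong (λ z → cong₂ ℤ._*_ (χ-cong (x-[z+x]≈z x z)) (χ-cong (y-[z+x]≈z+[x-y] x y z))))))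

        x-0≈x : ∀ x → x - 0# ≈ x
        x-0≈x x = trans (+-congˡ (-x≈x 0#)) (+-identityʳ x)

      -- The samples d₁ and d₀ fix the parameters, as the codegrees of their pairs with 0, and also
      -- show that the graph is neither edgeless nor complete.
      stronglyRegular : ¬ D 0# → ∀ d₁ → D d₁ → ∀ d₀ → ¬ d₀ ≈ 0# → ¬ D d₀ → IsStronglyRegular setoid (Cay F D)
      stronglyRegular 0∉D d₁ d₁∈D d₀ d₀≉0 d₀∉D = q , degree 0# , codegree d₁ 0# , codegree d₀ 0# , record
        { respects    = (λ {x} eq → neighbour-resp x eq) , (λ {y} eq → D-resp (+-congʳ eq))
        ; irreflexive = λ {x} {y} eq xy → 0∉D (D-resp (trans (+-congˡ (-‿cong (sym eq))) (-‿inverseʳ x)) xy)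
        ; symmetric   = λ {x} {y} → D-resp (trans (+-congˡ (-x≈x y)) (trans (+-comm x y) (+-congˡ (sym (-x≈x x)))))
        ; order       = cardinality
        ; valency     = λ x → subst (HasCardinality (subset setoid (x ~_)))
          (ℤ.+-injective (≡.trans (+degree x) (≡.sym (+degree 0#)))) (hasCardinality (neighbour-resp x) (neighbour? x))
        ; notComplete = λ complete → d₀∉D (D-resp (x-0≈x d₀) (complete d₀ 0# d₀≉0))
        ; notEdgeless = λ edgeless → edgeless d₁ 0# (D-resp (sym (x-0≈x d₁)) d₁∈D)
        ; adjacent    = λ x y xy → common x y d₁ (λ eq → 0∉D (D-resp eq xy)) (λ eq → 0∉D (D-resp eq d₁∈D))
              (≡.trans (χ-∈ xy) (≡.sym (χ-∈ d₁∈D)))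
        ; nonadjacent = λ x y x≉y ¬xy → common x y d₀ (x≉y ∘ x∙y⁻¹≈ε⇒x≈y x y) d₀≉0 (≡.trans (χ-∉ ¬xy) (≡.sym (χ-∉ d₀∉D)))
        }
        where
        χ-∈ : ∀ {x} → D x → χ x ≡ 1ℤ
        χ-∈ {x} dx = cong +_ (indicator-yes (D? x) dx)
        χ-∉ : ∀ {x} → ¬ D x → χ x ≡ 0ℤ
        χ-∉ {x} ¬dx = cong +_ (indicator-no (D? x) ¬dx)
        common : ∀ x y d → ¬ x - y ≈ 0# → ¬ d ≈ 0# → χ (x - y) ≡ χ d → HasCardinality (commonNeighbours setoid _~_ x y) (codegree d 0#)
        common x y d xy≉0 d≉0 eq = subst (HasCardinality (commonNeighbours setoid _~_ x y))
          (ℤ.+-injective (≡.trans (+codegree x y) (≡.trans (A-depends-on-χ (x - y) (d - 0#) xy≉0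
            (d≉0 ∘ trans (sym (x-0≈x d))) (≡.trans eq (χ-cong (sym (x-0≈x d))))) (≡.sym (+codegree d 0#)))))
          (hasCardinality (common-resp x y) (common? x y))

-- Unions of cyclotomic classes

open import Data.Nat.Base using (_^_)

module CyclotomicUnion {c ℓ : Level} {q : ℕ} (F : FiniteField c ℓ q)
  (γ : FiniteField.Carrier F) (prim : IsPrimitive F γ)
  (p r h : ℕ) (pr : Prime p) (1+p≡2^r : 1 ℕ.+ p ≡ 2 ^ r) (p≡1+2h : p ≡ 1 ℕ.+ 2 ℕ.* h) (k : ℕ)
  (q≡2^f : q ≡ 2 ^ (p ^ k ℕ.* r)) where
  open FiniteField F using (Carrier; _≈_; sym; trans; reflexive; 0#; setoid)
    renaming (_^_ to _⇑_; _*_ to _·_)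
  open MersennePrime p r h pr 1+p≡2^r p≡1+2h
  open PeriodValues F γ prim p r h pr 1+p≡2^r p≡1+2h k q≡2^f
  open Characteristic2 F γ prim (p ^ k ℕ.* r) q≡2^f
  open Eigenvalues F γ prim (p ^ k ℕ.* r) q≡2^f
  open import Algebra.Properties.Semiring.Exp (FiniteField.semiring F) using (^-homo-*)
  private module ZF = SumF ℤ-ring

  D : Pred Carrier ℓ
  D = ⋃ (Fin L) (λ i → CyclotomicClass F γ N (toℕ i))

  q∸1≡n : q ∸ 1 ≡ n
  q∸1≡n = cong (_∸ 1) q≡1+n

  N∣q∸1 : N ∣ q ∸ 1
  N∣q∸1 = subst (N ∣_) (≡.sym q∸1≡n) N∣n

  private
    [q∸1]/N≡M : (q ∸ 1) / N ≡ M
    [q∸1]/N≡M = ≡.trans (cong (_/ N) (≡.trans q∸1≡n n≡M*N)) (DM.m*n/n≡m M N)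

    L<N : L < N
    L<N = ℕ.<-≤-trans (ℕ.m<m*n L p 1<p) (ℕ.≤-reflexive (ℕ.*-comm L p))

    D-resp : ∀ {x y} → x ≈ y → D x → D y
    D-resp x≈y (i , j , j< , eq) = i , j , j< , trans (sym x≈y) eq

    γ∈D : ∀ e → e < n → e % N < L → D (γ ⇑ e)
    γ∈D e e<n e%N<L = fromℕ< e%N<L , e / N ,
      subst (e / N <_) (≡.sym [q∸1]/N≡M) (DM.m<n*o⇒m/o<n (subst (e <_) n≡M*N e<n)) ,
      reflexive (cong (γ ⇑_) (≡.trans (DM.m≡m%n+[m/n]*n e N) (cong (ℕ._+ e / N ℕ.* N) (≡.sym (Fin.toℕ-fromℕ< e%N<L)))))

    D⇒%< : ∀ e → D (γ ⇑ e) → e % N < L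
    D⇒%< e (i , j , _ , eq) = subst (_< L) (≡.sym (≡.trans (γ^-mod-N e (toℕ i ℕ.+ j ℕ.* N) eq)
      (≡.trans (DM.[m+kn]%n≡m%n (toℕ i) j N) (DM.m<n⇒m%n≡m (ℕ.<-trans (Fin.toℕ<n i) L<N))))) (Fin.toℕ<n i)

    0∉D : ¬ D 0#
    0∉D (i , j , _ , eq) = γ^-≉0 (toℕ i ℕ.+ j ℕ.* N) (sym eq)

    D? : Decidable D
    D? x with x ≈? 0#
    ... | yes x≈0 = no (0∉D ∘ D-resp x≈0)
    ... | no x≉0 with log x x≉0
    ...   | e , e<n , eq with e % N ℕ.<? L
    ...     | yes e< = yes (D-resp eq (γ∈D e e<n e<))
    ...     | no  e≮ = no (e≮ ∘ D⇒%< e ∘ D-resp (sym eq))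

    -- Membership of γ^e in D depends only on e modulo N, so the sum splits into the L classes with
    -- residue below L, each contributing one period.
    χ̂-window : ∀ a → χ̂ D-resp D? (γ ⇑ a) ≡ window a
    χ̂-window a = begin
      χ̂ D-resp D? (γ ⇑ a) ≡⟨ Z.Σ-cons n _ ⟩
      χ D-resp D? 0# ℤ.* ψ (γ ⇑ a · 0#) ℤ.+ Z.Σ< n term ≡⟨ cong (ℤ._+ Z.Σ< n term)
          (≡.trans (cong (λ x → + x ℤ.* ψ (γ ⇑ a · 0#)) (indicator-no (D? 0#) 0∉D)) (ℤ.*-zeroˡ (ψ (γ ⇑ a · 0#)))) ⟩
      0ℤ ℤ.+ Z.Σ< n term ≡⟨ ℤ.+-identityˡ _ ⟩
      Z.Σ< n term ≡⟨ cong (λ m → Z.Σ< m term) n≡M*N ⟩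
      Z.Σ< (M ℕ.* N) term ≡⟨ Z.Σ-block M N term ⟩
      Z.Σ< M (λ i → Z.Σ< N (λ j → term (i ℕ.* N ℕ.+ j))) ≡⟨ Z.Σ-cong M row ⟩
      Z.Σ< M (λ i → Z.Σ< L (λ j → ψ (γ ⇑ (a ℕ.+ j ℕ.+ i ℕ.* N)))) ≡⟨ Z.Σ-swap M L _ ⟩
      window a ∎
      where
      open ≡.≡-Reasoning
      term : ℕ → ℤ
      term e = χ D-resp D? (γ ⇑ e) ℤ.* ψ (γ ⇑ a · γ ⇑ e)
      %N : ∀ i j → j < N → (i ℕ.* N ℕ.+ j) % N ≡ j
      %N i j j<N = ≡.trans (cong (_% N) (ℕ.+-comm (i ℕ.* N) j)) (≡.trans (DM.[m+kn]%n≡m%n j i N) (DM.m<n⇒m%n≡m j<N))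
      bound : ∀ i j → i < M → j < N → i ℕ.* N ℕ.+ j < n
      bound i j i<M j<N = ℕ.<-≤-trans (ℕ.+-monoʳ-< (i ℕ.* N) j<N) (ℕ.≤-trans (ℕ.≤-reflexive (ℕ.+-comm (i ℕ.* N) N))
        (ℕ.≤-trans (ℕ.*-monoˡ-≤ N i<M) (ℕ.≤-reflexive (≡.sym n≡M*N))))
      exponent : ∀ a i j N → a ℕ.+ (i ℕ.* N ℕ.+ j) ≡ a ℕ.+ j ℕ.+ i ℕ.* N
      exponent = solve-ℕ
      inside : ∀ i j → i < M → j < L → term (i ℕ.* N ℕ.+ j) ≡ ψ (γ ⇑ (a ℕ.+ j ℕ.+ i ℕ.* N))
      inside i j i<M j<L = ≡.trans (cong (λ x → + x ℤ.* ψ (γ ⇑ a · γ ⇑ (i ℕ.* N ℕ.+ j))) (indicator-yes (D? (γ ⇑ (i ℕ.* N ℕ.+ j)))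
          (γ∈D _ (bound i j i<M j<N) (subst (_< L) (≡.sym (%N i j j<N)) j<L))))
        (≡.trans (ℤ.*-identityˡ _) (ψ-cong (trans (sym (^-homo-* γ a (i ℕ.* N ℕ.+ j))) (reflexive (cong (γ ⇑_) (exponent a i j N))))))
        where
        j<N : j < N
        j<N = ℕ.<-trans j<L L<N
      outside : ∀ i j → j < N ∸ L → term (i ℕ.* N ℕ.+ (L ℕ.+ j)) ≡ 0ℤ
      outside i j j< = ≡.trans (cong (λ x → + x ℤ.* ψ (γ ⇑ a · γ ⇑ (i ℕ.* N ℕ.+ (L ℕ.+ j))))
          (indicator-no (D? (γ ⇑ (i ℕ.* N ℕ.+ (L ℕ.+ j))))
          (λ d → ℕ.<⇒≱ (subst (_< L) (%N i (L ℕ.+ j) L+j<N) (D⇒%< _ d)) (ℕ.m≤m+n L j))))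
            (ℤ.*-zeroˡ (ψ (γ ⇑ a · γ ⇑ (i ℕ.* N ℕ.+ (L ℕ.+ j)))))
        where
        L+j<N : L ℕ.+ j < N
        L+j<N = ℕ.<-≤-trans (ℕ.+-monoʳ-< L j<) (ℕ.≤-reflexive (ℕ.m+[n∸m]≡n (ℕ.<⇒≤ L<N)))
      row : ∀ i → i < M → Z.Σ< N (λ j → term (i ℕ.* N ℕ.+ j)) ≡ Z.Σ< L (λ j → ψ (γ ⇑ (a ℕ.+ j ℕ.+ i ℕ.* N)))
      row i i<M = ≡.trans (cong (λ m → Z.Σ< m (λ j → term (i ℕ.* N ℕ.+ j))) (≡.sym (ℕ.m+[n∸m]≡n (ℕ.<⇒≤ L<N))))
        (≡.trans (Z.Σ-split L (N ∸ L) _) (≡.trans (cong₂ ℤ._+_ (Z.Σ-cong L (λ j j<L → inside i j i<M j<L))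
          (Z.Σ-zero (N ∸ L) (λ j j< → outside i j j<))) (ℤ.+-identityʳ _)))

    α β : ℤ
    α = proj₁ window-two-values
    β = proj₁ (proj₂ window-two-values)

    two-valued : ∀ b → ¬ b ≈ 0# → (χ̂ D-resp D? b ℤ.- α) ℤ.* (χ̂ D-resp D? b ℤ.- β) ≡ 0ℤ
    two-valued b b≉0 = ≡.trans (cong (λ x → (x ℤ.- α) ℤ.* (x ℤ.- β)) (≡.trans
        (χ̂-cong (sym (proj₂ (proj₂ (log b b≉0))))) (χ̂-window a))) (proj₂ (proj₂ window-two-values) a)
      where
      a = proj₁ (log b b≉0)
      χ̂-cong : ∀ {b b′} → b ≈ b′ → χ̂ D-resp D? b ≡ χ̂ D-resp D? b′
      χ̂-cong {b} {b′} eq = ZF.ΣF-cong {λ x → χ D-resp D? x ℤ.* ψ (b · x)} {λ x → χ D-resp D? x ℤ.* ψ (b′ · x)}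
          (λ x → cong (χ D-resp D? x ℤ.*_) (ψ-cong (FiniteField.*-congʳ F eq)))

  cyclotomicUnion-stronglyRegular : IsStronglyRegular setoid (Cay F D)
  cyclotomicUnion-stronglyRegular = stronglyRegular D-resp D? α β two-valued 0∉D
    -- γ^0 lies in C_0, while γ^L lies outside D because L < N.
    (γ ⇑ 0) (γ∈D 0 (s≤s z≤n) (subst (_< L) (≡.sym (DM.m<n⇒m%n≡m (ℕ.>-nonZero⁻¹ N))) (ℕ.>-nonZero⁻¹ L)))
    (γ ⇑ L) (γ^-≉0 L) (λ d → ℕ.<⇒≢ (D⇒%< L d) (DM.m<n⇒m%n≡m L<N))

-- The case p = 127 = 2^7 - 1

prime127 : Prime 127
prime127 = from-yes (prime? 127)

-- 126 = 7 · 18, where 7 is the order of 2 modulo 127.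
φ[127^] : ∀ k → φ (127 ^ suc k) ≡ 127 ^ k ℕ.* 7 ℕ.* 18
φ[127^] k = ≡.trans (Totient.φ-power 127 prime127 k) (≡.sym (ℕ.*-assoc (127 ^ k) 7 18))

mainTheorem6 : ∀ {c ℓ} (m : ℕ) → 1 ≤ m →
    let N = 127 ^ m
        f = φ N / 18
        q = 2 ^ f
    in (F : FiniteField c ℓ q) (γ : FiniteField.Carrier F) → IsPrimitive F γ →
       let C = CyclotomicClass F γ N {{m^n≢0 127 m}}
           D = ⋃ (Fin (127 ^ (m ∸ 1))) (λ i → C (toℕ i))
       in 18 ∣ φ N ×
          IsMultiplicativeOrder N {{m^n≢0 127 m}} 2 f ×
          N ∣ q ∸ 1 × IsStronglyRegular (FiniteField.setoid F) (Cay F D)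
mainTheorem6 (suc k) (s≤s _) F γ prim =
  divides (127 ^ k ℕ.* 7) (φ[127^] k) ,
  subst (IsMultiplicativeOrder (127 ^ suc k) {{m^n≢0 127 (suc k)}} 2) (≡.sym f≡) order ,
  N∣q∸1 ,
  cyclotomicUnion-stronglyRegular
  where
  f≡ : φ (127 ^ suc k) / 18 ≡ 127 ^ k ℕ.* 7
  f≡ = ≡.trans (cong (_/ 18) (φ[127^] k)) (DM.m*n/n≡m (127 ^ k ℕ.* 7) 18)
  open MersennePrime 127 7 63 prime127 ≡.refl ≡.refl
  open CyclotomicUnion F γ prim 127 7 63 prime127 ≡.refl ≡.refl k (cong (2 ^_) f≡)
  order : IsMultiplicativeOrder (127 ^ suc k) {{m^n≢0 127 (suc k)}} 2 (127 ^ k ℕ.* 7)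
  order = record
    { positive = ℕ.*-mono-≤ (ℕ.>-nonZero⁻¹ (127 ^ k) {{m^n≢0 127 k}}) (s≤s z≤n)
    ; power≡1  = 2^f%N k (proj₁ (odd-power k)) (proj₂ (odd-power k))
    ; minimal  = order-minimal k (proj₁ (odd-power k)) (proj₂ (odd-power k))
    }
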